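{- The decision problem "Given a positive regular expression $E$ (over some finite alphabet), does an $(E,E)$-crossword exist?" is undecidable; in fact, it is m-equivalent to the Halting Problem.
   Context: Regular expressions are built from letters, $\varepsilon$, union, concatenation and Kleene star; a string matches $E$ if it lies in $L(E)$. For an alphabet $\Sigma$, a $\Sigma$-crossword is a nonempty $m\times n$ array ($m,n\ge1$) of symbols of $\Sigma$; an $(R,C)$-crossword is a $\Sigma$-crossword whose every row (read left to right) matches $R$ and every column (read top to bottom) matches $C$. A regular expression is positive if the empty string does not match it. Two decision problems are m-equivalent if each is many-one reducible to the other via a total computable function. The Halting Problem is the set of (encodings of) pairs $(M,w)$ of a Turing machine $M$ and an input $w$ such that $M$ halts on $w$. -}

module Defs where

open import Data.Nat using (ℕ; zero; suc; _+_)
open import Data.Fin using (Fin; zero; suc; toℕ)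
open import Data.List using (List; []; _∷_; [_]; _++_; tabulate; replicate; concatMap; length; map; allFin)
open import Data.Bool using (Bool; true; false)
open import Data.Maybe using (Maybe; just; nothing)
open import Data.Product using (Σ; ∃; _×_; _,_)
open import Relation.Nullary using (¬_)
open import Relation.Binary.PropositionalEquality using (_≡_)

data Regex (k : ℕ) : Set where
  chr  : Fin k → Regex k
  eps  : Regex k
  _∪_  : Regex k → Regex k → Regex k
  _·_  : Regex k → Regex k → Regex k
  _*   : Regex k → Regex k

data _∈L_ {k : ℕ} : List (Fin k) → Regex k → Set where
  chr      : ∀ {a} → [ a ] ∈L chr a
  eps      : [] ∈L eps
  unionˡ   : ∀ {u E F} → u ∈L E → u ∈L (E ∪ F)
  unionʳ   : ∀ {u E F} → u ∈L F → u ∈L (E ∪ F)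
  cat      : ∀ {u v E F} → u ∈L E → v ∈L F → (u ++ v) ∈L (E · F)
  star-nil : ∀ {E} → [] ∈L (E *)
  star-cons : ∀ {u v E} → u ∈L E → v ∈L (E *) → (u ++ v) ∈L (E *)

Positive : ∀ {k} → Regex k → Set
Positive E = ¬ ([] ∈L E)

-- Crosswords: an (suc m) × (suc n) array (so m,n ≥ 1 in the paper's sense)

Row : ∀ {k m n} → (Fin (suc m) → Fin (suc n) → Fin k) → Fin (suc m) → List (Fin k)
Row A i = tabulate (λ j → A i j)

Col : ∀ {k m n} → (Fin (suc m) → Fin (suc n) → Fin k) → Fin (suc n) → List (Fin k)
Col A j = tabulate (λ i → A i j)

IsCrossword : ∀ {k} → Regex k → Regex k → (m n : ℕ) → (Fin (suc m) → Fin (suc n) → Fin k) → Set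
IsCrossword R C m n A = (∀ i → Row A i ∈L R) × (∀ j → Col A j ∈L C)

CrosswordExists : ∀ {k} → Regex k → Regex k → Set
CrosswordExists {k} R C =
  Σ ℕ λ m → Σ ℕ λ n → Σ (Fin (suc m) → Fin (suc n) → Fin k) λ A → IsCrossword R C m n A

Word : Set
Word = List Bool

natBits : ℕ → Word
natBits n = replicate n true ++ [ false ]

encNats : List ℕ → Word
encNats = concatMap natBits

codeRegex : ∀ {k} → Regex k → List ℕ
codeRegex (chr a)  = 0 ∷ toℕ a ∷ []
codeRegex eps      = 1 ∷ []
codeRegex (E ∪ F)  = 2 ∷ codeRegex E ++ codeRegex F
codeRegex (E · F)  = 3 ∷ codeRegex E ++ codeRegex F
codeRegex (E *)    = 4 ∷ codeRegex E

encRegex : (k : ℕ) → Regex k → Word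
encRegex k E = encNats (k ∷ codeRegex E)

-- Turing machines (one tape, infinite in both directions)
-- tape symbols: Fin (3 + extra); zero = blank, 1 = bit false, 2 = bit true

data Move : Set where
  L R : Move

record TM : Set where
  field
    nQ    : ℕ                      -- states are Fin (suc nQ), start state zero
    extra : ℕ
    δ     : Fin (suc nQ) → Fin (3 + extra) → Maybe (Fin (suc nQ) × Fin (3 + extra) × Move)
    -- δ q x ≡ nothing  means: halt

module _ (M : TM) where
  open TM M

  Sym : Set
  Sym = Fin (3 + extra)

  blank : Sym
  blank = zero

  bitSym : Bool → Sym
  bitSym false = suc zero
  bitSym true  = suc (suc zero)

  record Config : Set where
    constructor cfg
    field
      state : Fin (suc nQ)
      left  : List Sym     -- cells to the left of the head, nearest first
      head  : Sym
      right : List Sym     -- cells to the right of the head, nearest first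

  initial : Word → Config
  initial []      = cfg zero [] blank []
  initial (b ∷ w) = cfg zero [] (bitSym b) (map bitSym w)

  moveL : Fin (suc nQ) → List Sym → Sym → List Sym → Config
  moveL q []      x r = cfg q [] blank (x ∷ r)
  moveL q (y ∷ l) x r = cfg q l y (x ∷ r)

  moveR : Fin (suc nQ) → List Sym → Sym → List Sym → Config
  moveR q l x []      = cfg q (x ∷ l) blank []
  moveR q l x (y ∷ r) = cfg q (x ∷ l) y r

  stepWith : Config → Maybe (Fin (suc nQ) × Sym × Move) → Config
  stepWith c nothing = c
  stepWith (cfg _ l _ r) (just (q , x , L)) = moveL q l x r
  stepWith (cfg _ l _ r) (just (q , x , R)) = moveR q l x r

  step : Config → Config
  step c = stepWith c (δ (Config.state c) (Config.head c))

  run : ℕ → Config → Config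
  run zero    c = c
  run (suc n) c = run n (step c)

  Halted : Config → Set
  Halted c = δ (Config.state c) (Config.head c) ≡ nothing

  readBits : List Sym → Word
  readBits [] = []
  readBits (zero ∷ _) = []
  readBits (suc zero ∷ s) = false ∷ readBits s
  readBits (suc (suc zero) ∷ s) = true ∷ readBits s
  readBits (suc (suc (suc _)) ∷ _) = []

  output : Config → Word
  output (cfg _ _ x r) = readBits (x ∷ r)

  HaltsOn : Word → Set
  HaltsOn w = ∃ λ n → Halted (run n (initial w))

  Computes : (Word → Word) → Set
  Computes f = ∀ w → ∃ λ n → Halted (run n (initial w)) × output (run n (initial w)) ≡ f w

Computable : (Word → Word) → Set
Computable f = ∃ λ (M : TM) → Computes M f

Problem : Set₁
Problem = Word → Set

_≤m_ : Problem → Problem → Set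
A ≤m B = ∃ λ (f : Word → Word) → Computable f × (∀ w → (A w → B (f w)) × (B (f w) → A w))

_≡m_ : Problem → Problem → Set
A ≡m B = (A ≤m B) × (B ≤m A)

Decidable : Problem → Set
Decidable A = ∃ λ (f : Word → Word) → Computable f ×
  (∀ w → (A w → f w ≡ [ true ]) × (¬ A w → f w ≡ [ false ]))

codeMove : Move → ℕ
codeMove L = 0
codeMove R = 1

codeEntry : ∀ {q s} → Maybe (Fin q × Fin s × Move) → List ℕ
codeEntry nothing = 0 ∷ []
codeEntry (just (q , x , m)) = 1 ∷ toℕ q ∷ toℕ x ∷ codeMove m ∷ []

codeTM : TM → List ℕ
codeTM M = nQ ∷ extra ∷
  concatMap (λ q → concatMap (λ x → codeEntry (δ q x)) (allFin (3 + extra))) (allFin (suc nQ))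
  where open TM M

codeBit : Bool → ℕ
codeBit false = 0
codeBit true  = 1

encPair : TM → Word → Word
encPair M w = encNats (codeTM M ++ length w ∷ map codeBit w)

HaltingProblem : Problem
HaltingProblem x = ∃ λ (M : TM) → ∃ λ (w : Word) → (x ≡ encPair M w) × HaltsOn M w

CrosswordProblem : Problem
CrosswordProblem x = ∃ λ (k : ℕ) → ∃ λ (E : Regex k) →
  (x ≡ encRegex k E) × Positive E × CrosswordExists E E

{-# OPTIONS --safe #-}
-- Both problems are semidecidable (a witness is a finite certificate that a program can check), and every
-- semidecidable problem reduces to both of them, so they are m-equivalent; a decider for crosswords would
-- decide halting, which the usual diagonal machine refutes.
--
-- Programs are terms of a small total language. They are evaluated on binary trees by a machine with four stacks,
-- the stacks being tracks on the tape of a Turing machine; semidecision is an unbounded search on top of this.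
--
-- For a machine M and an input w, the rows of a crossword are the successive configurations of M, written with
-- tiles (content before, content after) so that a row checks one step and a column checks that consecutive tiles
-- fit. A single expression E serves for rows and columns: the letters of row 0 and column 0 announce the kind of
-- word that starts there, and a wall next to the row marks ensures that exactly one of row 0 and column 0
-- spells the initial configuration, so that every (E,E)-crossword is a computation or the transpose of one.

module Submission where

open import Defs
open import Data.Bool using (Bool; true; false; if_then_else_)
open import Data.Empty using (⊥-elim; ⊥)
open import Data.Fin using (Fin; zero; suc; splitAt; join; combine; remQuot; toℕ; fromℕ<)
open import Data.Fin.Properties using (splitAt-join; remQuot-combine; toℕ-fromℕ<; toℕ<n; toℕ-injective)
open import Data.List using (List; []; _∷_; [_]; _++_; foldl; foldr; reverse; _ʳ++_; replicate; map; length; tabulate; allFin; concatMap; upTo; applyUpTo)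
open import Data.List.Membership.Propositional using (_∈_)
open import Data.List.Membership.Propositional.Properties using (∈-map⁺; ∈-allFin)
open import Data.List.Properties using (reverse-foldr; reverse-involutive; ++-assoc; ++-identityʳ; ++-ʳ++; ʳ++-ʳ++; unfold-reverse; length-++; map-++; map-∘; map-cong; ∷-injectiveˡ; ∷-injectiveʳ; length-map; length-reverse; reverse-++; reverse-map; map-tabulate; tabulate-cong; map-injective; map-id; map-upTo; ++-is-foldr; concatMap-++)
open import Data.List.Relation.Unary.All using (All; []; _∷_; lookup)
open import Data.List.Relation.Unary.Any using (here; there)
import Data.Maybe as Maybe
open import Data.Maybe using (Maybe; just; nothing; maybe)
open import Data.Nat using (ℕ; zero; suc; _+_; _*_; _≟_; _≤_; _<_; z≤n; s≤s; pred; _⊔_; _∸_)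
open import Data.Nat.Properties using (+-suc; +-identityʳ; +-comm; suc-injective; 1+n≢n; ≤-refl; n≤1+n; ≤-trans; <⇒≢; m≤n+m; <-irrefl; m≤n⇒m<n∨m≡n; m≤m⊔n; m≤n⊔m; m≤m+n; 0∸n≡0; m∸n≡0⇒m≤n; ≤-antisym; m≤n⇒m∸n≡0; n∸n≡0; m∸n≤m; +-∸-assoc)
open import Data.Product using (∃; _×_; _,_; proj₁; proj₂; uncurry)
open import Data.Sum using (_⊎_; inj₁; inj₂)
open import Data.Unit using (⊤; tt)
open import Function using (_∘_; id)
open import Relation.Binary.PropositionalEquality using (_≡_; _≢_; refl; sym; trans; cong; cong₂; subst)
open import Relation.Nullary using (¬_; yes; no)
open import Relation.Nullary.Decidable using (dec-true; dec-false; does)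

-- Programs on binary trees

-- `Computable` demands an actual Turing machine, so every check and every reduction has to be
-- carried down to one. This is why the programs have a single loop construct: each layer of the
-- translation then needs one loop argument, and non-termination enters only through one outer loop.
--
-- Neither problem needs a parser. A certificate contains the machine or the expression itself; the
-- check encodes it afresh and compares the result with the instance. Injectivity of the encodings
-- serves the opposite purpose: a statement about a code is to be read back as one about the given
-- machine or expression.
--
-- A crossword has a fixed width whereas a tape grows. The language therefore lets row 0 surround
-- the input by any number of blanks, and a run of `t` steps fits once there is a cell to spare per
-- step on either side. The price is that computations have to be compared up to blanks.
--
-- Functions are only ever compared pointwise, and no argument distinguishes cases on whether a
-- machine halts.

data Tree : Set where
  leaf : Tree
  node : Tree → Tree → Tree

data Prog : Set where
  idₚ leafₚ fstₚ sndₚ : Prog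
  _⨾_ ⟨_,_⟩           : Prog → Prog → Prog
  foldₚ               : Prog → Prog

infixr 5 _⨾_

-- Lists are encoded as right spines and numbers as right spines with leaves as entries, so this one
-- recursor drives iteration, both list folds and branching. The step receives the state paired with
-- the entry.
foldSpine : (Tree → Tree) → Tree → Tree → Tree
foldSpine g s leaf       = s
foldSpine g s (node x l) = foldSpine g (g (node s x)) l

⟦_⟧ : Prog → Tree → Tree
⟦ idₚ ⟧       t          = t
⟦ leafₚ ⟧     t          = leaf
⟦ fstₚ ⟧      leaf       = leaf
⟦ fstₚ ⟧      (node a b) = a
⟦ sndₚ ⟧      leaf       = leaf
⟦ sndₚ ⟧      (node a b) = b
⟦ p ⨾ q ⟧     t          = ⟦ q ⟧ (⟦ p ⟧ t)
⟦ ⟨ p , q ⟩ ⟧ t          = node (⟦ p ⟧ t) (⟦ q ⟧ t)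
⟦ foldₚ p ⟧   leaf       = leaf
⟦ foldₚ p ⟧   (node l s) = foldSpine ⟦ p ⟧ s l

constₚ : Tree → Prog
constₚ leaf       = leafₚ
constₚ (node a b) = ⟨ constₚ a , constₚ b ⟩

⟦constₚ⟧ : ∀ a t → ⟦ constₚ a ⟧ t ≡ a
⟦constₚ⟧ leaf       t = refl
⟦constₚ⟧ (node a b) t = cong₂ node (⟦constₚ⟧ a t) (⟦constₚ⟧ b t)

-- Branching is a loop over the condition: a step turns `node a b` into `node a a`, so the second
-- component is `a` after any positive number of steps and `b` after none. Both branches are
-- evaluated, which is harmless because all programs are total.
selectStep : Prog
selectStep = fstₚ ⨾ ⟨ fstₚ , fstₚ ⟩

select : Prog → Prog → Prog → Prog
select c p q = ⟨ c , ⟨ p , q ⟩ ⟩ ⨾ foldₚ selectStep ⨾ sndₚ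

foldSpine-select : ∀ a l → foldSpine ⟦ selectStep ⟧ (node a a) l ≡ node a a
foldSpine-select a leaf       = refl
foldSpine-select a (node x l) = foldSpine-select a l

select-node : ∀ c p q t {x l} → ⟦ c ⟧ t ≡ node x l → ⟦ select c p q ⟧ t ≡ ⟦ p ⟧ t
select-node c p q t {x} {l} eq rewrite eq | foldSpine-select (⟦ p ⟧ t) l = refl

select-leaf : ∀ c p q t → ⟦ c ⟧ t ≡ leaf → ⟦ select c p q ⟧ t ≡ ⟦ q ⟧ t
select-leaf c p q t eq rewrite eq = refl

-- A typed term language and its compilation to tree programs

infixr 6 _⊗_

data Ty : Set where
  bool nat : Ty
  list     : Ty → Ty
  _⊗_      : Ty → Ty → Ty

Val : Ty → Set
Val bool     = Bool
Val nat      = ℕ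
Val (list τ) = List (Val τ)
Val (σ ⊗ τ)  = Val σ × Val τ

encode : ∀ τ → Val τ → Tree
encode bool     false    = leaf
encode bool     true     = node leaf leaf
encode nat      zero     = leaf
encode nat      (suc n)  = node leaf (encode nat n)
encode (list τ) []       = leaf
encode (list τ) (v ∷ vs) = node (encode τ v) (encode (list τ) vs)
encode (σ ⊗ τ)  (u , v)  = node (encode σ u) (encode τ v)

Ctx : Set
Ctx = List Ty

Env : Ctx → Set
Env = All Val

encodeEnv : ∀ {Γ} → Env Γ → Tree
encodeEnv []                = leaf
encodeEnv (_∷_ {x = τ} v γ) = node (encode τ v) (encodeEnv γ)

data Tm (Γ : Ctx) : Ty → Set where
  var     : ∀ {τ} → τ ∈ Γ → Tm Γ τ
  lit     : ∀ {τ} → Val τ → Tm Γ τ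
  call    : ∀ {Δ τ} → Tm Δ τ → All (Tm Γ) Δ → Tm Γ τ
  pairₜ   : ∀ {σ τ} → Tm Γ σ → Tm Γ τ → Tm Γ (σ ⊗ τ)
  fstₜ    : ∀ {σ τ} → Tm Γ (σ ⊗ τ) → Tm Γ σ
  sndₜ    : ∀ {σ τ} → Tm Γ (σ ⊗ τ) → Tm Γ τ
  ifₜ     : ∀ {τ} → Tm Γ bool → Tm Γ τ → Tm Γ τ → Tm Γ τ
  sucₜ    : Tm Γ nat → Tm Γ nat
  consₜ   : ∀ {τ} → Tm Γ τ → Tm Γ (list τ) → Tm Γ (list τ)
  iterₜ   : ∀ {τ} → Tm Γ nat → Tm Γ τ → Tm (τ ∷ Γ) τ → Tm Γ τ
  caseNₜ  : ∀ {τ} → Tm Γ nat → Tm Γ τ → Tm (nat ∷ Γ) τ → Tm Γ τ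
  caseLₜ  : ∀ {σ τ} → Tm Γ (list σ) → Tm Γ τ → Tm (σ ∷ list σ ∷ Γ) τ → Tm Γ τ
  foldlₜ  : ∀ {σ τ} → Tm Γ (list σ) → Tm Γ τ → Tm (σ ∷ τ ∷ Γ) τ → Tm Γ τ
  foldrₜ  : ∀ {σ τ} → Tm Γ (list σ) → Tm Γ τ → Tm (σ ∷ τ ∷ Γ) τ → Tm Γ τ

iter : {A : Set} → (A → A) → A → ℕ → A
iter f z zero    = z
iter f z (suc n) = iter f (f z) n

caseN : {A : Set} → ℕ → A → (ℕ → A) → A
caseN zero    z f = z
caseN (suc n) z f = f n

caseL : {A B : Set} → List B → A → (B → List B → A) → A
caseL []      z f = z
caseL (x ∷ l) z f = f x l

eval  : ∀ {Γ τ} → Tm Γ τ → Env Γ → Val τ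
evals : ∀ {Γ Δ} → All (Tm Γ) Δ → Env Γ → Env Δ
eval (var i)        γ = lookup γ i
eval (lit v)        γ = v
eval (call t ts)    γ = eval t (evals ts γ)
eval (pairₜ t u)    γ = eval t γ , eval u γ
eval (fstₜ t)       γ = proj₁ (eval t γ)
eval (sndₜ t)       γ = proj₂ (eval t γ)
eval (ifₜ t u v)    γ = if eval t γ then eval u γ else eval v γ
eval (sucₜ t)       γ = suc (eval t γ)
eval (consₜ t u)    γ = eval t γ ∷ eval u γ
eval (iterₜ n z f)  γ = iter (λ a → eval f (a ∷ γ)) (eval z γ) (eval n γ)
eval (caseNₜ n z f) γ = caseN (eval n γ) (eval z γ) (λ m → eval f (m ∷ γ))
eval (caseLₜ l z f) γ = caseL (eval l γ) (eval z γ) (λ x xs → eval f (x ∷ xs ∷ γ))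
eval (foldlₜ l z f) γ = foldl (λ a x → eval f (x ∷ a ∷ γ)) (eval z γ) (eval l γ)
eval (foldrₜ l z f) γ = foldr (λ x a → eval f (x ∷ a ∷ γ)) (eval z γ) (eval l γ)
evals []       γ = []
evals (t ∷ ts) γ = eval t γ ∷ evals ts γ

varₚ : ∀ {Γ} {τ : Ty} → τ ∈ Γ → Prog
varₚ (here _)  = fstₚ
varₚ (there i) = sndₚ ⨾ varₚ i

-- The body of a fold sees only the state and the current entry, so the environment travels along as
-- the second component of the state and is dropped at the end.
loopₚ : Prog → Prog → Prog → Prog
loopₚ l z f = ⟨ l , ⟨ z , idₚ ⟩ ⟩ ⨾ foldₚ ⟨ f , fstₚ ⨾ sndₚ ⟩ ⨾ fstₚ

reverseₚ : Prog
reverseₚ = ⟨ idₚ , leafₚ ⟩ ⨾ foldₚ ⟨ sndₚ , fstₚ ⟩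

branchN branchL : Prog → Prog → Prog
branchN n f = ⟨ n ⨾ sndₚ , idₚ ⟩ ⨾ f
branchL l f = ⟨ l ⨾ fstₚ , ⟨ l ⨾ sndₚ , idₚ ⟩ ⟩ ⨾ f

compile  : ∀ {Γ τ} → Tm Γ τ → Prog
compiles : ∀ {Γ Δ} → All (Tm Γ) Δ → Prog
compile (var i)        = varₚ i
compile (lit {τ} v)    = constₚ (encode τ v)
compile (call t ts)    = compiles ts ⨾ compile t
compile (pairₜ t u)    = ⟨ compile t , compile u ⟩
compile (fstₜ t)       = compile t ⨾ fstₚ
compile (sndₜ t)       = compile t ⨾ sndₚ
compile (ifₜ t u v)    = select (compile t) (compile u) (compile v)
compile (sucₜ t)       = ⟨ leafₚ , compile t ⟩
compile (consₜ t u)    = ⟨ compile t , compile u ⟩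
compile (iterₜ n z f)  = loopₚ (compile n) (compile z) (fstₚ ⨾ compile f)
compile (caseNₜ n z f) = select (compile n) (branchN (compile n) (compile f)) (compile z)
compile (caseLₜ l z f) = select (compile l) (branchL (compile l) (compile f)) (compile z)
compile (foldlₜ l z f) = loopₚ (compile l) (compile z) (⟨ sndₚ , fstₚ ⟩ ⨾ compile f)
-- The loop consumes a list from its front, so a right fold runs over the reversed list.
compile (foldrₜ l z f) = loopₚ (compile l ⨾ reverseₚ) (compile z) (⟨ sndₚ , fstₚ ⟩ ⨾ compile f)
compiles []       = leafₚ
compiles (t ∷ ts) = ⟨ compile t , compiles ts ⟩

varₚ-correct : ∀ {Γ τ} (i : τ ∈ Γ) (γ : Env Γ) → ⟦ varₚ i ⟧ (encodeEnv γ) ≡ encode τ (lookup γ i)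
varₚ-correct (here refl) (v ∷ γ) = refl
varₚ-correct (there i)   (v ∷ γ) = varₚ-correct i γ

foldSpine-list : ∀ {σ} {A : Set} (e : A → Tree) (g : Tree → Tree) (h : A → Val σ → A) →
  (∀ a x → g (node (e a) (encode σ x)) ≡ e (h a x)) →
  ∀ l a → foldSpine g (e a) (encode (list σ) l) ≡ e (foldl h a l)
foldSpine-list e g h ok []      a = refl
foldSpine-list e g h ok (x ∷ l) a rewrite ok a x = foldSpine-list e g h ok l (h a x)

foldSpine-nat : {A : Set} (e : A → Tree) (g : Tree → Tree) (h : A → A) →
  (∀ a → g (node (e a) leaf) ≡ e (h a)) →
  ∀ n a → foldSpine g (e a) (encode nat n) ≡ e (iter h a n)
foldSpine-nat e g h ok zero    a = refl
foldSpine-nat e g h ok (suc n) a rewrite ok a = foldSpine-nat e g h ok n (h a)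

reverseₚ-correct : ∀ {σ} (l : List (Val σ)) → ⟦ reverseₚ ⟧ (encode (list σ) l) ≡ encode (list σ) (reverse l)
reverseₚ-correct {σ} l = foldSpine-list (encode (list σ)) _ _ (λ _ _ → refl) l []

foldl-reverse′ : {A B : Set} (f : B → A → A) (z : A) (l : List B) →
  foldl (λ a x → f x a) z (reverse l) ≡ foldr f z l
foldl-reverse′ f z l = trans (sym (reverse-foldr f z (reverse l))) (cong (foldr f z) (reverse-involutive l))

compile-correct  : ∀ {Γ τ} (t : Tm Γ τ) (γ : Env Γ) → ⟦ compile t ⟧ (encodeEnv γ) ≡ encode τ (eval t γ)
compiles-correct : ∀ {Γ Δ} (ts : All (Tm Γ) Δ) (γ : Env Γ) → ⟦ compiles ts ⟧ (encodeEnv γ) ≡ encodeEnv (evals ts γ)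
compile-correct (var i)     γ = varₚ-correct i γ
compile-correct (lit v)     γ = ⟦constₚ⟧ _ _
compile-correct (call t ts) γ rewrite compiles-correct ts γ = compile-correct t (evals ts γ)
compile-correct (pairₜ t u) γ = cong₂ node (compile-correct t γ) (compile-correct u γ)
compile-correct (fstₜ t)    γ rewrite compile-correct t γ = refl
compile-correct (sndₜ t)    γ rewrite compile-correct t γ = refl
compile-correct (ifₜ t u v) γ with eval t γ | compile-correct t γ
... | true  | eq = trans (select-node (compile t) (compile u) (compile v) _ eq) (compile-correct u γ)
... | false | eq = trans (select-leaf (compile t) (compile u) (compile v) _ eq) (compile-correct v γ)
compile-correct (sucₜ t)    γ = cong (node leaf) (compile-correct t γ)
compile-correct (consₜ t u) γ = cong₂ node (compile-correct t γ) (compile-correct u γ)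
compile-correct (iterₜ {τ} n z f) γ rewrite compile-correct n γ | compile-correct z γ =
  cong ⟦ fstₚ ⟧ (foldSpine-nat (λ a → node (encode τ a) (encodeEnv γ)) _ _
    (λ a → cong (λ t → node t (encodeEnv γ)) (compile-correct f (a ∷ γ))) (eval n γ) (eval z γ))
compile-correct (caseNₜ n z f) γ with eval n γ | compile-correct n γ
... | zero  | eq = trans (select-leaf (compile n) (branchN (compile n) (compile f)) (compile z) _ eq) (compile-correct z γ)
... | suc m | eq = trans (select-node (compile n) (branchN (compile n) (compile f)) (compile z) _ eq)
  (trans (cong (λ t → ⟦ compile f ⟧ (node (⟦ sndₚ ⟧ t) (encodeEnv γ))) eq) (compile-correct f (m ∷ γ)))
compile-correct (caseLₜ l z f) γ with eval l γ | compile-correct l γ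
... | []     | eq = trans (select-leaf (compile l) (branchL (compile l) (compile f)) (compile z) _ eq) (compile-correct z γ)
... | x ∷ xs | eq = trans (select-node (compile l) (branchL (compile l) (compile f)) (compile z) _ eq)
  (trans (cong (λ t → ⟦ compile f ⟧ (node (⟦ fstₚ ⟧ t) (node (⟦ sndₚ ⟧ t) (encodeEnv γ)))) eq)
         (compile-correct f (x ∷ xs ∷ γ)))
compile-correct (foldlₜ {σ} {τ} l z f) γ rewrite compile-correct l γ | compile-correct z γ =
  cong ⟦ fstₚ ⟧ (foldSpine-list (λ a → node (encode τ a) (encodeEnv γ)) _ _
    (λ a x → cong (λ t → node t (encodeEnv γ)) (compile-correct f (x ∷ a ∷ γ))) (eval l γ) (eval z γ))
compile-correct (foldrₜ {σ} {τ} l z f) γ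
  rewrite compile-correct l γ | reverseₚ-correct {σ} (eval l γ) | compile-correct z γ =
  trans (cong ⟦ fstₚ ⟧ (foldSpine-list (λ a → node (encode τ a) (encodeEnv γ)) _ _
    (λ a x → cong (λ t → node t (encodeEnv γ)) (compile-correct f (x ∷ a ∷ γ))) (reverse (eval l γ)) (eval z γ)))
    (cong (encode τ) (foldl-reverse′ _ (eval z γ) (eval l γ)))
compiles-correct []       γ = refl
compiles-correct (t ∷ ts) γ = cong₂ node (compile-correct t γ) (compiles-correct ts γ)

-- A machine with four stacks

data Track : Set where
  io main aux cnt : Track

record Stacks : Set where
  constructor ⟪_,_,_,_⟫
  field ioₛ mainₛ auxₛ cntₛ : List Bool
open Stacks

get : Track → Stacks → List Bool
get io   = ioₛ
get main = mainₛ
get aux  = auxₛ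
get cnt  = cntₛ

set : Track → List Bool → Stacks → Stacks
set io   l ⟪ i , a , b , c ⟫ = ⟪ l , a , b , c ⟫
set main l ⟪ i , a , b , c ⟫ = ⟪ i , l , b , c ⟫
set aux  l ⟪ i , a , b , c ⟫ = ⟪ i , a , l , c ⟫
set cnt  l ⟪ i , a , b , c ⟫ = ⟪ i , a , b , l ⟫

infixr 5 _⨟_

data Stm : Set where
  nop   : Stm
  push  : Track → Bool → Stm
  _⨟_   : Stm → Stm → Stm
  case  : Track → (onEmpty onFalse onTrue : Stm) → Stm
  while : Track → (onFalse onTrue : Stm) → Stm

infix 3 _∋_⇓_

data _∋_⇓_ : Stm → Stacks → Stacks → Set where
  nop   : ∀ {σ} → nop ∋ σ ⇓ σ
  push  : ∀ {σ k b} → push k b ∋ σ ⇓ set k (b ∷ get k σ) σ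
  _⨟_   : ∀ {p q σ σ′ σ″} → p ∋ σ ⇓ σ′ → q ∋ σ′ ⇓ σ″ → p ⨟ q ∋ σ ⇓ σ″
  caseE : ∀ {k e f t σ σ′} → get k σ ≡ [] → e ∋ σ ⇓ σ′ → case k e f t ∋ σ ⇓ σ′
  caseF : ∀ {k e f t σ σ′ l} → get k σ ≡ false ∷ l → f ∋ set k l σ ⇓ σ′ → case k e f t ∋ σ ⇓ σ′
  caseT : ∀ {k e f t σ σ′ l} → get k σ ≡ true ∷ l → t ∋ set k l σ ⇓ σ′ → case k e f t ∋ σ ⇓ σ′
  whileE : ∀ {k f t σ} → get k σ ≡ [] → while k f t ∋ σ ⇓ σ
  whileF : ∀ {k f t σ σ′ σ″ l} → get k σ ≡ false ∷ l → f ∋ set k l σ ⇓ σ′ → while k f t ∋ σ′ ⇓ σ″ →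
           while k f t ∋ σ ⇓ σ″
  whileT : ∀ {k f t σ σ′ σ″ l} → get k σ ≡ true ∷ l → t ∋ set k l σ ⇓ σ′ → while k f t ∋ σ′ ⇓ σ″ →
           while k f t ∋ σ ⇓ σ″

fromMain : ∀ {p i a a′ b c σ} → a ≡ a′ → p ∋ ⟪ i , a′ , b , c ⟫ ⇓ σ → p ∋ ⟪ i , a , b , c ⟫ ⇓ σ
fromMain refl d = d

toMain : ∀ {p i a a′ b c σ} → a ≡ a′ → p ∋ σ ⇓ ⟪ i , a , b , c ⟫ → p ∋ σ ⇓ ⟪ i , a′ , b , c ⟫
toMain refl d = d

toIo : ∀ {p i i′ a b c σ} → i ≡ i′ → p ∋ σ ⇓ ⟪ i , a , b , c ⟫ → p ∋ σ ⇓ ⟪ i′ , a , b , c ⟫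
toIo refl d = d

-- Preorder codes are self-delimiting: several trees can lie on one track without separators, and
-- the end of the topmost one is found by counting the subtrees still due.
pre : Tree → List Bool
pre leaf       = false ∷ []
pre (node a b) = true ∷ pre a ++ pre b

pour : Track → Track → Stm
pour j k = while j (push k false) (push k true)

-- cnt holds the number of subtrees still to be moved.
moveLoop : Track → Stm
moveLoop k = while cnt nop (case main nop (push k false) (push k true ⨟ push cnt true ⨟ push cnt true))

moveTree : Track → Stm
moveTree k = push cnt true ⨟ moveLoop k

-- Each transfer to another track reverses the bits, so a tree must be transferred an even number of
-- times to become readable again. In `dup` the copy that reaches `io` has been transferred twice,
-- hence it takes two more transfers, through `aux`, to get back to `main`.
drop dup swap : Stm
drop = moveTree aux ⨟ while aux nop nop
dup  = moveTree aux ⨟ while aux (push main false ⨟ push io false) (push main true ⨟ push io true) ⨟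
       pour io aux ⨟ pour aux main
swap = moveTree aux ⨟ moveTree io ⨟ pour aux main ⨟ pour io main

-- The state waits on `aux` while the list is consumed on `main`. Once the state is poured on top of
-- the next entry, a single bit `true` turns the two codes into the code of `node s x`. The flag on
-- `cnt` has been popped by then, so the body finds `io`, `aux` and `cnt` empty and may use them.
foldLoop : Stm → Stm
foldLoop s = while cnt nop (case main nop nop
  (pour aux main ⨟ push main true ⨟ s ⨟ moveTree aux ⨟ push cnt true))

implement : Prog → Stm
implement idₚ       = nop
implement leafₚ     = drop ⨟ push main false
implement fstₚ      = case main nop (push main false) (swap ⨟ drop)
implement sndₚ      = case main nop (push main false) drop
implement (p ⨾ q)   = implement p ⨟ implement q
-- `q` runs first because in preorder the left component has to end up on top.
implement ⟨ p , q ⟩ = dup ⨟ implement q ⨟ swap ⨟ implement p ⨟ push main true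
implement (foldₚ p) = case main nop (push main false)
  (swap ⨟ moveTree aux ⨟ push cnt true ⨟ foldLoop (implement p) ⨟ pour aux main)

pour-main : ∀ b {i a c} → pour aux main ∋ ⟪ i , a , b , c ⟫ ⇓ ⟪ i , b ʳ++ a , [] , c ⟫
pour-main []          = whileE refl
pour-main (false ∷ b) = whileF refl push (pour-main b)
pour-main (true ∷ b)  = whileT refl push (pour-main b)

pour-io-main : ∀ i {a b c} → pour io main ∋ ⟪ i , a , b , c ⟫ ⇓ ⟪ [] , i ʳ++ a , b , c ⟫
pour-io-main []          = whileE refl
pour-io-main (false ∷ b) = whileF refl push (pour-io-main b)
pour-io-main (true ∷ b)  = whileT refl push (pour-io-main b)

pour-io-aux : ∀ i {a b c} → pour io aux ∋ ⟪ i , a , b , c ⟫ ⇓ ⟪ [] , a , i ʳ++ b , c ⟫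
pour-io-aux []          = whileE refl
pour-io-aux (false ∷ b) = whileF refl push (pour-io-aux b)
pour-io-aux (true ∷ b)  = whileT refl push (pour-io-aux b)

pour-both : ∀ b {i a c} →
  while aux (push main false ⨟ push io false) (push main true ⨟ push io true) ∋
    ⟪ i , a , b , c ⟫ ⇓ ⟪ b ʳ++ i , b ʳ++ a , [] , c ⟫
pour-both []          = whileE refl
pour-both (false ∷ b) = whileF refl (push ⨟ push) (pour-both b)
pour-both (true ∷ b)  = whileT refl (push ⨟ push) (pour-both b)

clear-aux : ∀ b {i a c} → while aux nop nop ∋ ⟪ i , a , b , c ⟫ ⇓ ⟪ i , a , [] , c ⟫
clear-aux []          = whileE refl
clear-aux (false ∷ b) = whileF refl nop (clear-aux b)
clear-aux (true ∷ b)  = whileT refl nop (clear-aux b)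

-- Moving one subtree is only an initial stretch of the turns of a single loop, not a statement of
-- its own. The claim is therefore put in continuation form: a derivation for the remaining turns is
-- extended at its front.
moveLoop-aux : ∀ t {i a b c σ} → moveLoop aux ∋ ⟪ i , a , pre t ʳ++ b , c ⟫ ⇓ σ →
  moveLoop aux ∋ ⟪ i , pre t ++ a , b , true ∷ c ⟫ ⇓ σ
moveLoop-aux leaf       d = whileT refl (caseF refl push) d
moveLoop-aux (node s t) {i} {a} {b} {c} {σ} d = whileT refl (caseT refl (push ⨟ push ⨟ push))
  (subst (λ l → moveLoop aux ∋ ⟪ i , l , true ∷ b , true ∷ true ∷ c ⟫ ⇓ σ) (sym (++-assoc (pre s) (pre t) a))
    (moveLoop-aux s (moveLoop-aux t
      (subst (λ l → moveLoop aux ∋ ⟪ i , a , l , c ⟫ ⇓ σ) (++-ʳ++ (pre s)) d))))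

moveLoop-io : ∀ t {i a b c σ} → moveLoop io ∋ ⟪ pre t ʳ++ i , a , b , c ⟫ ⇓ σ →
  moveLoop io ∋ ⟪ i , pre t ++ a , b , true ∷ c ⟫ ⇓ σ
moveLoop-io leaf       d = whileT refl (caseF refl push) d
moveLoop-io (node s t) {i} {a} {b} {c} {σ} d = whileT refl (caseT refl (push ⨟ push ⨟ push))
  (subst (λ l → moveLoop io ∋ ⟪ true ∷ i , l , b , true ∷ true ∷ c ⟫ ⇓ σ) (sym (++-assoc (pre s) (pre t) a))
    (moveLoop-io s (moveLoop-io t
      (subst (λ l → moveLoop io ∋ ⟪ l , a , b , c ⟫ ⇓ σ) (++-ʳ++ (pre s)) d))))

moveTree-aux : ∀ t {i a b} → moveTree aux ∋ ⟪ i , pre t ++ a , b , [] ⟫ ⇓ ⟪ i , a , pre t ʳ++ b , [] ⟫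
moveTree-aux t = push ⨟ moveLoop-aux t (whileE refl)

moveTree-io : ∀ t {i a b} → moveTree io ∋ ⟪ i , pre t ++ a , b , [] ⟫ ⇓ ⟪ pre t ʳ++ i , a , b , [] ⟫
moveTree-io t = push ⨟ moveLoop-io t (whileE refl)

unpour-main : ∀ t {i a c} → pour aux main ∋ ⟪ i , a , pre t ʳ++ [] , c ⟫ ⇓ ⟪ i , pre t ++ a , [] , c ⟫
unpour-main t = toMain (ʳ++-ʳ++ (pre t)) (pour-main (pre t ʳ++ []))

drop-⇓ : ∀ t {i a} → drop ∋ ⟪ i , pre t ++ a , [] , [] ⟫ ⇓ ⟪ i , a , [] , [] ⟫
drop-⇓ t = moveTree-aux t ⨟ clear-aux _

swap-⇓ : ∀ s t {a} → swap ∋ ⟪ [] , pre s ++ pre t ++ a , [] , [] ⟫ ⇓ ⟪ [] , pre t ++ pre s ++ a , [] , [] ⟫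
swap-⇓ s t = moveTree-aux s ⨟ moveTree-io t ⨟ unpour-main s ⨟
  toMain (ʳ++-ʳ++ (pre t)) (pour-io-main (pre t ʳ++ []))

dup-⇓ : ∀ t {a} → dup ∋ ⟪ [] , pre t ++ a , [] , [] ⟫ ⇓ ⟪ [] , pre t ++ pre t ++ a , [] , [] ⟫
dup-⇓ t = moveTree-aux t ⨟
  toIo (trans (ʳ++-ʳ++ (pre t)) (++-identityʳ (pre t))) (toMain (ʳ++-ʳ++ (pre t)) (pour-both (pre t ʳ++ []))) ⨟
  pour-io-aux (pre t) ⨟ unpour-main t

-- The invariant behind the induction: the other three tracks are empty before and after, and
-- whatever lies below the argument on `main` is preserved. The latter allows pending operands to be
-- kept there.
implement-⇓ : ∀ p t {a} → implement p ∋ ⟪ [] , pre t ++ a , [] , [] ⟫ ⇓ ⟪ [] , pre (⟦ p ⟧ t) ++ a , [] , [] ⟫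

foldLoop-⇓ : ∀ p l s {a} → foldLoop (implement p) ∋ ⟪ [] , pre l ++ a , pre s ʳ++ [] , true ∷ [] ⟫ ⇓
  ⟪ [] , a , pre (foldSpine ⟦ p ⟧ s l) ʳ++ [] , [] ⟫

implement-⇓ idₚ t = nop
implement-⇓ leafₚ t = drop-⇓ t ⨟ push
implement-⇓ fstₚ leaf = caseF refl push
implement-⇓ fstₚ (node s t) {a} = caseT refl
  (fromMain (++-assoc (pre s) (pre t) a) (swap-⇓ s t) ⨟ drop-⇓ t)
implement-⇓ sndₚ leaf = caseF refl push
implement-⇓ sndₚ (node s t) {a} = caseT refl
  (fromMain (++-assoc (pre s) (pre t) a) (drop-⇓ s))
implement-⇓ (p ⨾ q) t = implement-⇓ p t ⨟ implement-⇓ q (⟦ p ⟧ t)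
implement-⇓ ⟨ p , q ⟩ t {a} = dup-⇓ t ⨟ implement-⇓ q t ⨟ swap-⇓ (⟦ q ⟧ t) t ⨟ implement-⇓ p t ⨟
  toMain (cong (true ∷_) (sym (++-assoc (pre (⟦ p ⟧ t)) _ _))) push
implement-⇓ (foldₚ p) leaf = caseF refl push
implement-⇓ (foldₚ p) (node l s) {a} = caseT refl
  (fromMain (++-assoc (pre l) (pre s) a) (swap-⇓ l s) ⨟
   moveTree-aux s ⨟ push ⨟ foldLoop-⇓ p l s ⨟ unpour-main (foldSpine ⟦ p ⟧ s l))

foldLoop-⇓ p leaf s = whileT refl (caseF refl nop) (whileE refl)
foldLoop-⇓ p (node x l) s {a} = whileT refl
  (caseT refl (unpour-main s ⨟ push ⨟
    fromMain (cong (true ∷_) (trans (cong (pre s ++_) (++-assoc (pre x) (pre l) a)) (sym (++-assoc (pre s) (pre x) _)))) (implement-⇓ p (node s x)) ⨟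
    moveTree-aux (⟦ p ⟧ (node s x)) ⨟ push))
  (foldLoop-⇓ p l (⟦ p ⟧ (node s x)))

-- The top of `io` is the last letter of the word, so consing the letters as they are popped yields
-- the word in its proper order. The bits of each code are pushed back to front: the code of the
-- letter, then `true` for the cons node.
readLoop : Stm
readLoop = while io (push main false ⨟ push main true)
                    (push main false ⨟ push main false ⨟ push main true ⨟ push main true)

readWord : Stm
readWord = push main false ⨟ readLoop

writeLoop : Stm
writeLoop = while cnt nop (case main nop nop (case main nop
    (push io false) (case main nop nop nop ⨟ case main nop nop nop ⨟ push io true) ⨟ push cnt true))

writeWord : Stm
writeWord = push cnt true ⨟ writeLoop

readLoop-⇓ : ∀ w {v b c} → readLoop ∋ ⟪ w , pre (encode (list bool) v) , b , c ⟫ ⇓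
  ⟪ [] , pre (encode (list bool) (w ʳ++ v)) , b , c ⟫
readLoop-⇓ []          = whileE refl
readLoop-⇓ (false ∷ w) = whileF refl (push ⨟ push) (readLoop-⇓ w)
readLoop-⇓ (true ∷ w)  = whileT refl (push ⨟ push ⨟ push ⨟ push) (readLoop-⇓ w)

readWord-⇓ : ∀ w → readWord ∋ ⟪ reverse w , [] , [] , [] ⟫ ⇓ ⟪ [] , pre (encode (list bool) w) , [] , [] ⟫
readWord-⇓ w = push ⨟ toMain (cong (λ l → pre (encode (list bool) l)) (trans (ʳ++-ʳ++ w) (++-identityʳ w)))
  (readLoop-⇓ (reverse w) {[]})

writeLoop-⇓ : ∀ w {i b} → writeLoop ∋ ⟪ i , pre (encode (list bool) w) , b , true ∷ [] ⟫ ⇓ ⟪ w ʳ++ i , [] , b , [] ⟫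
writeLoop-⇓ []          = whileT refl (caseF refl nop) (whileE refl)
writeLoop-⇓ (false ∷ w) = whileT refl (caseT refl (caseF refl push ⨟ push)) (writeLoop-⇓ w)
writeLoop-⇓ (true ∷ w)  = whileT refl (caseT refl (caseT refl (caseF refl nop ⨟ caseF refl nop ⨟ push) ⨟ push))
  (writeLoop-⇓ w)

writeWord-⇓ : ∀ w → writeWord ∋ ⟪ [] , pre (encode (list bool) w) , [] , [] ⟫ ⇓ ⟪ reverse w , [] , [] , [] ⟫
writeWord-⇓ w = push ⨟ writeLoop-⇓ w

-- Turing machines simulating the stack machine

nth : {A : Set} → A → List A → ℕ → A
nth d []      i       = d
nth d (x ∷ l) zero    = x
nth d (x ∷ l) (suc i) = nth d l i

module _ (M : TM) where
  open TM M

  -- Lists do not determine how many blanks they end with, so cells are read with blank as default.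
  -- Cells to the left of position 0 are left unconstrained: the machines built below never go
  -- there.
  record Represents (c : Config M) (q : Fin (suc nQ)) (p : ℕ) (f : ℕ → Sym M) : Set where
    constructor represents
    field
      state-≡ : Config.state c ≡ q
      head-≡  : Config.head c ≡ f p
      left-≡  : ∀ j i → j + suc i ≡ p → nth zero (Config.left c) i ≡ f j
      right-≡ : ∀ i → nth zero (Config.right c) i ≡ f (suc (p + i))

  run-+ : ∀ m n c → run M (m + n) c ≡ run M n (run M m c)
  run-+ zero    n c = refl
  run-+ (suc m) n c = run-+ m n (step M c)

  halted-step : ∀ c → Halted M c → step M c ≡ c
  halted-step (cfg q l x r) h rewrite h = refl

  halted-run : ∀ n c → Halted M c → run M n c ≡ c
  halted-run zero    c h = refl
  halted-run (suc n) c h rewrite halted-step c h = halted-run n c h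

  -- A halted configuration is a fixed point of `step`. The number `N` stays the same although the
  -- run starts later, which lets it act as decreasing fuel in `finds`.
  halted-later : ∀ N m c → Halted M (run M N c) → Halted M (run M N (run M m c))
  halted-later N m c h = subst (Halted M)
    (trans (sym (halted-run m (run M N c) h))
      (trans (sym (run-+ N m c)) (trans (cong (λ k → run M k c) (+-comm N m)) (run-+ m N c)))) h

  step-right : ∀ {c q p f q′ x f′} → Represents c q p f → δ q (f p) ≡ just (q′ , x , R) →
    f′ p ≡ x → (∀ j → j ≢ p → f′ j ≡ f j) → Represents (step M c) q′ (suc p) f′
  step-right {cfg q l y r} {p = p} {f} {q′} {x} {f′} (represents refl refl lf rt) e fp fj rewrite e = go r rt
    where
    lf′ : ∀ j i → j + suc i ≡ suc p → nth zero (x ∷ l) i ≡ f′ j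
    lf′ j zero    eq = trans (sym fp) (cong f′ (sym (suc-injective (trans (trans (cong suc (sym (+-identityʳ j))) (sym (+-suc j 0))) eq))))
    lf′ j (suc i) eq = trans (lf j i eq′) (sym (fj j j≢p))
      where
      eq′ : j + suc i ≡ p
      eq′ = suc-injective (trans (sym (+-suc j (suc i))) eq)
      j≢p : j ≢ p
      j≢p refl = <⇒≢ (s≤s (m≤n+m j i)) (trans (sym eq′) (+-comm j (suc i)))
    ahead : ∀ i → f′ (suc (p + i)) ≡ f (suc (p + i))
    ahead i = fj _ (λ eq → <⇒≢ (s≤s (m≤n+m p i)) (sym (trans (cong suc (+-comm i p)) eq)))
    go : ∀ r → (∀ i → nth zero r i ≡ f (suc (p + i))) → Represents (moveR M q′ l x r) q′ (suc p) f′
    go []      rt = represents refl (trans (rt 0) (trans (sym (ahead 0)) (cong (f′ ∘ suc) (+-identityʳ p)))) lf′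
      (λ i → trans (rt (suc i)) (trans (sym (ahead (suc i))) (cong (f′ ∘ suc) (+-suc p i))))
    go (y ∷ r) rt = represents refl (trans (rt 0) (trans (sym (ahead 0)) (cong (f′ ∘ suc) (+-identityʳ p)))) lf′
      (λ i → trans (rt (suc i)) (trans (sym (ahead (suc i))) (cong (f′ ∘ suc) (+-suc p i))))

  step-left : ∀ {c q p f q′ x f′} → Represents c q (suc p) f → δ q (f (suc p)) ≡ just (q′ , x , L) →
    f′ (suc p) ≡ x → (∀ j → j ≢ suc p → f′ j ≡ f j) → Represents (step M c) q′ p f′
  step-left {cfg q l y r} {p = p} {f} {q′} {x} {f′} (represents refl refl lf rt) e fp fj rewrite e = go l lf
    where
    rt′ : ∀ i → nth zero (x ∷ r) i ≡ f′ (suc (p + i))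
    rt′ zero    = trans (sym fp) (cong (f′ ∘ suc) (sym (+-identityʳ p)))
    rt′ (suc i) = trans (rt i) (trans (sym (fj _ (λ eq → <⇒≢ (s≤s (m≤n+m p i)) (sym (trans (cong suc (+-comm i p)) (suc-injective eq))))))
      (cong (f′ ∘ suc) (sym (+-suc p i))))
    below : ∀ j k → j + k ≡ p → f′ j ≡ f j
    below j k eq = fj j (λ { refl → <⇒≢ (s≤s (m≤n+m p k)) (sym (trans (cong suc (+-comm k p)) eq)) })
    go : ∀ l → (∀ j i → j + suc i ≡ suc p → nth zero l i ≡ f j) → Represents (moveL M q′ l x r) q′ p f′
    go []      lf = represents refl (trans (lf p 0 (trans (+-suc p 0) (cong suc (+-identityʳ p)))) (sym (below p 0 (+-identityʳ p))))
      (λ j i eq → trans (lf j (suc i) (trans (+-suc j (suc i)) (cong suc eq))) (sym (below j (suc i) eq))) rt′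
    go (z ∷ l) lf = represents refl (trans (lf p 0 (trans (+-suc p 0) (cong suc (+-identityʳ p)))) (sym (below p 0 (+-identityʳ p))))
      (λ j i eq → trans (lf j (suc i) (trans (+-suc j (suc i)) (cong suc eq))) (sym (below j (suc i) eq))) rt′

-- Finite types and the encoding of stacks on tape cells

record Finite (A : Set) : Set where
  field
    size    : ℕ
    index   : A → Fin size
    at      : Fin size → A
    at-index : ∀ a → at (index a) ≡ a
open Finite

⊤-finite : Finite ⊤
⊤-finite = record { size = 1 ; index = λ _ → zero ; at = λ _ → tt ; at-index = λ _ → refl }

⊎-finite : {A B : Set} → Finite A → Finite B → Finite (A ⊎ B)
⊎-finite {A} {B} F G = record
  { size = size F + size G
  ; index = λ x → join (size F) (size G) (to x)
  ; at = λ i → from (splitAt (size F) i)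
  ; at-index = λ x → trans (cong from (splitAt-join (size F) (size G) (to x))) (from-to x) }
  where
  to : A ⊎ B → Fin (size F) ⊎ Fin (size G)
  to (inj₁ a) = inj₁ (index F a)
  to (inj₂ b) = inj₂ (index G b)
  from : Fin (size F) ⊎ Fin (size G) → A ⊎ B
  from (inj₁ i) = inj₁ (at F i)
  from (inj₂ j) = inj₂ (at G j)
  from-to : ∀ x → from (to x) ≡ x
  from-to (inj₁ a) = cong inj₁ (at-index F a)
  from-to (inj₂ b) = cong inj₂ (at-index G b)

Fin-finite : ∀ n → Finite (Fin n)
Fin-finite n = record { size = n ; index = id ; at = id ; at-index = λ _ → refl }

×-finite : {A B : Set} → Finite A → Finite B → Finite (A × B)
×-finite {A} {B} F G = record
  { size = size F * size G
  ; index = λ { (a , b) → combine (index F a) (index G b) }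
  ; at = λ i → from (remQuot (size G) i)
  ; at-index = λ { (a , b) → trans (cong from (remQuot-combine (index F a) (index G b)))
                               (cong₂ _,_ (at-index F a) (at-index G b)) } }
  where
  from : Fin (size F) × Fin (size G) → A × B
  from (i , j) = at F i , at G j

retract-finite : {A B : Set} (f : A → B) (g : B → A) → (∀ a → g (f a) ≡ a) → Finite B → Finite A
retract-finite f g gf F = record
  { size = size F ; index = λ a → index F (f a) ; at = λ i → g (at F i)
  ; at-index = λ a → trans (cong g (at-index F (f a))) (gf a) }

Maybe-finite : {A : Set} → Finite A → Finite (Maybe A)
Maybe-finite F = retract-finite {B = ⊤ ⊎ _} (maybe inj₂ (inj₁ tt)) (λ { (inj₁ _) → nothing ; (inj₂ a) → just a })
  (λ { nothing → refl ; (just a) → refl }) (⊎-finite ⊤-finite F)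

-- A tape cell shows one square of each of the four stacks (0 = empty, 1 = false, 2 = true) and a flag marking
-- the leftmost cell; the bottom of every stack is at the leftmost cell.
record Cell : Set where
  constructor cell
  field origin ioᵈ mainᵈ auxᵈ cntᵈ : Fin 3

digitAt : Track → Cell → Fin 3
digitAt io   = Cell.ioᵈ
digitAt main = Cell.mainᵈ
digitAt aux  = Cell.auxᵈ
digitAt cnt  = Cell.cntᵈ

write : Track → Fin 3 → Cell → Cell
write io   d (cell o i a b c) = cell o d a b c
write main d (cell o i a b c) = cell o i d b c
write aux  d (cell o i a b c) = cell o i a d c
write cnt  d (cell o i a b c) = cell o i a b d

mark : Fin 3 → Cell → Cell
mark o (cell _ i a b c) = cell o i a b c

-- With the io digit least significant, the symbols 0, 1, 2 are the cells holding blank, false, true on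
-- the io track and nothing else, so the initial tape already is an io stack.
Cell-finite : Finite Cell
Cell-finite = retract-finite
  (λ { (cell o i a b c) → (o , a , b , c) , i }) (λ { ((o , a , b , c) , i) → cell o i a b c }) (λ _ → refl)
  (×-finite (×-finite (Fin-finite 3) (×-finite (Fin-finite 3) (×-finite (Fin-finite 3) (Fin-finite 3)))) (Fin-finite 3))

encodeCell : Cell → Fin 243
encodeCell = index Cell-finite

decodeCell : Fin 243 → Cell
decodeCell = at Cell-finite

decode-encodeCell : ∀ x → decodeCell (encodeCell x) ≡ x
decode-encodeCell = at-index Cell-finite

data Instr (X : Set) : Set where
  nop  : X → Instr X
  push : Track → Bool → X → Instr X
  pop  : Track → (onEmpty onFalse onTrue : X) → Instr X
  stop : Instr X

-- In `back x` the head returns to the flagged cell, where the instruction at `x` begins; in `go x`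
-- it walks right to the first empty square of the stack concerned; in `popping x` it has stepped
-- back from there onto the top. Every transition moves the head, so finishing at position 0 takes a
-- step to the right and one back, hence two final states.
data State (X : Set) : Set where
  start fin₁ fin₂  : State X
  go popping back : X → State X

State-finite : {X : Set} → Finite X → Finite (State X)
State-finite {X} F = retract-finite to from from-to (⊎-finite (Fin-finite 3) (⊎-finite F (⊎-finite F F)))
  where
  to : State X → Fin 3 ⊎ (X ⊎ (X ⊎ X))
  to start       = inj₁ zero
  to fin₁        = inj₁ (suc zero)
  to fin₂        = inj₁ (suc (suc zero))
  to (go x)      = inj₂ (inj₁ x)
  to (popping x) = inj₂ (inj₂ (inj₁ x))
  to (back x)    = inj₂ (inj₂ (inj₂ x))
  from : Fin 3 ⊎ (X ⊎ (X ⊎ X)) → State X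
  from (inj₁ zero)             = start
  from (inj₁ (suc zero))       = fin₁
  from (inj₁ (suc (suc zero))) = fin₂
  from (inj₂ (inj₁ x))         = go x
  from (inj₂ (inj₂ (inj₁ x)))  = popping x
  from (inj₂ (inj₂ (inj₂ x)))  = back x
  from-to : ∀ s → from (to s) ≡ s
  from-to start       = refl
  from-to fin₁        = refl
  from-to fin₂        = refl
  from-to (go x)      = refl
  from-to (popping x) = refl
  from-to (back x)    = refl

digit : Bool → Fin 3
digit false = suc zero
digit true  = suc (suc zero)

square : List Bool → ℕ → Fin 3
square []      p = zero
square (b ∷ l) p = if does (p ≟ length l) then digit b else square l p

flagAt : Fin 3 → ℕ → Fin 3
flagAt o zero    = o
flagAt o (suc _) = zero

cells : Fin 3 → Stacks → ℕ → Cell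
cells o ⟪ i , a , b , c ⟫ p = cell (flagAt o p) (square i p) (square a p) (square b p) (square c p)

square-top : ∀ b l → square (b ∷ l) (length l) ≡ digit b
square-top b l rewrite dec-true (length l ≟ length l) refl = refl

square-other : ∀ b l p → p ≢ length l → square (b ∷ l) p ≡ square l p
square-other b l p ne rewrite dec-false (p ≟ length l) ne = refl

square-above : ∀ l p → length l ≤ p → square l p ≡ zero
square-above []      p le = refl
square-above (b ∷ l) p le = trans (square-other b l p (λ eq → <-irrefl (sym eq) le)) (square-above l p (≤-trans (n≤1+n _) le))

square-below : ∀ l p → p < length l → ∃ λ d → square l p ≡ suc d
square-below (b ∷ l) p (s≤s le) with m≤n⇒m<n∨m≡n le
... | inj₂ refl = top b (square-top b l)
  where
  top : ∀ b → square (b ∷ l) (length l) ≡ digit b → ∃ λ d → square (b ∷ l) (length l) ≡ suc d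
  top false eq = zero , eq
  top true  eq = suc zero , eq
... | inj₁ lt with square-below l p lt
...   | d , eq = d , trans (square-other b l p (<⇒≢ lt)) eq

digitAt-cells : ∀ k o σ p → digitAt k (cells o σ p) ≡ square (get k σ) p
digitAt-cells io   o σ p = refl
digitAt-cells main o σ p = refl
digitAt-cells aux  o σ p = refl
digitAt-cells cnt  o σ p = refl

cells-set : ∀ k o σ l p → cells o (set k l σ) p ≡ write k (square l p) (cells o σ p)
cells-set io   o σ l p = refl
cells-set main o σ l p = refl
cells-set aux  o σ l p = refl
cells-set cnt  o σ l p = refl

write-same : ∀ k x d → digitAt k x ≡ d → write k d x ≡ x
write-same io   x d refl = refl
write-same main x d refl = refl
write-same aux  x d refl = refl
write-same cnt  x d refl = refl

-- The Turing machine of a table of stack instructions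

module Machine {X : Set} (X-finite : Finite X) (instr : X → Instr X) (x₀ : X) where

  Action : Set
  Action = Maybe (State X × Cell × Move)

  atEnd : Fin 3 → Action → Action → Action
  atEnd zero    a b = a
  atEnd (suc _) a b = b

  exec : X → Instr X → Cell → Action
  exec x (nop y)       c = just (back y , c , R)
  exec x (push k b y)  c = atEnd (digitAt k c) (just (back y , write k (digit b) c , R)) (just (go x , c , R))
  exec x (pop k e f t) c = atEnd (digitAt k c)
    (atEnd (Cell.origin c) (just (popping x , c , L)) (just (back e , c , R))) (just (go x , c , R))
  -- Without the flag, and with the other tracks empty, the cells of an answer are again the plain
  -- symbols for blank, false and true.
  exec x stop          c = just (fin₁ , mark zero c , R)

  take : Instr X → Cell → Action
  take (pop k e f t) c with digitAt k c
  ... | zero           = nothing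
  ... | suc zero       = just (back f , write k zero c , R)
  ... | suc (suc zero) = just (back t , write k zero c , R)
  take _ c = nothing

  trans-δ : State X → Cell → Action
  trans-δ start       c = just (back x₀ , mark (suc zero) c , R)
  trans-δ fin₁        c = just (fin₂ , c , L)
  trans-δ fin₂        c = nothing
  trans-δ (go x)      c = exec x (instr x) c
  trans-δ (popping x) c = take (instr x) c
  trans-δ (back x)    c = atEnd (Cell.origin c) (just (back x , c , L)) (exec x (instr x) c)

  states : Finite (State X)
  states = State-finite X-finite

  encodeAction : Action → Maybe (Fin (size states) × Fin 243 × Move)
  encodeAction = Maybe.map (λ { (q , c , m) → index states q , encodeCell c , m })

  abstract
    δᵐ : Fin (size states) → Fin 243 → Maybe (Fin (size states) × Fin 243 × Move)
    δᵐ q s = encodeAction (trans-δ (at states q) (decodeCell s))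

    δ-≡ : ∀ q x → δᵐ (index states q) (encodeCell x) ≡ encodeAction (trans-δ q x)
    δ-≡ q x = cong₂ (λ q x → encodeAction (trans-δ q x)) (at-index states q) (decode-encodeCell x)

  machine : TM
  machine = record { nQ = 2 + (size X-finite + (size X-finite + size X-finite)) ; extra = 240 ; δ = δᵐ }

  record Point : Set where
    constructor point
    field
      state : State X
      pos   : ℕ
      tape  : ℕ → Cell

  record Rep (c : Config machine) (D : Point) : Set where
    constructor rep
    field unrep : Represents machine c (index states (Point.state D)) (Point.pos D) (λ j → encodeCell (Point.tape D j))

  record _⇒_ (D D′ : Point) : Set where
    constructor reaches
    field reach : ∀ c → Rep c D → ∃ λ m → Rep (run machine m c) D′
  open _⇒_ public

  -- At least one step is required because `finds` recurses on the number of machine steps: each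
  -- turn of the search loop has to use some of it up.
  record _⇒⁺_ (D D′ : Point) : Set where
    constructor reaches⁺
    field reach⁺ : ∀ c → Rep c D → ∃ λ m → Rep (run machine (suc m) c) D′
  open _⇒⁺_ public

  ⇒-refl : ∀ {D} → D ⇒ D
  ⇒-refl = reaches λ c r → 0 , r

  infixr 4 _⟫_ _⟫⁺_

  _⟫_ : ∀ {D E F} → D ⇒⁺ E → E ⇒ F → D ⇒⁺ F
  _⟫_ {D} {E} {F} d e = reaches⁺ λ c r → join₂ c (reach⁺ d c r)
    where
    join₁ : ∀ c m → (∃ λ n → Rep (run machine n (run machine (suc m) c)) F) → ∃ λ m → Rep (run machine (suc m) c) F
    join₁ c m (n , r) = m + n , subst (λ c → Rep c F) (sym (run-+ machine (suc m) n c)) r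
    join₂ : ∀ c → (∃ λ m → Rep (run machine (suc m) c) E) → ∃ λ m → Rep (run machine (suc m) c) F
    join₂ c (m , r) = join₁ c m (reach e _ r)

  ⇒⁺-⇒ : ∀ {D E} → D ⇒⁺ E → D ⇒ E
  ⇒⁺-⇒ {D} {E} d = reaches λ c r → weaken c (reach⁺ d c r)
    where
    weaken : ∀ c → (∃ λ m → Rep (run machine (suc m) c) E) → ∃ λ m → Rep (run machine m c) E
    weaken c (m , r) = suc m , r

  _⟫⁺_ : ∀ {D E F} → D ⇒⁺ E → E ⇒⁺ F → D ⇒⁺ F
  d ⟫⁺ e = d ⟫ ⇒⁺-⇒ e

  right : ∀ {q p f q′ x f′} → trans-δ q (f p) ≡ just (q′ , x , R) → f′ p ≡ x →
    (∀ j → j ≢ p → f′ j ≡ f j) → point q p f ⇒⁺ point q′ (suc p) f′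
  right {q} {p} {f} e fp fj = reaches⁺ λ { c (rep r) → 0 , rep (step-right machine r
    (trans (δ-≡ q (f p)) (cong encodeAction e)) (cong encodeCell fp) (λ j ne → cong encodeCell (fj j ne))) }

  left : ∀ {q p f q′ x f′} → trans-δ q (f (suc p)) ≡ just (q′ , x , L) → f′ (suc p) ≡ x →
    (∀ j → j ≢ suc p → f′ j ≡ f j) → point q (suc p) f ⇒⁺ point q′ p f′
  left {q} {p} {f} e fp fj = reaches⁺ λ { c (rep r) → 0 , rep (step-left machine r
    (trans (δ-≡ q (f (suc p))) (cong encodeAction e)) (cong encodeCell fp) (λ j ne → cong encodeCell (fj j ne))) }

  tapeOf : Stacks → ℕ → Cell
  tapeOf = cells (suc zero)

  At : X → Stacks → Point
  At x σ = point (back x) 0 (tapeOf σ)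

  return : ∀ x p σ → point (back x) p (tapeOf σ) ⇒ At x σ
  return x zero    σ = ⇒-refl
  return x (suc p) σ = ⇒⁺-⇒ (left refl refl (λ _ _ → refl) ⟫ return x p σ)

  -- Induction on the distance `d` to the first empty square. The walk starts in `back x` and
  -- continues in `go x`; quantifying over all `q` that act like `exec` at the current cell covers
  -- both.
  walk : ∀ x σ {D} k →
    (∀ d c → digitAt k c ≡ suc d → exec x (instr x) c ≡ just (go x , c , R)) →
    (∀ q → trans-δ q (tapeOf σ (length (get k σ))) ≡ exec x (instr x) (tapeOf σ (length (get k σ))) →
      point q (length (get k σ)) (tapeOf σ) ⇒⁺ D) →
    ∀ d q p → d + p ≡ length (get k σ) → trans-δ q (tapeOf σ p) ≡ exec x (instr x) (tapeOf σ p) →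
    point q p (tapeOf σ) ⇒⁺ D
  walk x σ k skip last zero    q .(length (get k σ)) refl e = last q e
  walk x σ k skip last (suc d) q p eq e with square-below (get k σ) p (subst (suc p ≤_) eq (s≤s (m≤n+m p d)))
  ... | v , nz = right (trans e (skip v _ (trans (digitAt-cells k (suc zero) σ p) nz))) refl (λ _ _ → refl) ⟫⁺
    walk x σ k skip last d (go x) (suc p) (trans (+-suc d p) eq) refl

  nop-⇒ : ∀ {x y σ} → instr x ≡ nop y → At x σ ⇒⁺ At y σ
  nop-⇒ {x} {y} {σ} e = right (cong (λ i → exec x i _) e) refl (λ _ _ → refl) ⟫ return y 1 σ

  push-⇒ : ∀ {x y k b σ} → instr x ≡ push k b y → At x σ ⇒⁺ At y (set k (b ∷ get k σ) σ)
  push-⇒ {x} {y} {k} {b} {σ} e = walk x σ k skip last (length (get k σ)) (back x) 0 (+-identityʳ _) refl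
    where
    skip : ∀ d c → digitAt k c ≡ suc d → exec x (instr x) c ≡ just (go x , c , R)
    skip d c eq rewrite e | eq = refl
    n : ℕ
    n = length (get k σ)
    σ′ : Stacks
    σ′ = set k (b ∷ get k σ) σ
    last : ∀ q → trans-δ q (tapeOf σ n) ≡ exec x (instr x) (tapeOf σ n) → point q n (tapeOf σ) ⇒⁺ At y σ′
    last q eq = right {f′ = tapeOf σ′} (trans eq act)
      (trans (cells-set k _ σ _ n) (cong (λ d → write k d (tapeOf σ n)) (square-top b (get k σ))))
      (λ j ne → trans (cells-set k _ σ _ j) (write-same k _ _
        (trans (digitAt-cells k _ σ j) (sym (square-other b (get k σ) j ne)))))
      ⟫ return y (suc n) σ′
      where
      act : exec x (instr x) (tapeOf σ n) ≡ just (back y , write k (digit b) (tapeOf σ n) , R)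
      act rewrite e | digitAt-cells k (suc zero) σ n | square-above (get k σ) n ≤-refl = refl

  pop-empty-⇒ : ∀ {x y k f t σ} → instr x ≡ pop k y f t → get k σ ≡ [] → At x σ ⇒⁺ At y σ
  pop-empty-⇒ {x} {y} {k} {f} {t} {σ} e eq = right act refl (λ _ _ → refl) ⟫ return y 1 σ
    where
    act : exec x (instr x) (tapeOf σ 0) ≡ just (back y , tapeOf σ 0 , R)
    act rewrite e | digitAt-cells k (suc zero) σ 0 | eq = refl

  branch : Bool → X → X → X
  branch false f t = f
  branch true  f t = t

  take-digit : ∀ b k {y f t c} → digitAt k c ≡ digit b →
    take (pop k y f t) c ≡ just (back (branch b f t) , write k zero c , R)
  take-digit false k eq rewrite eq = refl
  take-digit true  k eq rewrite eq = refl

  pop-cons-⇒ : ∀ {x y k f t b l σ} → instr x ≡ pop k y f t → get k σ ≡ b ∷ l → At x σ ⇒⁺ At (branch b f t) (set k l σ)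
  pop-cons-⇒ {x} {y} {k} {f} {t} {b} {l} {σ} e eq = walk x σ k skip last (length (get k σ)) (back x) 0 (+-identityʳ _) refl
    where
    skip : ∀ d c → digitAt k c ≡ suc d → exec x (instr x) c ≡ just (go x , c , R)
    skip d c eq rewrite e | eq = refl
    σ′ : Stacks
    σ′ = set k l σ
    n : ℕ
    n = length l
    top : digitAt k (tapeOf σ n) ≡ digit b
    top = trans (digitAt-cells k (suc zero) σ n) (trans (cong (λ s → square s n) eq) (square-top b l))
    takes : take (instr x) (tapeOf σ n) ≡ just (back (branch b f t) , write k zero (tapeOf σ n) , R)
    takes rewrite e = take-digit b k {y} {f} {t} top
    grab : point (popping x) n (tapeOf σ) ⇒⁺ At (branch b f t) σ′
    grab = right {f′ = tapeOf σ′} takes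
      (trans (cells-set k _ σ _ n) (cong (λ d → write k d (tapeOf σ n)) (square-above l n ≤-refl)))
      (λ j ne → trans (cells-set k _ σ _ j) (write-same k _ _
        (trans (digitAt-cells k _ σ j) (trans (cong (λ s → square s j) eq) (square-other b l j ne)))))
      ⟫ return _ (suc n) σ′
    last : ∀ q → trans-δ q (tapeOf σ (length (get k σ))) ≡ exec x (instr x) (tapeOf σ (length (get k σ))) →
      point q (length (get k σ)) (tapeOf σ) ⇒⁺ At (branch b f t) σ′
    last q e′ = subst (λ m → point q m (tapeOf σ) ⇒⁺ At (branch b f t) σ′) (sym len)
      (left (trans (subst (λ m → trans-δ q (tapeOf σ m) ≡ exec x (instr x) (tapeOf σ m)) len e′) act) refl (λ _ _ → refl) ⟫⁺ grab)
      where
      len : length (get k σ) ≡ suc n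
      len = cong length eq
      act : exec x (instr x) (tapeOf σ (suc n)) ≡ just (popping x , tapeOf σ (suc n) , L)
      act rewrite e | digitAt-cells k (suc zero) σ (suc n) | eq | square-other b l (suc n) 1+n≢n
                | square-above l (suc n) (n≤1+n n) = refl

  stop-⇒ : ∀ {x σ} → instr x ≡ stop → At x σ ⇒⁺ point fin₂ 0 (cells zero σ)
  stop-⇒ {x} {σ} e = right (cong (λ i → exec x i _) e) refl (λ { zero ne → ⊥-elim (ne refl) ; (suc j) ne → refl }) ⟫⁺
    left {f = cells zero σ} refl refl (λ _ _ → refl)

  fin₂-halted : ∀ {c p f} → Rep c (point fin₂ p f) → Halted machine c
  fin₂-halted {cfg _ _ _ _} {p} {f} (rep (represents refl refl _ _)) = δ-≡ fin₂ (f p)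

  pop-running : ∀ {c x k e f t σ} → instr x ≡ pop k e f t → Rep c (At x σ) → ¬ Halted machine c
  pop-running {cfg _ _ _ _} {x} {k} {σ = σ} eq (rep (represents refl refl _ _)) h
    rewrite δ-≡ (back x) (tapeOf σ 0) | eq with digitAt k (tapeOf σ 0) | h
  ... | zero  | ()
  ... | suc _ | ()

-- Control points of structured statements

Points : Stm → Set
Points nop            = ⊤
Points (push k b)     = ⊤
Points (p ⨟ q)        = Points p ⊎ Points q
Points (case k e f t) = Maybe (Points e ⊎ (Points f ⊎ Points t))
Points (while k f t)  = Maybe (Points f ⊎ Points t)

Points-finite : ∀ s → Finite (Points s)
Points-finite nop            = ⊤-finite
Points-finite (push k b)     = ⊤-finite
Points-finite (p ⨟ q)        = ⊎-finite (Points-finite p) (Points-finite q)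
Points-finite (case k e f t) = Maybe-finite (⊎-finite (Points-finite e) (⊎-finite (Points-finite f) (Points-finite t)))
Points-finite (while k f t)  = Maybe-finite (⊎-finite (Points-finite f) (Points-finite t))

entry : ∀ s → Points s
entry nop            = tt
entry (push k b)     = tt
entry (p ⨟ q)        = inj₁ (entry p)
entry (case k e f t) = nothing
entry (while k f t)  = nothing

-- The embedding `ι` places the control points of a part among those of the whole program, and `e`
-- is the point reached on leaving the part. A loop body leaves to `ι nothing`, the test of its
-- loop. Thus the instructions of a part do not depend on where it stands, and the simulation goes
-- by induction on the derivation.
code : ∀ s {X : Set} → (Points s → X) → X → Points s → Instr X
code nop            ι e x                       = nop e
code (push k b)     ι e x                       = push k b e
code (p ⨟ q)        ι e (inj₁ x)                = code p (ι ∘ inj₁) (ι (inj₂ (entry q))) x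
code (p ⨟ q)        ι e (inj₂ x)                = code q (ι ∘ inj₂) e x
code (case k a b c) ι e nothing                 =
  pop k (ι (just (inj₁ (entry a)))) (ι (just (inj₂ (inj₁ (entry b))))) (ι (just (inj₂ (inj₂ (entry c)))))
code (case k a b c) ι e (just (inj₁ x))         = code a (ι ∘ just ∘ inj₁) e x
code (case k a b c) ι e (just (inj₂ (inj₁ x)))  = code b (ι ∘ just ∘ inj₂ ∘ inj₁) e x
code (case k a b c) ι e (just (inj₂ (inj₂ x)))  = code c (ι ∘ just ∘ inj₂ ∘ inj₂) e x
code (while k a b)  ι e nothing                 = pop k e (ι (just (inj₁ (entry a)))) (ι (just (inj₂ (entry b))))
code (while k a b)  ι e (just (inj₁ x))         = code a (ι ∘ just ∘ inj₁) (ι nothing) x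
code (while k a b)  ι e (just (inj₂ x))         = code b (ι ∘ just ∘ inj₂) (ι nothing) x

module Compiled (s₀ : Stm) where

  instr₀ : Maybe (Points s₀) → Instr (Maybe (Points s₀))
  instr₀ nothing  = stop
  instr₀ (just x) = code s₀ just nothing x

  open Machine (Maybe-finite (Points-finite s₀)) instr₀ (just (entry s₀)) public

  Embeds : ∀ s → (Points s → Maybe (Points s₀)) → Maybe (Points s₀) → Set
  Embeds s ι e = ∀ x → instr₀ (ι x) ≡ code s ι e x

  simulates : ∀ {s σ σ′} → s ∋ σ ⇓ σ′ → ∀ ι e → Embeds s ι e → At (ι (entry s)) σ ⇒⁺ At e σ′
  simulates {σ = σ} nop ι e emb = nop-⇒ {σ = σ} (emb tt)
  simulates push       ι e emb = push-⇒ (emb tt)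
  simulates (d ⨟ d′)   ι e emb = simulates d _ _ (emb ∘ inj₁) ⟫⁺ simulates d′ _ _ (emb ∘ inj₂)
  simulates (caseE g d) ι e emb = pop-empty-⇒ (emb nothing) g ⟫⁺ simulates d _ _ (emb ∘ just ∘ inj₁)
  simulates (caseF g d) ι e emb = pop-cons-⇒ (emb nothing) g ⟫⁺ simulates d _ _ (emb ∘ just ∘ inj₂ ∘ inj₁)
  simulates (caseT g d) ι e emb = pop-cons-⇒ (emb nothing) g ⟫⁺ simulates d _ _ (emb ∘ just ∘ inj₂ ∘ inj₂)
  simulates (whileE g)  ι e emb = pop-empty-⇒ (emb nothing) g
  simulates (whileF g d d′) ι e emb = pop-cons-⇒ (emb nothing) g ⟫⁺ simulates d _ _ (emb ∘ just ∘ inj₁) ⟫⁺ simulates d′ ι e emb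
  simulates (whileT g d d′) ι e emb = pop-cons-⇒ (emb nothing) g ⟫⁺ simulates d _ _ (emb ∘ just ∘ inj₂) ⟫⁺ simulates d′ ι e emb

-- Input and output on the tape

digitOf : Word → ℕ → Fin 3
digitOf []      i       = zero
digitOf (b ∷ w) zero    = digit b
digitOf (b ∷ w) (suc i) = digitOf w i

length-snoc : ∀ (l : Word) b → length (l ++ [ b ]) ≡ suc (length l)
length-snoc l b = trans (length-++ l) (+-comm (length l) 1)

square-snoc-zero : ∀ l b → square (l ++ [ b ]) 0 ≡ digit b
square-snoc-zero []      b = square-top b []
square-snoc-zero (c ∷ l) b = trans
  (square-other c (l ++ [ b ]) 0 (λ eq → 0≢suc (trans eq (length-snoc l b)))) (square-snoc-zero l b)
  where
  0≢suc : ∀ {n} → 0 ≢ suc n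
  0≢suc ()

square-snoc-suc : ∀ l b i → square (l ++ [ b ]) (suc i) ≡ square l i
square-snoc-suc []      b i = square-other b [] (suc i) (λ ())
square-snoc-suc (c ∷ l) b i with i ≟ length l
... | yes refl = trans (cong (square (c ∷ l ++ [ b ])) (sym (length-snoc l b)))
                       (trans (square-top c (l ++ [ b ])) (sym (square-top c l)))
... | no ne    = trans (square-other c (l ++ [ b ]) (suc i) (λ eq → ne (cong pred (trans eq (length-snoc l b)))))
                       (trans (square-snoc-suc l b i) (sym (square-other c l i ne)))

-- The bottom of a stack lies in the leftmost cell, so a word written from left to right is the
-- stack of its reversal.
square-reverse : ∀ w i → square (reverse w) i ≡ digitOf w i
square-reverse []      i       = refl
square-reverse (b ∷ w) i       rewrite unfold-reverse b w with i
... | zero  = square-snoc-zero (reverse w) b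
... | suc i = trans (square-snoc-suc (reverse w) b i) (square-reverse w i)

ioSymbol : Fin 3 → Fin 243
ioSymbol d = encodeCell (cell zero d zero zero zero)

ioCell-≡ : ∀ w p → encodeCell (cells zero ⟪ reverse w , [] , [] , [] ⟫ p) ≡ ioSymbol (digitOf w p)
ioCell-≡ w zero    = cong ioSymbol (square-reverse w 0)
ioCell-≡ w (suc p) = cong ioSymbol (square-reverse w (suc p))

-- Turns the code of the input into the code of an environment with this one variable, which is what
-- compiled terms expect.
emptyMain : Prog → Prog
emptyMain p = ⟨ idₚ , leafₚ ⟩ ⨾ p

module Programs (s₀ : Stm) where
  open Compiled s₀ public

  bitSym-≡ : ∀ b → bitSym machine b ≡ ioSymbol (digit b)
  bitSym-≡ false = refl
  bitSym-≡ true  = refl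

  word-symbols : ∀ w i → nth zero (map (bitSym machine) w) i ≡ ioSymbol (digitOf w i)
  word-symbols []      i       = refl
  word-symbols (b ∷ w) zero    = bitSym-≡ b
  word-symbols (b ∷ w) (suc i) = word-symbols w i

  initial-Rep : ∀ w → Rep (initial machine w) (point start 0 (cells zero ⟪ reverse w , [] , [] , [] ⟫))
  initial-Rep []      = rep (represents refl refl (λ { j i eq → ⊥-elim (no-left j i eq) }) (λ i → refl))
    where
    no-left : ∀ j i → j + suc i ≢ 0
    no-left zero    i ()
    no-left (suc j) i ()
  initial-Rep (b ∷ w) = rep (represents refl (trans (bitSym-≡ b) (sym (ioCell-≡ (b ∷ w) 0))) (λ { j i eq → ⊥-elim (no-left j i eq) })
    (λ i → trans (word-symbols w i) (sym (ioCell-≡ (b ∷ w) (suc i)))))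
    where
    no-left : ∀ j i → j + suc i ≢ 0
    no-left zero    i ()
    no-left (suc j) i ()

  begins : ∀ w → point start 0 (cells zero ⟪ reverse w , [] , [] , [] ⟫) ⇒⁺ At (just (entry s₀)) ⟪ reverse w , [] , [] , [] ⟫
  begins w = right refl refl (λ { zero ne → ⊥-elim (ne refl) ; (suc j) ne → refl }) ⟫ return (just (entry s₀)) 1 ⟪ reverse w , [] , [] , [] ⟫

  completes : ∀ {w σ} → s₀ ∋ ⟪ reverse w , [] , [] , [] ⟫ ⇓ σ →
    point start 0 (cells zero ⟪ reverse w , [] , [] , [] ⟫) ⇒⁺ point fin₂ 0 (cells zero σ)
  completes {w} {σ} d = begins w ⟫⁺ simulates d just nothing (λ _ → refl) ⟫⁺ stop-⇒ {nothing} {σ} refl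

  readBits-≡ : ∀ s w → (∀ i → nth zero s i ≡ ioSymbol (digitOf w i)) → readBits machine s ≡ w
  readBits-≡ []      []          eq = refl
  readBits-≡ []      (false ∷ w) eq with () ← eq 0
  readBits-≡ []      (true ∷ w)  eq with () ← eq 0
  readBits-≡ (x ∷ s) []          eq rewrite eq 0 = refl
  readBits-≡ (x ∷ s) (false ∷ w) eq rewrite eq 0 = cong (false ∷_) (readBits-≡ s w (eq ∘ suc))
  readBits-≡ (x ∷ s) (true ∷ w)  eq rewrite eq 0 = cong (true ∷_) (readBits-≡ s w (eq ∘ suc))

  output-≡ : ∀ {c} w → Rep c (point fin₂ 0 (cells zero ⟪ reverse w , [] , [] , [] ⟫)) → output machine c ≡ w
  output-≡ {cfg q l x r} w (rep (represents _ hd _ rt)) = readBits-≡ (x ∷ r) w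
    (λ { zero → trans hd (ioCell-≡ w 0) ; (suc i) → trans (rt i) (ioCell-≡ w (suc i)) })

implement₀-⇓ : ∀ p t → implement p ∋ ⟪ [] , pre t , [] , [] ⟫ ⇓ ⟪ [] , pre (⟦ p ⟧ t) , [] , [] ⟫
implement₀-⇓ p t = fromMain (sym (++-identityʳ (pre t))) (toMain (++-identityʳ (pre (⟦ p ⟧ t))) (implement-⇓ p t))

abstract
  Tm-computable : (t : Tm (list bool ∷ []) (list bool)) → Computable (λ w → eval t (w ∷ []))
  Tm-computable t = machine , result
    where
    s₀ : Stm
    s₀ = readWord ⨟ implement (emptyMain (compile t)) ⨟ writeWord
    open Programs s₀
    runs : ∀ w → s₀ ∋ ⟪ reverse w , [] , [] , [] ⟫ ⇓ ⟪ reverse (eval t (w ∷ [])) , [] , [] , [] ⟫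
    runs w = readWord-⇓ w ⨟
      toMain (cong pre (compile-correct t (w ∷ []))) (implement₀-⇓ (emptyMain (compile t)) (encode (list bool) w)) ⨟
      writeWord-⇓ (eval t (w ∷ []))
    result : Computes machine (λ w → eval t (w ∷ []))
    result w = finish (reach⁺ (completes {w} (runs w)) (initial machine w) (initial-Rep w))
      where
      v : Word
      v = eval t (w ∷ [])
      finish : (∃ λ m → Rep (run machine (suc m) (initial machine w)) (point fin₂ 0 (cells zero ⟪ reverse v , [] , [] , [] ⟫))) →
        ∃ λ n → Halted machine (run machine n (initial machine w)) × output machine (run machine n (initial machine w)) ≡ v
      finish (m , r) = suc m , fin₂-halted r , output-≡ v r

-- Unbounded search on the stack machine

data NonLeaf : Tree → Set where
  nonLeaf : ∀ {a b} → NonLeaf (node a b)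

nonLeaf? : ∀ t → (t ≡ leaf) ⊎ NonLeaf t
nonLeaf? leaf       = inj₁ refl
nonLeaf? (node a b) = inj₂ nonLeaf

module Search (init test next : Prog) where

  -- On `main` lies the code of `node (test t) (next t)`. Popping its first bit exposes the test. If
  -- that is a leaf, popping it leaves exactly the next state, and the loop flag is renewed.
  -- Otherwise the flag stays off and a remainder of the code is left behind; this does not matter,
  -- since only halting is observed.
  continue : Stm
  continue = case main nop nop (case main nop (push cnt true) nop)

  searchLoop : Stm
  searchLoop = while cnt nop (implement ⟨ test , next ⟩ ⨟ continue)

  searcher : Stm
  searcher = (readWord ⨟ implement init ⨟ push cnt true) ⨟ searchLoop

  open Programs searcher

  state : Word → ℕ → Tree
  state w n = iter ⟦ next ⟧ (⟦ init ⟧ (encode (list bool) w)) n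

  seeking : Tree → Stacks
  seeking t = ⟪ [] , pre t , [] , true ∷ [] ⟫

  -- The loop may stop before round `n`, at an earlier state that passes the test; for this reason
  -- only the existence of final stacks is claimed.
  found-⇓ : ∀ n t → NonLeaf (⟦ test ⟧ (iter ⟦ next ⟧ t n)) → ∃ λ σ → searchLoop ∋ seeking t ⇓ σ
  found-⇓ n t ok = seek n (nonLeaf? (⟦ test ⟧ t)) ok
    where
    body : implement ⟨ test , next ⟩ ∋ ⟪ [] , pre t , [] , [] ⟫ ⇓ ⟪ [] , pre (node (⟦ test ⟧ t) (⟦ next ⟧ t)) , [] , [] ⟫
    body = implement₀-⇓ ⟨ test , next ⟩ t
    stops : NonLeaf (⟦ test ⟧ t) → ∃ λ σ → searchLoop ∋ seeking t ⇓ σ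
    stops y with ⟦ test ⟧ t | body
    stops nonLeaf | node a b | d = _ , whileT refl (d ⨟ caseT refl (caseT refl nop)) (whileE refl)
    seek : ∀ n → (⟦ test ⟧ t ≡ leaf) ⊎ NonLeaf (⟦ test ⟧ t) → NonLeaf (⟦ test ⟧ (iter ⟦ next ⟧ t n)) → ∃ λ σ → searchLoop ∋ seeking t ⇓ σ
    seek n       (inj₂ y) ok = stops y
    seek zero    (inj₁ _) ok = stops ok
    seek (suc n) (inj₁ e) ok with ⟦ test ⟧ t | body
    seek (suc n) (inj₁ refl) ok | leaf | d with found-⇓ n (⟦ next ⟧ t) ok
    ... | σ , e = σ , whileT refl (d ⨟ caseT refl (caseF refl push)) e

  loopPoint : Maybe (Points searcher)
  loopPoint = just (inj₂ nothing)

  prepare : ∀ w → At (just (entry searcher)) ⟪ reverse w , [] , [] , [] ⟫ ⇒⁺ At loopPoint (seeking (state w 0))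
  prepare w = simulates
    (readWord-⇓ w ⨟ implement₀-⇓ init (encode (list bool) w) ⨟ push)
    (just ∘ inj₁) loopPoint (λ _ → refl)

  again : ∀ t → ⟦ test ⟧ t ≡ leaf → At loopPoint (seeking t) ⇒⁺ At loopPoint (seeking (⟦ next ⟧ t))
  again t eq = pop-cons-⇒ {b = true} {σ = seeking t} refl refl ⟫⁺ simulates (body _ eq (implement₀-⇓ ⟨ test , next ⟩ t)) (just ∘ inj₂ ∘ just ∘ inj₂) loopPoint (λ _ → refl)
    where
    body : ∀ u → u ≡ leaf →
      implement ⟨ test , next ⟩ ∋ ⟪ [] , pre t , [] , [] ⟫ ⇓ ⟪ [] , pre (node u (⟦ next ⟧ t)) , [] , [] ⟫ →
      implement ⟨ test , next ⟩ ⨟ continue ∋ ⟪ [] , pre t , [] , [] ⟫ ⇓ seeking (⟦ next ⟧ t)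
    body .leaf refl d = d ⨟ caseT refl (caseF refl push)

  -- Halting of the machine does not come with a derivation to recurse on, so the recursion is on
  -- the time of halting. A failed test consumes at least one step, and at the loop test the machine
  -- is about to pop, hence not halted, which settles time zero.
  finds : ∀ N c t → Rep c (At loopPoint (seeking t)) → Halted machine (run machine N c) →
    ∃ λ n → NonLeaf (⟦ test ⟧ (iter ⟦ next ⟧ t n))
  finds zero    c t r h = ⊥-elim (pop-running {σ = seeking t} refl r h)
  finds (suc N) c t r h = check (nonLeaf? (⟦ test ⟧ t))
    where
    later : (∃ λ n → NonLeaf (⟦ test ⟧ (iter ⟦ next ⟧ (⟦ next ⟧ t) n))) → ∃ λ n → NonLeaf (⟦ test ⟧ (iter ⟦ next ⟧ t n))
    later (n , y) = suc n , y
    resume : (∃ λ m → Rep (run machine (suc m) c) (At loopPoint (seeking (⟦ next ⟧ t)))) →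
      ∃ λ n → NonLeaf (⟦ test ⟧ (iter ⟦ next ⟧ t n))
    resume (m , r′) = later (finds N (run machine (suc m) c) (⟦ next ⟧ t) r′ (halted-later machine N m (step machine c) h))
    check : (⟦ test ⟧ t ≡ leaf) ⊎ NonLeaf (⟦ test ⟧ t) → ∃ λ n → NonLeaf (⟦ test ⟧ (iter ⟦ next ⟧ t n))
    check (inj₂ y) = 0 , y
    check (inj₁ e) = resume (reach⁺ (again t e) c r)

  search-halts : ∀ w n → NonLeaf (⟦ test ⟧ (state w n)) → HaltsOn machine w
  search-halts w n ok = finish (found-⇓ n (state w 0) ok)
    where
    halts : ∀ {σ} → (∃ λ m → Rep (run machine (suc m) (initial machine w)) (point fin₂ 0 (cells zero σ))) → HaltsOn machine w
    halts (m , r) = suc m , fin₂-halted r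
    finish : (∃ λ σ → searchLoop ∋ seeking (state w 0) ⇓ σ) → HaltsOn machine w
    finish (σ , d) = halts {σ} (reach⁺
      (begins w ⟫⁺ prepare w ⟫⁺ simulates d (just ∘ inj₂) nothing (λ _ → refl) ⟫⁺ stop-⇒ {nothing} {σ} refl)
      (initial machine w) (initial-Rep w))

  search-finds : ∀ w → HaltsOn machine w → ∃ λ n → NonLeaf (⟦ test ⟧ (state w n))
  search-finds w (N , h) = finish (reach⁺ (begins w ⟫⁺ prepare w) (initial machine w) (initial-Rep w))
    where
    finish : (∃ λ m → Rep (run machine (suc m) (initial machine w)) (At loopPoint (seeking (state w 0)))) →
      ∃ λ n → NonLeaf (⟦ test ⟧ (state w n))
    finish (m , r) = finds N (run machine (suc m) (initial machine w)) (state w 0) r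
      (halted-later machine N (suc m) (initial machine w) h)

abstract
  search-machine : ∀ init test next → ∃ λ (M : TM) → ∀ w →
    (∀ n → NonLeaf (⟦ test ⟧ (iter ⟦ next ⟧ (⟦ init ⟧ (encode (list bool) w)) n)) → HaltsOn M w) ×
    (HaltsOn M w → ∃ λ n → NonLeaf (⟦ test ⟧ (iter ⟦ next ⟧ (⟦ init ⟧ (encode (list bool) w)) n)))
  search-machine init test next = Programs.machine searcher , λ w → search-halts w , search-finds w
    where open Search init test next

-- Search for certificates

v₀ : ∀ {Γ τ} → Tm (τ ∷ Γ) τ
v₀ = var (here refl)

v₁ : ∀ {Γ σ τ} → Tm (σ ∷ τ ∷ Γ) τ
v₁ = var (there (here refl))

v₂ : ∀ {Γ ρ σ τ} → Tm (ρ ∷ σ ∷ τ ∷ Γ) τ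
v₂ = var (there (there (here refl)))

v₃ : ∀ {Γ π ρ σ τ} → Tm (π ∷ ρ ∷ σ ∷ τ ∷ Γ) τ
v₃ = var (there (there (there (here refl))))

v₄ : ∀ {Γ ο π ρ σ τ} → Tm (ο ∷ π ∷ ρ ∷ σ ∷ τ ∷ Γ) τ
v₄ = var (there (there (there (there (here refl)))))

v₅ : ∀ {Γ ξ ο π ρ σ τ} → Tm (ξ ∷ ο ∷ π ∷ ρ ∷ σ ∷ τ ∷ Γ) τ
v₅ = var (there (there (there (there (there (here refl))))))

v₆ : ∀ {Γ ν ξ ο π ρ σ τ} → Tm (ν ∷ ξ ∷ ο ∷ π ∷ ρ ∷ σ ∷ τ ∷ Γ) τ
v₆ = var (there (there (there (there (there (there (here refl)))))))

nilₜ : ∀ {Γ τ} → Tm Γ (list τ)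
nilₜ = lit []

products : {A B C : Set} → (A → B → C) → List A → List B → List C
products f xs ys = foldr (λ x acc → foldr (λ y → f x y ∷_) acc ys) [] xs

∈-products : {A B C : Set} (f : A → B → C) {xs : List A} {ys : List B} {x : A} {y : B} →
  x ∈ xs → y ∈ ys → f x y ∈ products f xs ys
∈-products f {xs = x ∷ xs} {ys} (here refl) y∈ = enter ys y∈
  where
  enter : ∀ {acc y} ys → y ∈ ys → f x y ∈ foldr (λ y → f x y ∷_) acc ys
  enter (y ∷ ys) (here refl) = here refl
  enter (y ∷ ys) (there i)   = there (enter ys i)
∈-products f {xs = x ∷ xs} {ys} (there i) y∈ = keep ys (∈-products f i y∈)
  where
  keep : ∀ {acc c} ys → c ∈ acc → c ∈ foldr (λ y → f x y ∷_) acc ys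
  keep []       i = i
  keep (y ∷ ys) i = there (keep ys i)

iter-suc : {A : Set} (f : A → A) (z : A) (n : ℕ) → iter f z (suc n) ≡ f (iter f z n)
iter-suc f z zero    = refl
iter-suc f z (suc n) = iter-suc f (f z) n

-- The values that are small with respect to the bound in the environment; every value is small eventually.
candidates : ∀ τ → Tm (nat ∷ []) (list τ)
candidates bool     = lit (true ∷ false ∷ [])
candidates nat      = iterₜ v₀ nilₜ (consₜ (lit 0) (foldrₜ v₀ nilₜ (consₜ (sucₜ v₀) v₁)))
candidates (list τ) = iterₜ v₀ nilₜ (consₜ nilₜ
  (foldrₜ (call (candidates τ) (v₁ ∷ [])) nilₜ (foldrₜ v₂ v₁ (consₜ (consₜ v₂ v₀) v₁))))
candidates (σ ⊗ τ)  =
  foldrₜ (call (candidates σ) (v₀ ∷ [])) nilₜ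
    (foldrₜ (call (candidates τ) (v₂ ∷ [])) v₁ (consₜ (pairₜ v₂ v₀) v₁))

-- Membership is claimed for all bounds from `N` on, not just for `N`, so that the bounds of several
-- components can be merged by taking a maximum. For lists the same bound limits the entries and the
-- length.
candidate : ∀ τ (v : Val τ) → ∃ λ N → ∀ n → N ≤ n → v ∈ eval (candidates τ) (n ∷ [])
candidate bool true  = 0 , λ _ _ → here refl
candidate bool false = 0 , λ _ _ → there (here refl)
candidate nat m = suc m , λ n → small m n
  where
  grow : List ℕ → List ℕ
  grow S = 0 ∷ foldr (λ k → suc k ∷_) [] S
  suc∈ : ∀ {m S} → m ∈ S → suc m ∈ foldr (λ k → suc k ∷_) [] S
  suc∈ (here refl) = here refl
  suc∈ (there i)   = there (suc∈ i)
  small : ∀ m n → m < n → m ∈ iter grow [] n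
  small m (suc n) (s≤s le) rewrite iter-suc grow [] n with m | le
  ... | zero  | _  = here refl
  ... | suc k | lt = there (suc∈ (small k n lt))
candidate (list τ) l = bound l , λ n le → subset n l (bound≤ l n le) (length< l n le)
  where
  bound : List (Val τ) → ℕ
  bound []      = 1
  bound (v ∷ l) = proj₁ (candidate τ v) ⊔ suc (bound l)
  pred≤ : ∀ {m n} → suc m ≤ n → m ≤ n
  pred≤ {zero}  le       = z≤n
  pred≤ {suc m} (s≤s le) = s≤s (pred≤ le)
  length< : ∀ l n → bound l ≤ n → length l < n
  length< []      n le = le
  length< (v ∷ l) (suc n) le with ≤-trans (m≤n⊔m (proj₁ (candidate τ v)) (suc (bound l))) le
  ... | s≤s le′ = s≤s (length< l n le′)
  length< (v ∷ l) zero le with () ← ≤-trans (m≤n⊔m (proj₁ (candidate τ v)) (suc (bound l))) le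
  bound≤ : ∀ l n → bound l ≤ n → All (_∈ eval (candidates τ) (n ∷ [])) l
  bound≤ []      n le = []
  bound≤ (v ∷ l) n le = proj₂ (candidate τ v) n (≤-trans (m≤m⊔n _ (suc (bound l))) le) ∷
    bound≤ l n (pred≤ (≤-trans (m≤n⊔m (proj₁ (candidate τ v)) (suc (bound l))) le))
  grow : ℕ → List (List (Val τ)) → List (List (Val τ))
  grow n S = [] ∷ products _∷_ (eval (candidates τ) (n ∷ [])) S
  within : ∀ n k l → All (_∈ eval (candidates τ) (n ∷ [])) l → length l < k → l ∈ iter (grow n) [] k
  within n (suc k) []      []       lt rewrite iter-suc (grow n) [] k = here refl
  within n (suc k) (v ∷ l) (i ∷ is) (s≤s lt) rewrite iter-suc (grow n) [] k =
    there (∈-products _∷_ i (within n k l is lt))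
  subset : ∀ n l → All (_∈ eval (candidates τ) (n ∷ [])) l → length l < n → l ∈ iter (grow n) [] n
  subset n = within n n
candidate (σ ⊗ τ) (u , v) with candidate σ u | candidate τ v
... | M , f | N , g = M ⊔ N , λ n le →
  ∈-products _,_ (f n (≤-trans (m≤m⊔n M N) le)) (g n (≤-trans (m≤n⊔m M N) le))

SemiDecidable : Problem → Set
SemiDecidable A = ∃ λ (M : TM) → ∀ w → (A w → HaltsOn M w) × (HaltsOn M w → A w)

-- Round `n` tests all candidates for the bound `n`, which is a total computation; only the sequence
-- of rounds is unbounded. Each value is a candidate in some round, and a round succeeds only on a
-- value that passes the check.
exists-semidecidable : ∀ τ (check : Tm (τ ∷ list bool ∷ []) bool) →
  SemiDecidable (λ w → ∃ λ (v : Val τ) → eval check (v ∷ w ∷ []) ≡ true)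
exists-semidecidable τ check = machine , λ w → (λ { (v , ok) → halts w v ok }) , λ h → found w (proj₂ (searches w) h)
  where
  test : Tm (nat ∷ list bool ∷ []) bool
  test = foldrₜ (call (candidates τ) (v₀ ∷ [])) (lit false) (ifₜ (call check (v₀ ∷ v₃ ∷ [])) (lit true) v₁)
  next : Prog
  next = compiles {Γ = nat ∷ list bool ∷ []} (sucₜ v₀ ∷ v₁ ∷ [])
  init : Prog
  init = ⟨ leafₚ , ⟨ idₚ , leafₚ ⟩ ⟩
  state : Word → ℕ → Tree
  state w n = iter ⟦ next ⟧ (⟦ init ⟧ (encode (list bool) w)) n
  machine : TM
  machine = proj₁ (search-machine init (compile test) next)
  searches : ∀ w → (∀ n → NonLeaf (⟦ compile test ⟧ (state w n)) → HaltsOn machine w) ×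
                   (HaltsOn machine w → ∃ λ n → NonLeaf (⟦ compile test ⟧ (state w n)))
  searches = proj₂ (search-machine init (compile test) next)
  iterates : ∀ (w : Word) k n → iter ⟦ next ⟧ (encodeEnv {nat ∷ list bool ∷ []} (k ∷ w ∷ [])) n ≡
    encodeEnv {nat ∷ list bool ∷ []} (iter suc k n ∷ w ∷ [])
  iterates w k zero    = refl
  iterates w k (suc n) = iterates w (suc k) n
  iter-suc-ℕ : ∀ n → iter suc 0 n ≡ n
  iter-suc-ℕ zero    = refl
  iter-suc-ℕ (suc n) = trans (iter-suc suc 0 n) (cong suc (iter-suc-ℕ n))
  state-≡ : ∀ w n → state w n ≡ encodeEnv {nat ∷ list bool ∷ []} (n ∷ w ∷ [])
  state-≡ w n = trans (iterates w 0 n) (cong (λ m → encodeEnv {nat ∷ list bool ∷ []} (m ∷ w ∷ [])) (iter-suc-ℕ n))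
  any : Word → List (Val τ) → Bool
  any w = foldr (λ v b → if eval check (v ∷ w ∷ []) then true else b) false
  any-true : ∀ w l v → v ∈ l → eval check (v ∷ w ∷ []) ≡ true → any w l ≡ true
  any-true w (v ∷ l) .v (here refl) ok rewrite ok = refl
  any-true w (u ∷ l) v (there i) ok with eval check (u ∷ w ∷ [])
  ... | true  = refl
  ... | false = any-true w l v i ok
  true-any : ∀ w l → any w l ≡ true → ∃ λ v → eval check (v ∷ w ∷ []) ≡ true
  true-any w (u ∷ l) ok with eval check (u ∷ w ∷ []) in eq
  ... | true  = u , eq
  ... | false = true-any w l ok
  test-≡ : ∀ w n → ⟦ compile test ⟧ (state w n) ≡ encode bool (any w (eval (candidates τ) (n ∷ [])))
  test-≡ w n = trans (cong ⟦ compile test ⟧ (state-≡ w n)) (compile-correct test (n ∷ w ∷ []))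
  halts : ∀ w v → eval check (v ∷ w ∷ []) ≡ true → HaltsOn machine w
  halts w v ok with candidate τ v
  ... | N , small = proj₁ (searches w) N (subst NonLeaf (sym (trans (test-≡ w N) (cong (encode bool) (any-true w _ v (small N ≤-refl) ok)))) nonLeaf)
  nonLeaf-true : ∀ b → NonLeaf (encode bool b) → b ≡ true
  nonLeaf-true true y = refl
  found : ∀ w → (∃ λ n → NonLeaf (⟦ compile test ⟧ (state w n))) → ∃ λ v → eval check (v ∷ w ∷ []) ≡ true
  found w (n , y) = true-any w (eval (candidates τ) (n ∷ [])) (nonLeaf-true _ (subst NonLeaf (test-≡ w n) y))

-- Regular expressions

module _ {k : ℕ} where

  -- There is no expression for the empty language, so a finite union needs a first member;
  -- enumerations of finite types are used with some element repeated at the front.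
  ⋃ : {A : Set} → (A → Regex k) → A → List A → Regex k
  ⋃ f x []       = f x
  ⋃ f x (y ∷ ys) = f x ∪ ⋃ f y ys

  ∈-⋃ : {A : Set} (f : A → Regex k) {w : List (Fin k)} {z x : A} {xs : List A} → z ∈ x ∷ xs → w ∈L f z → w ∈L ⋃ f x xs
  ∈-⋃ f {xs = []}     (here refl) d = d
  ∈-⋃ f {xs = y ∷ ys} (here refl) d = unionˡ d
  ∈-⋃ f {xs = y ∷ ys} (there i)   d = unionʳ (∈-⋃ f i d)

  ⋃-inv : {A : Set} (f : A → Regex k) {w : List (Fin k)} (x : A) (xs : List A) → w ∈L ⋃ f x xs → ∃ λ z → w ∈L f z
  ⋃-inv f x []       d          = x , d
  ⋃-inv f x (y ∷ ys) (unionˡ d) = x , d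
  ⋃-inv f x (y ∷ ys) (unionʳ d) = ⋃-inv f y ys d

  chr·-inv : ∀ {a : Fin k} {E w} → w ∈L (chr a · E) → ∃ λ v → w ≡ a ∷ v × v ∈L E
  chr·-inv (cat chr d) = _ , refl , d

  chr· : ∀ {a : Fin k} {E w} → w ∈L E → (a ∷ w) ∈L (chr a · E)
  chr· d = cat chr d

  star-++ : ∀ {E : Regex k} {u v} → u ∈L (E *) → v ∈L (E *) → (u ++ v) ∈L (E *)
  star-++ star-nil d = d
  star-++ {E} {v = v} (star-cons {u} {w} c d) e = subst (_∈L (E *)) (sym (++-assoc u w v)) (star-cons c (star-++ d e))

  star-one : ∀ {E : Regex k} {u} → u ∈L E → u ∈L (E *)
  star-one {E} {u} d = subst (_∈L (E *)) (++-identityʳ u) (star-cons d star-nil)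

  letters-star : {X : Set} (g : X → Fin k) {E : Regex k} → (∀ x → [ g x ] ∈L E) → ∀ xs → map g xs ∈L (E *)
  letters-star g ok []       = star-nil
  letters-star g ok (x ∷ xs) = star-cons (ok x) (letters-star g ok xs)

  star-letters : {X : Set} (g : X → Fin k) {E : Regex k} → (∀ {w} → w ∈L E → ∃ λ x → w ≡ [ g x ]) →
    ∀ {w} → w ∈L (E *) → ∃ λ xs → w ≡ map g xs
  star-letters g ok star-nil        = [] , refl
  star-letters g ok (star-cons c d) with ok c | star-letters g ok d
  ... | x , refl | xs , refl = x ∷ xs , refl

  -- Kleene's construction for the complete digraph on V whose edge from u to v carries the letter e u v.
  module Paths {V : Set} (e : V → V → Fin k) where

    paths : List V → V → V → Regex k
    paths []       u v = chr (e u v)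
    paths (x ∷ xs) u v = paths xs u v ∪ (paths xs u x · ((paths xs x x *) · paths xs x v))

    data Path : V → List (Fin k) → V → Set where
      edge : ∀ {u v} → Path u [ e u v ] v
      hop  : ∀ {u x w v} → Path x w v → Path u (e u x ∷ w) v

    Path-++ : ∀ {u w x w′ v} → Path u w x → Path x w′ v → Path u (w ++ w′) v
    Path-++ edge    q = hop q
    Path-++ (hop p) q = hop (Path-++ p q)

    paths-sound : ∀ xs {u v w} → w ∈L paths xs u v → Path u w v
    loops-sound : ∀ xs {x v w w′} → w ∈L (paths xs x x *) → Path x w′ v → Path x (w ++ w′) v
    paths-sound []       chr = edge
    paths-sound (x ∷ xs) (unionˡ d) = paths-sound xs d
    paths-sound (x ∷ xs) (unionʳ (cat c (cat d e))) = Path-++ (paths-sound xs c) (loops-sound xs d (paths-sound xs e))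
    loops-sound xs star-nil p = p
    loops-sound xs {w′ = w′} (star-cons {u} {v} c d) p =
      subst (λ w → Path _ w _) (sym (++-assoc u v w′)) (Path-++ (paths-sound xs c) (loops-sound xs d p))

    edge∈ : ∀ xs u v → [ e u v ] ∈L paths xs u v
    edge∈ []       u v = chr
    edge∈ (x ∷ xs) u v = unionˡ (edge∈ xs u v)

    private
      Into From : List V → V → V → List (Fin k) → Set
      Into xs u x w = w ∈L (paths xs u x · (paths xs x x *))
      From xs x v w = w ∈L ((paths xs x x *) · paths xs x v)

      into : ∀ {xs u x w} → w ∈L paths (x ∷ xs) u x → Into xs u x w
      into (unionˡ d) = subst (_∈L _) (++-identityʳ _) (cat d star-nil)
      into {w = w} (unionʳ (cat {u} c (cat d e))) = cat c (star-++ d (star-one e))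

      from : ∀ {xs x v w} → w ∈L paths (x ∷ xs) x v → From xs x v w
      from (unionˡ d) = cat star-nil d
      from {xs} {x} {v} (unionʳ (cat {u} {w} c (cat {u′} {v′} d e))) =
        subst (_∈L _) (++-assoc u u′ v′) (cat (star-cons c d) e)

      meet : ∀ {xs u x v w w′} → Into xs u x w → From xs x v w′ → (w ++ w′) ∈L paths (x ∷ xs) u v
      meet (cat {a} {b} p q) (cat {c} {d} r s) = unionʳ (subst (_∈L _)
        (trans (cong (a ++_) (++-assoc b c d)) (sym (++-assoc a b (c ++ d)))) (cat p (cat (star-++ q r) s)))

    join∈ : ∀ xs {u z v w w′} → z ∈ xs → w ∈L paths xs u z → w′ ∈L paths xs z v → (w ++ w′) ∈L paths xs u v
    join∈ (x ∷ xs) (here refl) p q = meet (into p) (from q)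
    join∈ (x ∷ xs) (there i) (unionˡ p) (unionˡ q) = unionˡ (join∈ xs i p q)
    join∈ (x ∷ xs) {w′ = w′} (there i) (unionʳ (cat {a} p (cat {b} {c} p′ p″))) (unionˡ q) =
      unionʳ (subst (_∈L _) (trans (cong (a ++_) (sym (++-assoc b c w′))) (sym (++-assoc a (b ++ c) w′)))
        (cat p (cat p′ (join∈ xs i p″ q))))
    join∈ (x ∷ xs) {w = w} (there i) (unionˡ p) (unionʳ (cat {a} {b} q q′)) =
      unionʳ (subst (_∈L _) (++-assoc w a b) (cat (join∈ xs i p q) q′))
    join∈ (x ∷ xs) (there i) (unionʳ (cat {a} p (cat {b} {c} p′ p″))) (unionʳ (cat {d} q (cat {e₁} {f} q′ q″))) =
      unionʳ (subst (_∈L _) reassoc (cat p (cat (star-++ p′ (star-cons (join∈ xs i p″ q) q′)) q″)))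
      where
      reassoc : a ++ (b ++ (c ++ d) ++ e₁) ++ f ≡ (a ++ b ++ c) ++ d ++ e₁ ++ f
      reassoc = trans (cong (a ++_) (trans (++-assoc b ((c ++ d) ++ e₁) f) (cong (b ++_)
          (trans (++-assoc (c ++ d) e₁ f) (++-assoc c d (e₁ ++ f))))))
        (trans (cong (a ++_) (sym (++-assoc b c (d ++ e₁ ++ f)))) (sym (++-assoc a (b ++ c) (d ++ e₁ ++ f))))

    paths-complete : ∀ xs → (∀ x → x ∈ xs) → ∀ {u w v} → Path u w v → w ∈L paths xs u v
    paths-complete xs all edge    = edge∈ xs _ _
    paths-complete xs all (hop p) = join∈ xs (all _) (edge∈ xs _ _) (paths-complete xs all p)

-- Configurations as rows

nth-const : {X A : Set} (d : A) (xs : List X) (i : ℕ) → nth d (map (λ _ → d) xs) i ≡ d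
nth-const d []       i       = refl
nth-const d (x ∷ xs) zero    = refl
nth-const d (x ∷ xs) (suc i) = nth-const d xs i

tabulate-nth₂ : {A B C : Set} (F : A → B → C) (a : A) (b : B) (ts : List (A × B)) {n : ℕ} → length ts ≡ n →
  tabulate {n = n} (λ j → F (nth a (map proj₁ ts) (toℕ j)) (nth b (map proj₂ ts) (toℕ j))) ≡ map (uncurry F) ts
tabulate-nth₂ F a b []       refl = refl
tabulate-nth₂ F a b (t ∷ ts) refl = cong (uncurry F t ∷_) (tabulate-nth₂ F a b ts refl)

tabulate-nth : {A C : Set} (F : A → C) (a : A) (xs : List A) → tabulate {n = length xs} (λ j → F (nth a xs (toℕ j))) ≡ map F xs
tabulate-nth F a []       = refl
tabulate-nth F a (x ∷ xs) = cong (F x ∷_) (tabulate-nth F a xs)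

module BlankEquivalence (M : TM) where
  open TM M

  infix 4 _≈_

  -- Needed because row 0 of a crossword spells an initial configuration padded with explicit
  -- blanks. Lists that differ only in final blanks have the same entries under the default `zero`.
  record _≈_ (c d : Config M) : Set where
    constructor equivalent
    field
      state-≈ : Config.state c ≡ Config.state d
      head-≈  : Config.head c ≡ Config.head d
      left-≈  : ∀ i → nth zero (Config.left c) i ≡ nth zero (Config.left d) i
      right-≈ : ∀ i → nth zero (Config.right c) i ≡ nth zero (Config.right d) i

  nth-∷ : ∀ {x : Sym M} {l l′} → (∀ i → nth zero l i ≡ nth zero l′ i) → ∀ i → nth zero (x ∷ l) i ≡ nth zero (x ∷ l′) i
  nth-∷ eq zero    = refl
  nth-∷ eq (suc i) = eq i

  moveL-≈ : ∀ q x l l′ {r r′} → (∀ i → nth zero l i ≡ nth zero l′ i) → (∀ i → nth zero r i ≡ nth zero r′ i) →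
    moveL M q l x r ≈ moveL M q l′ x r′
  moveL-≈ q x []      []       lf rt = equivalent refl refl lf (nth-∷ rt)
  moveL-≈ q x []      (_ ∷ _)  lf rt = equivalent refl (lf 0) (lf ∘ suc) (nth-∷ rt)
  moveL-≈ q x (_ ∷ _) []       lf rt = equivalent refl (lf 0) (lf ∘ suc) (nth-∷ rt)
  moveL-≈ q x (_ ∷ _) (_ ∷ _)  lf rt = equivalent refl (lf 0) (lf ∘ suc) (nth-∷ rt)

  moveR-≈ : ∀ q x r r′ {l l′} → (∀ i → nth zero l i ≡ nth zero l′ i) → (∀ i → nth zero r i ≡ nth zero r′ i) →
    moveR M q l x r ≈ moveR M q l′ x r′
  moveR-≈ q x []      []       lf rt = equivalent refl refl (nth-∷ lf) rt
  moveR-≈ q x []      (_ ∷ _)  lf rt = equivalent refl (rt 0) (nth-∷ lf) (rt ∘ suc)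
  moveR-≈ q x (_ ∷ _) []       lf rt = equivalent refl (rt 0) (nth-∷ lf) (rt ∘ suc)
  moveR-≈ q x (_ ∷ _) (_ ∷ _)  lf rt = equivalent refl (rt 0) (nth-∷ lf) (rt ∘ suc)

  step-≈ : ∀ {c d} → c ≈ d → step M c ≈ step M d
  step-≈ {cfg q l a r} {cfg .q l′ .a r′} (equivalent refl refl lf rt) with δ q a
  ... | nothing           = equivalent refl refl lf rt
  ... | just (q′ , x , L) = moveL-≈ q′ x l l′ lf rt
  ... | just (q′ , x , R) = moveR-≈ q′ x r r′ lf rt

  run-≈ : ∀ n {c d} → c ≈ d → run M n c ≈ run M n d
  run-≈ zero    e = e
  run-≈ (suc n) e = run-≈ n (step-≈ e)

  halted-≈ : ∀ {c d} → c ≈ d → Halted M c → Halted M d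
  halted-≈ {cfg q l a r} {cfg .q l′ .a r′} (equivalent refl refl _ _) h = h

  ≈-sym : ∀ {c d} → c ≈ d → d ≈ c
  ≈-sym (equivalent a b c d) = equivalent (sym a) (sym b) (sym ∘ c) (sym ∘ d)

module Rows (M : TM) where
  open TM M

  data Content : Set where
    plain  : Sym M → Content
    headed : Fin (suc nQ) → Sym M → Content

  row : Config M → List Content
  row (cfg q l a r) = map plain (reverse l) ++ headed q a ∷ map plain r

  stat : Sym M → Content × Content
  stat a = plain a , plain a

  -- Here `b` is the neighbour that receives the head: the cell on the left for a left move, on the
  -- right for a right move. Keeping it in one block with the scanned cell lets a row check the move
  -- locally. A halted configuration repeats itself, in agreement with `step`, so a crossword may go
  -- on after halting.
  activeWith : Fin (suc nQ) → Sym M → Sym M → Maybe (Fin (suc nQ) × Sym M × Move) → List (Content × Content)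
  activeWith q a b nothing             = [ headed q a , headed q a ]
  activeWith q a b (just (q′ , x , L)) = (plain b , headed q′ b) ∷ (headed q a , plain x) ∷ []
  activeWith q a b (just (q′ , x , R)) = (headed q a , plain x) ∷ (plain b , headed q′ b) ∷ []

  active : Fin (suc nQ) → Sym M → Sym M → List (Content × Content)
  active q a b = activeWith q a b (δ q a)

  -- The row below a configuration whose state is not halting has no head, hence cannot match.
  finalWith : Fin (suc nQ) → Sym M → Maybe (Fin (suc nQ) × Sym M × Move) → Content × Content
  finalWith q a nothing  = headed q a , headed q a
  finalWith q a (just _) = stat a

  final : Fin (suc nQ) → Sym M → Content × Content
  final q a = finalWith q a (δ q a)

  line : List (Sym M) → List (Content × Content) → List (Sym M) → List (Content × Content)
  line l ts r = map stat l ++ ts ++ map stat r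

  map-line : ∀ (p : Content × Content → Content) → (∀ a → p (stat a) ≡ plain a) → ∀ l ts r →
    map p (line l ts r) ≡ map plain l ++ map p ts ++ map plain r
  map-line p eq l ts r = trans (map-++ p (map stat l) _) (cong₂ _++_ (plains l)
    (trans (map-++ p ts _) (cong (map p ts ++_) (plains r))))
    where
    plains : ∀ l → map p (map stat l) ≡ map plain l
    plains []      = refl
    plains (a ∷ l) = cong₂ _∷_ (eq a) (plains l)

  above-line : ∀ l ts r → map proj₁ (line l ts r) ≡ map plain l ++ map proj₁ ts ++ map plain r
  above-line = map-line proj₁ (λ _ → refl)

  below-line : ∀ l ts r → map proj₂ (line l ts r) ≡ map plain l ++ map proj₂ ts ++ map plain r
  below-line = map-line proj₂ (λ _ → refl)

  -- A plain content never equals a headed one, so the head marks the place where both sides must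
  -- split.
  split-unique : ∀ l l′ {q q′ a a′ r r′} → map plain l ++ headed q a ∷ r ≡ map plain l′ ++ headed q′ a′ ∷ r′ →
    l ≡ l′ × q ≡ q′ × a ≡ a′ × r ≡ r′
  split-unique []      []       refl = refl , refl , refl , refl
  split-unique []      (_ ∷ _)  eq with () ← ∷-injectiveˡ eq
  split-unique (_ ∷ _) []       eq with () ← ∷-injectiveˡ eq
  split-unique (x ∷ l) (y ∷ l′) eq with ∷-injectiveˡ eq | split-unique l l′ (∷-injectiveʳ eq)
  ... | refl | refl , p = refl , p

  no-head : ∀ l l′ {q a r} → map plain l ++ headed q a ∷ r ≢ map plain l′
  no-head []      (_ ∷ _)  eq with () ← ∷-injectiveˡ eq
  no-head (x ∷ l) (_ ∷ l′) eq = no-head l l′ (∷-injectiveʳ eq)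

  plain-injective : ∀ {l r} → map plain l ≡ map plain r → l ≡ r
  plain-injective = map-injective λ { refl → refl }

  snoc-row : ∀ l b {cs} → map plain (l ++ [ b ]) ++ cs ≡ map plain l ++ plain b ∷ cs
  snoc-row []      b = refl
  snoc-row (x ∷ l) b = cong (plain x ∷_) (snoc-row l b)

  reverse-flip : ∀ {l l′ : List (Sym M)} → reverse l ≡ l′ → l ≡ reverse l′
  reverse-flip {l} eq = trans (sym (reverse-involutive l)) (cong reverse eq)

  -- The contents before the step contain exactly one head, both in the configuration and in the
  -- tiles. This pins the active block to the head; the state and symbol then agree too, and the
  -- contents after the step are forced.
  step-row : ∀ c l q a b r → row c ≡ map proj₁ (line l (active q a b) r) → row (step M c) ≡ map proj₂ (line l (active q a b) r)
  step-row c l q a b r eq rewrite above-line l (active q a b) r | below-line l (active q a b) r = stepped c eq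
    where
    stepped : ∀ c → row c ≡ map plain l ++ map proj₁ (active q a b) ++ map plain r →
      row (step M c) ≡ map plain l ++ map proj₂ (active q a b) ++ map plain r
    stepped (cfg q₀ l₀ a₀ r₀) eq with δ q a in δ≡
    stepped (cfg q₀ l₀ a₀ r₀) eq | nothing with split-unique (reverse l₀) l eq
    ... | refl , refl , refl , rr rewrite δ≡ = eq
    stepped (cfg q₀ l₀ a₀ r₀) eq | just (q′ , x , R) with split-unique (reverse l₀) l eq
    ... | refl , refl , refl , rr with plain-injective {r₀} {b ∷ r} rr
    ...   | refl rewrite δ≡ | unfold-reverse x l₀ = snoc-row (reverse l₀) x
    -- The block of a left move begins one cell before the head, so the cells to the left of the
    -- head are `l ++ [ b ]`, in configurations stored in reverse.
    stepped (cfg q₀ l₀ a₀ r₀) eq | just (q′ , x , L)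
      with split-unique (reverse l₀) (l ++ [ b ]) (trans eq (sym (snoc-row l b)))
    ... | ll , refl , refl , rr with plain-injective {r₀} {r} rr | reverse-flip {l₀} ll
    ...   | refl | refl rewrite δ≡ | reverse-++ l [ b ] | reverse-involutive l = refl

  -- A row can show the step only if the neighbour that the head moves to lies inside it, so a cell
  -- is provided on either side; supplying these cells is the task of the padding.
  stepped-row : ∀ q y l a z r → ∃ λ l′ → ∃ λ b → ∃ λ r′ →
    row (cfg q (y ∷ l) a (z ∷ r)) ≡ map proj₁ (line l′ (active q a b) r′)
  stepped-row q y l a z r with δ q a
  ... | nothing = reverse (y ∷ l) , a , z ∷ r , sym (above-line (reverse (y ∷ l)) [ headed q a , headed q a ] (z ∷ r))
  ... | just (q′ , x , R) = reverse (y ∷ l) , z , r , sym (above-line (reverse (y ∷ l)) (activeWith q a z (just (q′ , x , R))) r)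
  ... | just (q′ , x , L) = reverse l , y , z ∷ r , trans (cong (λ l′ → map plain l′ ++ headed q a ∷ map plain (z ∷ r)) (unfold-reverse y l))
    (trans (snoc-row (reverse l) y) (sym (above-line (reverse l) (activeWith q a y (just (q′ , x , L))) (z ∷ r))))

  final-row : ∀ c l q a r → row c ≡ map proj₁ (line l [ final q a ] r) → Halted M c
  final-row (cfg q₀ l₀ a₀ r₀) l q a r eq with δ q a in δ≡ | trans eq (above-line l [ final q a ] r)
  ... | nothing | eq′ with split-unique (reverse l₀) l eq′
  ...   | refl , refl , refl , _ = δ≡
  final-row (cfg q₀ l₀ a₀ r₀) l q a r eq | just _ | eq′ =
    ⊥-elim (no-head (reverse l₀) (l ++ a ∷ r) (trans eq′ (sym (map-++ plain l (a ∷ r)))))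

-- The crossword of a computation

elements : {A : Set} → Finite A → List A
elements F = map (at F) (allFin (size F))

∈-elements : {A : Set} (F : Finite A) (a : A) → a ∈ elements F
∈-elements F a = subst (_∈ elements F) (at-index F a) (∈-map⁺ (at F) (∈-allFin (index F a)))

module CrosswordOf (M : TM) where
  open TM M
  open Rows M

  -- Row 0 is corner, wallTop, then the letters `first` spelling the initial configuration; every later row is
  -- stepMark (or stopMark, in the last row), wall, then tiles holding the content of a cell before and after a step.
  data Letter : Set where
    corner stepMark stopMark wallTop wall : Letter
    first : Content → Letter
    tile  : Content → Content → Letter

  abstract
    Content-finite : Finite Content
    Content-finite = retract-finite to from (λ { (plain a) → refl ; (headed q a) → refl })
      (⊎-finite (Fin-finite (3 + extra)) (×-finite (Fin-finite (suc nQ)) (Fin-finite (3 + extra))))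
      where
      to : Content → Sym M ⊎ (Fin (suc nQ) × Sym M)
      to (plain a)    = inj₁ a
      to (headed q a) = inj₂ (q , a)
      from : Sym M ⊎ (Fin (suc nQ) × Sym M) → Content
      from (inj₁ a)       = plain a
      from (inj₂ (q , a)) = headed q a

    Letter-finite : Finite Letter
    Letter-finite = retract-finite to from from-to
      (⊎-finite (Fin-finite 5) (⊎-finite Content-finite (×-finite Content-finite Content-finite)))
      where
      to : Letter → Fin 5 ⊎ (Content ⊎ (Content × Content))
      to corner     = inj₁ zero
      to stepMark   = inj₁ (suc zero)
      to stopMark   = inj₁ (suc (suc zero))
      to wallTop    = inj₁ (suc (suc (suc zero)))
      to wall       = inj₁ (suc (suc (suc (suc zero))))
      to (first c)  = inj₂ (inj₁ c)
      to (tile c d) = inj₂ (inj₂ (c , d))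
      from : Fin 5 ⊎ (Content ⊎ (Content × Content)) → Letter
      from (inj₁ zero)                         = corner
      from (inj₁ (suc zero))                   = stepMark
      from (inj₁ (suc (suc zero)))             = stopMark
      from (inj₁ (suc (suc (suc zero))))       = wallTop
      from (inj₁ (suc (suc (suc (suc zero))))) = wall
      from (inj₂ (inj₁ c))                     = first c
      from (inj₂ (inj₂ (c , d)))               = tile c d
      from-to : ∀ x → from (to x) ≡ x
      from-to corner     = refl
      from-to stepMark   = refl
      from-to stopMark   = refl
      from-to wallTop    = refl
      from-to wall       = refl
      from-to (first c)  = refl
      from-to (tile c d) = refl

  letters : ℕ
  letters = size Letter-finite

  ⌜_⌝ : Letter → Fin letters
  ⌜_⌝ = index Letter-finite

  tileOf : Content × Content → Letter
  tileOf (c , d) = tile c d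

  headSym : Word → Sym M
  headSym []      = zero
  headSym (b ∷ w) = bitSym M b

  tailSyms : Word → List (Sym M)
  tailSyms []      = []
  tailSyms (b ∷ w) = map (bitSym M) w

  padding : List ⊤ → List (Sym M)
  padding = map (λ _ → zero)

  padded : List ⊤ → Word → List ⊤ → Config M
  padded I w J = cfg zero (reverse (padding I)) (headSym w) (tailSyms w ++ padding J)

  data Column : Content → List Letter → Set where
    end  : ∀ {c d} → Column c [ tile c d ]
    more : ∀ {c d w} → Column d w → Column c (tile c d ∷ w)

  -- The language of `crosswordR w` as a grammar. In an upright crossword `top`, `across` and `last`
  -- are rows, while `side`, `border` and `column` are columns. The first letter decides the shape
  -- except for `corner`, which starts both `top` and `side`; no shape starts with `wall` or with a
  -- tile.
  data Shape (w : Word) : List Letter → Set where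
    top    : ∀ I J → Shape w (corner ∷ wallTop ∷ map first (row (padded I w J)))
    side   : (I : List ⊤) → Shape w (corner ∷ map (λ _ → stepMark) I ++ [ stopMark ])
    across : ∀ l q a b r → Shape w (stepMark ∷ wall ∷ map tileOf (line l (active q a b) r))
    last   : ∀ l q a r → Shape w (stopMark ∷ wall ∷ map tileOf (line l [ final q a ] r))
    border : (I : List ⊤) → Shape w (wallTop ∷ wall ∷ map (λ _ → wall) I)
    column : ∀ {c xs} → Column c xs → Shape w (first c ∷ xs)

  blankR wallR statR : Regex letters
  blankR = chr ⌜ first (plain zero) ⌝
  wallR  = chr ⌜ wall ⌝
  statR  = ⋃ (λ a → chr ⌜ tileOf (stat a) ⌝) zero (elements (Fin-finite (3 + extra)))

  tilesR : List (Content × Content) → Regex letters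
  tilesR []       = eps
  tilesR (t ∷ ts) = chr ⌜ tileOf t ⌝ · tilesR ts

  Keys₃ : Finite (Fin (suc nQ) × Sym M × Sym M)
  Keys₃ = ×-finite (Fin-finite (suc nQ)) (×-finite (Fin-finite (3 + extra)) (Fin-finite (3 + extra)))

  Keys₂ : Finite (Fin (suc nQ) × Sym M)
  Keys₂ = ×-finite (Fin-finite (suc nQ)) (Fin-finite (3 + extra))

  actionTiles : Fin (suc nQ) × Sym M × Sym M → List (Content × Content)
  actionTiles (q , a , b) = active q a b

  finalTiles : Fin (suc nQ) × Sym M → List (Content × Content)
  finalTiles (q , a) = [ final q a ]

  lineR : {A : Set} → Finite A → A → (A → List (Content × Content)) → Regex letters
  lineR F a₀ ts = (statR *) · (⋃ (tilesR ∘ ts) a₀ (elements F) · (statR *))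

  open Paths (λ c d → ⌜ tile c d ⌝)

  columnOf : Content × Content → Regex letters
  columnOf (c , d) = chr ⌜ first c ⌝ · paths (elements Content-finite) c d

  sideR acrossR lastR borderR columnR fixedR : Regex letters
  sideR   = chr ⌜ corner ⌝ · ((chr ⌜ stepMark ⌝ *) · chr ⌜ stopMark ⌝)
  acrossR = chr ⌜ stepMark ⌝ · (wallR · lineR Keys₃ (zero , zero , zero) actionTiles)
  lastR   = chr ⌜ stopMark ⌝ · (wallR · lineR Keys₂ (zero , zero) finalTiles)
  borderR = chr ⌜ wallTop ⌝ · (wallR · (wallR *))
  columnR = ⋃ columnOf (plain zero , plain zero) (elements (×-finite Content-finite Content-finite))
  fixedR  = sideR ∪ (acrossR ∪ (lastR ∪ (borderR ∪ columnR)))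

  symsR : Word → Regex letters
  symsR []      = blankR *
  symsR (b ∷ w) = chr ⌜ first (plain (bitSym M b)) ⌝ · symsR w

  tailR : Word → Regex letters
  tailR []      = blankR *
  tailR (b ∷ w) = symsR w

  topR : Word → Regex letters
  topR w = chr ⌜ corner ⌝ · (chr ⌜ wallTop ⌝ · ((blankR *) · (chr ⌜ first (headed zero (headSym w)) ⌝ · tailR w)))

  -- Only the summand `topR w` depends on the input, so for a fixed machine the code of `fixedR` is
  -- a constant of the reduction.
  crosswordR : Word → Regex letters
  crosswordR w = topR w ∪ fixedR

  spell : List Letter → List (Fin letters)
  spell = map ⌜_⌝

  row-padded : ∀ I w J → row (padded I w J) ≡
    map (λ _ → plain zero) I ++ headed zero (headSym w) ∷ map plain (tailSyms w) ++ map (λ _ → plain zero) J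
  row-padded I w J = cong₂ _++_
    (trans (cong (map plain) (reverse-involutive (padding I))) (sym (map-∘ I)))
    (cong (headed zero (headSym w) ∷_) (trans (map-++ plain (tailSyms w) (padding J))
      (cong (map plain (tailSyms w) ++_) (sym (map-∘ J)))))

  private
    Spelled : Word → List (Fin letters) → Set
    Spelled w v = ∃ λ xs → v ≡ spell xs × Shape w xs

  symsR-sound : ∀ w {v} → v ∈L symsR w → ∃ λ (J : List ⊤) → v ≡ spell (map first (map plain (map (bitSym M) w) ++ map (λ _ → plain zero) J))
  symsR-sound [] d with star-letters (λ (_ : ⊤) → ⌜ first (plain zero) ⌝) (λ { chr → tt , refl }) d
  ... | J , refl = J , trans (map-∘ J) (cong spell (map-∘ J))
  symsR-sound (b ∷ w) d with chr·-inv d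
  ... | v , refl , e with symsR-sound w e
  ...   | J , refl = J , refl

  tailR-sound : ∀ w {v} → v ∈L tailR w → ∃ λ (J : List ⊤) → v ≡ spell (map first (map plain (tailSyms w) ++ map (λ _ → plain zero) J))
  tailR-sound []      = symsR-sound []
  tailR-sound (b ∷ w) = symsR-sound w

  symsR-complete : ∀ w (J : List ⊤) → spell (map first (map plain (map (bitSym M) w) ++ map (λ _ → plain zero) J)) ∈L symsR w
  symsR-complete []      J = subst (_∈L (blankR *)) (trans (map-∘ J) (cong spell (map-∘ J)))
    (letters-star (λ (_ : ⊤) → ⌜ first (plain zero) ⌝) (λ _ → chr) J)
  symsR-complete (b ∷ w) J = chr· (symsR-complete w J)

  tailR-complete : ∀ w (J : List ⊤) → spell (map first (map plain (tailSyms w) ++ map (λ _ → plain zero) J)) ∈L tailR w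
  tailR-complete []      = symsR-complete []
  tailR-complete (b ∷ w) = symsR-complete w

  spell-padded : ∀ w (I J : List ⊤) → spell (map first (row (padded I w J))) ≡ map (λ _ → ⌜ first (plain zero) ⌝) I ++
    ⌜ first (headed zero (headSym w)) ⌝ ∷ spell (map first (map plain (tailSyms w) ++ map (λ _ → plain zero) J))
  spell-padded w I J = trans (cong (spell ∘ map first) (row-padded I w J))
    (trans (sym (map-∘ (map (λ _ → plain zero) I ++ _)))
    (trans (map-++ (⌜_⌝ ∘ first) (map (λ _ → plain zero) I) _)
      (cong₂ _++_ (sym (map-∘ I)) (cong (⌜ first (headed zero (headSym w)) ⌝ ∷_) (map-∘ _)))))

  topR-sound : ∀ w {v} → v ∈L topR w → Spelled w v
  topR-sound w d with chr·-inv d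
  ... | _ , refl , d′ with chr·-inv d′
  ... | _ , refl , cat i e with star-letters (λ (_ : ⊤) → ⌜ first (plain zero) ⌝) (λ { chr → tt , refl }) i | chr·-inv e
  ... | I , refl | _ , refl , j with tailR-sound w j
  ... | J , refl = _ , cong (λ v → ⌜ corner ⌝ ∷ ⌜ wallTop ⌝ ∷ v) (sym (spell-padded w I J)) , top I J

  topR-complete : ∀ w I J → spell (corner ∷ wallTop ∷ map first (row (padded I w J))) ∈L topR w
  topR-complete w I J = chr· (chr· (subst (_∈L _) (sym (spell-padded w I J))
    (cat (letters-star (λ (_ : ⊤) → ⌜ first (plain zero) ⌝) (λ _ → chr) I) (chr· (tailR-complete w J)))))

  tilesR-sound : ∀ ts {v} → v ∈L tilesR ts → v ≡ spell (map tileOf ts)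
  tilesR-sound []       eps       = refl
  tilesR-sound (t ∷ ts) (cat chr d) = cong (⌜ tileOf t ⌝ ∷_) (tilesR-sound ts d)

  tilesR-complete : ∀ ts → spell (map tileOf ts) ∈L tilesR ts
  tilesR-complete []       = eps
  tilesR-complete (t ∷ ts) = chr· (tilesR-complete ts)

  spell-line : ∀ l ts r → spell (map tileOf (line l ts r)) ≡
    map (λ a → ⌜ tileOf (stat a) ⌝) l ++ spell (map tileOf ts) ++ map (λ a → ⌜ tileOf (stat a) ⌝) r
  spell-line l ts r = trans (sym (map-∘ (line l ts r))) (trans (map-++ (⌜_⌝ ∘ tileOf) (map stat l) _)
    (cong₂ _++_ (sym (map-∘ l)) (trans (map-++ (⌜_⌝ ∘ tileOf) ts _) (cong₂ _++_ (map-∘ ts) (sym (map-∘ r))))))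

  stat-sound : ∀ {v} → v ∈L statR → ∃ λ a → v ≡ [ ⌜ tileOf (stat a) ⌝ ]
  stat-sound d with ⋃-inv _ zero (elements (Fin-finite (3 + extra))) d
  ... | a , chr = a , refl

  stat-complete : ∀ a → [ ⌜ tileOf (stat a) ⌝ ] ∈L statR
  stat-complete a = ∈-⋃ (λ a → chr ⌜ tileOf (stat a) ⌝) (there (∈-elements (Fin-finite (3 + extra)) a)) chr

  lineR-sound : {A : Set} (F : Finite A) (a₀ : A) (ts : A → List (Content × Content)) → ∀ {v} → v ∈L lineR F a₀ ts →
    ∃ λ l → ∃ λ z → ∃ λ r → v ≡ spell (map tileOf (line l (ts z) r))
  lineR-sound F a₀ ts (cat i (cat d j)) with star-letters _ stat-sound i | ⋃-inv (tilesR ∘ ts) a₀ (elements F) d | star-letters _ stat-sound j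
  ... | l , refl | z , e | r , refl = l , z , r , trans (cong (λ v → map _ l ++ v ++ map _ r) (tilesR-sound (ts z) e)) (sym (spell-line l (ts z) r))

  lineR-complete : {A : Set} (F : Finite A) (a₀ : A) (ts : A → List (Content × Content)) → ∀ l z r →
    spell (map tileOf (line l (ts z) r)) ∈L lineR F a₀ ts
  lineR-complete F a₀ ts l z r = subst (_∈L _) (sym (spell-line l (ts z) r))
    (cat (letters-star _ stat-complete l) (cat (∈-⋃ (tilesR ∘ ts) (there (∈-elements F z)) (tilesR-complete (ts z)))
      (letters-star _ stat-complete r)))

  Path-Column : ∀ {c v d} → Path c v d → ∃ λ xs → v ≡ spell xs × Column c xs
  Path-Column edge    = _ , refl , end
  Path-Column (hop p) with Path-Column p
  ... | xs , refl , k = _ , refl , more k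

  Column-Path : ∀ {c xs} → Column c xs → ∃ λ d → Path c (spell xs) d
  Column-Path end      = _ , edge
  Column-Path (more k) with Column-Path k
  ... | d , p = d , hop p

  crosswordR-sound : ∀ w {v} → v ∈L crosswordR w → Spelled w v
  crosswordR-sound w (unionˡ d) = topR-sound w d
  crosswordR-sound w (unionʳ (unionˡ d)) with chr·-inv d
  ... | _ , refl , cat i chr with star-letters (λ (_ : ⊤) → ⌜ stepMark ⌝) (λ { chr → tt , refl }) i
  ... | I , refl = _ , cong (⌜ corner ⌝ ∷_) (sym (trans (map-++ ⌜_⌝ (map (λ _ → stepMark) I) _) (cong (_++ _) (sym (map-∘ I))))) , side I
  crosswordR-sound w (unionʳ (unionʳ (unionˡ d))) with chr·-inv d
  ... | _ , refl , d′ with chr·-inv d′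
  ... | _ , refl , e with lineR-sound Keys₃ (zero , zero , zero) actionTiles e
  ... | l , (q , a , b) , r , refl = _ , refl , across l q a b r
  crosswordR-sound w (unionʳ (unionʳ (unionʳ (unionˡ d)))) with chr·-inv d
  ... | _ , refl , d′ with chr·-inv d′
  ... | _ , refl , e with lineR-sound Keys₂ (zero , zero) finalTiles e
  ... | l , (q , a) , r , refl = _ , refl , last l q a r
  crosswordR-sound w (unionʳ (unionʳ (unionʳ (unionʳ (unionˡ d))))) with chr·-inv d
  ... | _ , refl , d′ with chr·-inv d′
  ... | _ , refl , i with star-letters (λ (_ : ⊤) → ⌜ wall ⌝) (λ { chr → tt , refl }) i
  ... | I , refl = _ , cong (λ v → ⌜ wallTop ⌝ ∷ ⌜ wall ⌝ ∷ v) (map-∘ I) , border I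
  crosswordR-sound w (unionʳ (unionʳ (unionʳ (unionʳ (unionʳ d)))))
    with ⋃-inv columnOf (plain zero , plain zero) (elements (×-finite Content-finite Content-finite)) d
  ... | (c , d′) , e with chr·-inv e
  ... | _ , refl , p with Path-Column (paths-sound (elements Content-finite) p)
  ... | xs , refl , k = _ , refl , column k

  crosswordR-complete : ∀ w {xs} → Shape w xs → spell xs ∈L crosswordR w
  crosswordR-complete w (top I J) = unionˡ (topR-complete w I J)
  crosswordR-complete w (side I) = unionʳ (unionˡ (chr· (subst (_∈L _)
    (sym (trans (map-++ ⌜_⌝ (map (λ _ → stepMark) I) _) (cong (_++ _) (sym (map-∘ I)))))
    (cat (letters-star (λ (_ : ⊤) → ⌜ stepMark ⌝) (λ _ → chr) I) chr))))
  crosswordR-complete w (across l q a b r) =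
    unionʳ (unionʳ (unionˡ (chr· (chr· (lineR-complete Keys₃ (zero , zero , zero) actionTiles l (q , a , b) r)))))
  crosswordR-complete w (last l q a r) =
    unionʳ (unionʳ (unionʳ (unionˡ (chr· (chr· (lineR-complete Keys₂ (zero , zero) finalTiles l (q , a) r))))))
  crosswordR-complete w (border I) = unionʳ (unionʳ (unionʳ (unionʳ (unionˡ (chr· (chr·
    (subst (_∈L _) (map-∘ I) (letters-star (λ (_ : ⊤) → ⌜ wall ⌝) (λ _ → chr) I))))))))
  crosswordR-complete w (column {c} k) with Column-Path k
  ... | d , p = unionʳ (unionʳ (unionʳ (unionʳ (unionʳ
    (∈-⋃ columnOf (there (∈-elements (×-finite Content-finite Content-finite) (c , d)))
      (chr· (paths-complete (elements Content-finite) (∈-elements Content-finite) p)))))))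

  crosswordR-positive : ∀ w → Positive (crosswordR w)
  crosswordR-positive w d with crosswordR-sound w d
  ... | []     , refl , ()
  ... | _ ∷ _  , ()   , _

-- Crosswords exist exactly for halting computations

tabulate-injective : {A : Set} {n : ℕ} {f g : Fin n → A} → tabulate f ≡ tabulate g → ∀ i → f i ≡ g i
tabulate-injective eq zero    = ∷-injectiveˡ eq
tabulate-injective eq (suc i) = tabulate-injective (∷-injectiveʳ eq) i

module Correctness (M : TM) where
  open TM M
  open Rows M
  open BlankEquivalence M
  open CrosswordOf M

  padded-≈ : ∀ I w J → padded I w J ≈ initial M w
  padded-≈ I w J = padded≈ w
    where
    left≈ : ∀ i → nth zero (reverse (padding I)) i ≡ zero
    left≈ i = trans (cong (λ l → nth zero l i) (sym (reverse-map (λ _ → zero) I))) (nth-const zero (reverse I) i)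
    right≈ : ∀ l i → nth zero (l ++ padding J) i ≡ nth zero l i
    right≈ []      i       = nth-const zero J i
    right≈ (a ∷ l) zero    = refl
    right≈ (a ∷ l) (suc i) = right≈ l i
    padded≈ : ∀ w → padded I w J ≈ initial M w
    padded≈ []      = equivalent refl refl left≈ (right≈ [])
    padded≈ (b ∷ w) = equivalent refl refl left≈ (right≈ (map (bitSym M) w))

  before after : Letter → Content
  before (tile c d) = c
  before _          = plain zero
  after (tile c d) = d
  after _          = plain zero

  map-before : ∀ ts → map before (map tileOf ts) ≡ map proj₁ ts
  map-before []       = refl
  map-before (t ∷ ts) = cong (proj₁ t ∷_) (map-before ts)

  map-after : ∀ ts → map after (map tileOf ts) ≡ map proj₂ ts
  map-after []       = refl
  map-after (t ∷ ts) = cong (proj₂ t ∷_) (map-after ts)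

  Column-before : ∀ {c x xs} → Column c (x ∷ xs) → before x ≡ c
  Column-before end      = refl
  Column-before (more k) = refl

  Column-after : ∀ {c x y ys} → Column c (x ∷ y ∷ ys) → Column (after x) (y ∷ ys)
  Column-after (more k) = k

  module _ {w : Word} where

    below-stepMark : ∀ {x xs} → Shape w (stepMark ∷ x ∷ xs) →
      ∃ λ l → ∃ λ q → ∃ λ a → ∃ λ b → ∃ λ r → x ≡ wall × xs ≡ map tileOf (line l (active q a b) r)
    below-stepMark (across l q a b r) = l , q , a , b , r , refl , refl

    below-stopMark : ∀ {x xs} → Shape w (stopMark ∷ x ∷ xs) →
      ∃ λ l → ∃ λ q → ∃ λ a → ∃ λ r → x ≡ wall × xs ≡ map tileOf (line l [ final q a ] r)
    below-stopMark (last l q a r) = l , q , a , r , refl , refl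

    below-first : ∀ {c xs} → Shape w (first c ∷ xs) → Column c xs
    below-first (column k) = k

    relabel : ∀ {x y xs} → x ≡ y → Shape w (x ∷ xs) → Shape w (y ∷ xs)
    relabel refl s = s

    -- The sequence of rows below row 0; the column of row marks runs down to the first stopMark.
    descend : ∀ {m n} (I : List ⊤) (marks walls : Fin m → Letter) (tiles : Fin m → Fin n → Letter)
      (prev : Fin n → Content) (c : Config M) →
      tabulate marks ≡ map (λ _ → stepMark) I ++ [ stopMark ] →
      (∀ i → Shape w (marks i ∷ walls i ∷ tabulate (tiles i))) →
      (∀ j → Column (prev j) (tabulate (λ i → tiles i j))) →
      tabulate prev ≡ row c → ∃ λ t → Halted M (run M t c)
    descend {suc m} {n} [] marks walls tiles prev c me rows cols eq
      with below-stopMark (relabel (∷-injectiveˡ me) (rows zero))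
    ... | l , q , a , r , _ , ts = 0 , final-row c l q a r
      (trans (sym eq) (trans (tabulate-cong (λ j → sym (Column-before (cols j))))
        (trans (sym (map-tabulate (tiles zero) before)) (trans (cong (map before) ts) (map-before _)))))
    descend {suc zero} (_ ∷ []) marks walls tiles prev c me rows cols eq with () ← ∷-injectiveʳ me
    descend {suc zero} (_ ∷ _ ∷ I) marks walls tiles prev c me rows cols eq with () ← ∷-injectiveʳ me
    descend {suc (suc m)} {n} (_ ∷ I) marks walls tiles prev c me rows cols eq
      with below-stepMark (relabel (∷-injectiveˡ me) (rows zero))
    ... | l , q , a , b , r , _ , ts with descend I (marks ∘ suc) (walls ∘ suc) (tiles ∘ suc) (λ j → after (tiles zero j)) (step M c)
        (∷-injectiveʳ me) (rows ∘ suc) (λ j → Column-after (cols j)) next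
      where
      -- The columns force the first content of each tile in this row to be the content handed down
      -- from the row above.
      current : row c ≡ map proj₁ (line l (active q a b) r)
      current = trans (sym eq) (trans (tabulate-cong (λ j → sym (Column-before (cols j))))
        (trans (sym (map-tabulate (tiles zero) before)) (trans (cong (map before) ts) (map-before _))))
      next : tabulate (λ j → after (tiles zero j)) ≡ row (step M c)
      next = trans (sym (map-tabulate (tiles zero) after)) (trans (cong (map after) ts)
        (trans (map-after _) (sym (step-row c l q a b r current))))
    ...   | t , h = suc t , h

    Grid : ℕ → ℕ → Set
    Grid m n = Fin (suc m) → Fin (suc n) → Letter

    Good : ∀ {m n} → Grid m n → Set
    Good B = (∀ i → Shape w (tabulate (B i))) × (∀ j → Shape w (tabulate (λ i → B i j)))

    marks-cases : ∀ {m} (f : Fin m → Letter) (I : List ⊤) → tabulate f ≡ map (λ _ → stepMark) I ++ [ stopMark ] →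
      ∀ i → f i ≡ stepMark ⊎ f i ≡ stopMark
    marks-cases {suc m} f []      eq zero    = inj₂ (∷-injectiveˡ eq)
    marks-cases {suc (suc m)} f [] eq (suc i) with () ← ∷-injectiveʳ eq
    marks-cases {suc m} f (_ ∷ I) eq zero    = inj₁ (∷-injectiveˡ eq)
    marks-cases {suc m} f (_ ∷ I) eq (suc i) = marks-cases (f ∘ suc) I (∷-injectiveʳ eq) i

    row-nonempty : ∀ c → ∃ λ x → ∃ λ xs → row c ≡ x ∷ xs
    row-nonempty (cfg q l a r) with reverse l
    ... | []    = _ , _ , refl
    ... | _ ∷ _ = _ , _ , refl

    tiles-nonempty : ∀ l t ts r → ∃ λ d → ∃ λ xs → map tileOf (line l (t ∷ ts) r) ≡ tileOf d ∷ xs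
    tiles-nonempty []      t ts r = _ , _ , refl
    tiles-nonempty (a ∷ l) t ts r = _ , _ , refl

    active-nonempty : ∀ q a b → ∃ λ t → ∃ λ ts → active q a b ≡ t ∷ ts
    active-nonempty q a b with δ q a
    ... | nothing           = _ , _ , refl
    ... | just (_ , _ , L)  = _ , _ , refl
    ... | just (_ , _ , R)  = _ , _ , refl

    after-mark : ∀ {x y xs} → Shape w (x ∷ y ∷ xs) → x ≡ stepMark ⊎ x ≡ stopMark →
      y ≡ wall × ∃ λ d → ∃ λ ys → xs ≡ tileOf d ∷ ys
    after-mark s (inj₁ refl) with below-stepMark s
    ... | l , q , a , b , r , refl , refl with active-nonempty q a b
    ...   | t , ts , eq rewrite eq = refl , tiles-nonempty l t ts r
    after-mark s (inj₂ refl) with below-stopMark s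
    ... | l , q , a , r , refl , refl = refl , tiles-nonempty l (final q a) [] r

    upright : ∀ {m n} (B : Grid m n) → Good B → ∀ I J (K : List ⊤) →
      tabulate (B zero) ≡ corner ∷ wallTop ∷ map first (row (padded I w J)) →
      tabulate (λ i → B i zero) ≡ corner ∷ map (λ _ → stepMark) K ++ [ stopMark ] → HaltsOn M w
    upright {n = zero} B g I J K re ce with () ← ∷-injectiveʳ re
    upright {n = suc n} B (rs , cs) I J K re ce with descend K (λ i → B (suc i) zero) (λ i → B (suc i) (suc zero))
        (λ i j → B (suc i) (suc (suc j))) content (padded I w J) (∷-injectiveʳ ce) (rs ∘ suc)
        (λ j → below-first (relabel (head≡ j) (cs (suc (suc j)))))
        contents
      where
      unfirst : Letter → Content
      unfirst (first c) = c
      unfirst _         = plain zero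
      content : Fin n → Content
      content j = unfirst (B zero (suc (suc j)))
      heads : tabulate (λ j → B zero (suc (suc j))) ≡ map first (row (padded I w J))
      heads = ∷-injectiveʳ (∷-injectiveʳ re)
      contents : tabulate content ≡ row (padded I w J)
      contents = trans (sym (map-tabulate _ unfirst)) (trans (cong (map unfirst) heads)
        (trans (sym (map-∘ (row (padded I w J)))) (map-id _)))
      head≡ : ∀ j → B zero (suc (suc j)) ≡ first (content j)
      head≡ = tabulate-injective (trans heads (trans (cong (map first) (sym contents)) (map-tabulate content first)))
    ... | t , h = t , halted-≈ (run-≈ t (padded-≈ I w J)) h

    -- The clash is in row 1 and column 2. Row 1 starts with `wallTop`, the second letter of column
    -- 0, so it consists of walls from there on; column 2 starts with a `first` letter, so it
    -- continues with a tile.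
    two-tops : ∀ {m n} (B : Grid m n) → Good B → ∀ I J I′ J′ →
      tabulate (B zero) ≡ corner ∷ wallTop ∷ map first (row (padded I w J)) →
      tabulate (λ i → B i zero) ≡ corner ∷ wallTop ∷ map first (row (padded I′ w J′)) → ⊥
    two-tops {zero} B g I J I′ J′ re ce with () ← ∷-injectiveʳ ce
    two-tops {suc m} {zero} B g I J I′ J′ re ce with () ← ∷-injectiveʳ re
    two-tops {suc m} {suc zero} B g I J I′ J′ re ce with row-nonempty (padded I w J)
    ... | x , xs , eq with () ← trans (∷-injectiveʳ (∷-injectiveʳ re)) (cong (map first) eq)
    two-tops {suc m} {suc (suc n)} B (rs , cs) I J I′ J′ re ce with row-nonempty (padded I w J)
    ... | x , xs , eq = contradict (third (relabel (∷-injectiveˡ (∷-injectiveʳ ce)) (rs (suc zero))) refl)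
          (Column-tile (below-first (relabel (∷-injectiveˡ (trans (∷-injectiveʳ (∷-injectiveʳ re)) (cong (map first) eq))) (cs (suc (suc zero))))))
      where
      third : ∀ {ys y z zs} → Shape w ys → ys ≡ wallTop ∷ y ∷ z ∷ zs → z ≡ wall
      third (border (_ ∷ I)) refl = refl
      Column-tile : ∀ {c x xs} → Column c (x ∷ xs) → ∃ λ d → x ≡ tileOf d
      Column-tile end      = _ , refl
      Column-tile (more _) = _ , refl
      contradict : ∀ {z} → z ≡ wall → (∃ λ d → z ≡ tileOf d) → ⊥
      contradict refl (d , ())

    -- This is the purpose of the wall. Row 1 starts with a mark, so its third letter is a tile; in
    -- a grid with only two columns there is no room for that tile. Otherwise column 2 starts with a
    -- mark as well, so its second letter, at the same position, is a wall.
    two-sides : ∀ {m n} (B : Grid m n) → Good B → (I I′ : List ⊤) →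
      tabulate (B zero) ≡ corner ∷ map (λ _ → stepMark) I ++ [ stopMark ] →
      tabulate (λ i → B i zero) ≡ corner ∷ map (λ _ → stepMark) I′ ++ [ stopMark ] → ⊥
    two-sides {zero} B g I [] re ce with () ← ∷-injectiveʳ ce
    two-sides {zero} B g I (_ ∷ _) re ce with () ← ∷-injectiveʳ ce
    two-sides {suc m} {zero} B g [] I′ re ce with () ← ∷-injectiveʳ re
    two-sides {suc m} {zero} B g (_ ∷ _) I′ re ce with () ← ∷-injectiveʳ re
    two-sides {suc m} {suc zero} B (rs , cs) I I′ re ce
      with after-mark (rs (suc zero)) (marks-cases (λ i → B (suc i) zero) I′ (∷-injectiveʳ ce) zero)
    ... | _ , d , ys , ()
    two-sides {suc m} {suc (suc n)} B (rs , cs) I I′ re ce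
      with after-mark (rs (suc zero)) (marks-cases (λ i → B (suc i) zero) I′ (∷-injectiveʳ ce) zero)
         | proj₁ (after-mark′ (cs (suc (suc zero))) (marks-cases (λ j → B zero (suc j)) I (∷-injectiveʳ re) (suc zero)))
      where
      after-mark′ : ∀ {x y xs} → Shape w (x ∷ y ∷ xs) → x ≡ stepMark ⊎ x ≡ stopMark → y ≡ wall × ⊤
      after-mark′ s k = proj₁ (after-mark s k) , tt
    ... | _ , d , ys , eq | eq′ with () ← trans (sym eq′) (∷-injectiveˡ eq)

    starts : ∀ {xs ys} → Shape w xs → xs ≡ corner ∷ ys →
      (∃ λ I → ∃ λ J → ys ≡ wallTop ∷ map first (row (padded I w J))) ⊎ (∃ λ (I : List ⊤) → ys ≡ map (λ _ → stepMark) I ++ [ stopMark ])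
    starts (top I J) refl = inj₁ (I , J , refl)
    starts (side I)  refl = inj₂ (I , refl)

    -- A letter following a non-corner letter in row 0 would have to start a column.
    second-starts : ∀ {zs x y xs} → Shape w zs → zs ≡ x ∷ y ∷ xs → (∀ {ys} → ¬ Shape w (y ∷ ys)) ⊎ x ≡ corner
    second-starts (top I J)          refl = inj₂ refl
    second-starts (side I)           eq   = inj₂ (sym (∷-injectiveˡ eq))
    second-starts (across l q a b r) refl = inj₁ λ ()
    second-starts (last l q a r)     refl = inj₁ λ ()
    second-starts (border I)         refl = inj₁ λ ()
    second-starts (column end)       refl = inj₁ λ ()
    second-starts (column (more _))  refl = inj₁ λ ()

    -- Rules out grids with a single column, whose row 0 has no second letter to argue with in
    -- `corner-first`.
    no-single : ∀ {xs x} → Shape w xs → xs ≢ [ x ]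
    no-single (side [])      ()
    no-single (side (_ ∷ _)) ()
    no-single (column end)      ()
    no-single (column (more _)) ()

    corner-first : ∀ {m n} (B : Grid m n) → Good B → B zero zero ≡ corner
    corner-first {n = zero}  B (rs , cs) = ⊥-elim (no-single (rs zero) refl)
    corner-first {n = suc n} B (rs , cs) with second-starts (rs zero) refl
    ... | inj₁ absent = ⊥-elim (absent (cs (suc zero)))
    ... | inj₂ eq = eq

    Good-halts : ∀ {m n} (B : Grid m n) → Good B → HaltsOn M w
    Good-halts B g@(rs , cs) with corner-first B g
    ... | eq with starts (rs zero) (cong (_∷ tabulate (λ j → B zero (suc j))) eq) | starts (cs zero) (cong (_∷ tabulate (λ i → B (suc i) zero)) eq)
    ... | inj₁ (I , J , re) | inj₁ (I′ , J′ , ce) = ⊥-elim (two-tops B g I J I′ J′ (cong₂ _∷_ eq re) (cong₂ _∷_ eq ce))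
    ... | inj₁ (I , J , re) | inj₂ (K , ce)       = upright B g I J K (cong₂ _∷_ eq re) (cong₂ _∷_ eq ce)
    ... | inj₂ (K , re)     | inj₁ (I , J , ce)   = upright (λ j i → B i j) (cs , rs) I J K (cong₂ _∷_ eq ce) (cong₂ _∷_ eq re)
    ... | inj₂ (K , re)     | inj₂ (K′ , ce)      = ⊥-elim (two-sides B g K K′ (cong₂ _∷_ eq re) (cong₂ _∷_ eq ce))

  map-at-spell : ∀ xs → map (at Letter-finite) (spell xs) ≡ xs
  map-at-spell xs = trans (sym (map-∘ xs)) (trans (map-cong (at-index Letter-finite) xs) (map-id xs))

  crossword-halts : ∀ w → CrosswordExists (crosswordR w) (crosswordR w) → HaltsOn M w
  crossword-halts w (m , n , A , rs , cs) = Good-halts (λ i j → at Letter-finite (A i j))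
    ((λ i → shape (A i) (rs i)) , (λ j → shape (λ i → A i j) (cs j)))
    where
    shape : ∀ {n} (f : Fin n → Fin letters) → tabulate f ∈L crosswordR w → Shape w (tabulate (λ i → at Letter-finite (f i)))
    shape f d with crosswordR-sound w d
    ... | xs , eq , s = subst (Shape w) (sym (trans (sym (map-tabulate f (at Letter-finite)))
      (trans (cong (map (at Letter-finite)) eq) (map-at-spell xs)))) s

  mark-at : ℕ → ℕ → Letter
  mark-at zero    i       = stopMark
  mark-at (suc t) zero    = stepMark
  mark-at (suc t) (suc i) = mark-at t i

  marks-≡ : ∀ t → tabulate {n = suc t} (λ i → mark-at t (toℕ i)) ≡ map (λ _ → stepMark) (replicate t tt) ++ [ stopMark ]
  marks-≡ zero    = refl
  marks-≡ (suc t) = cong (stepMark ∷_) (marks-≡ t)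

  walls-≡ : ∀ t → tabulate {n = t} (λ _ → wall) ≡ map (λ _ → wall) (replicate t tt)
  walls-≡ zero    = refl
  walls-≡ (suc t) = cong (wall ∷_) (walls-≡ t)

  contentAt : Config M → ℕ → Content
  contentAt c = nth (plain zero) (row c)

  tileRow : ∀ {n} → Config M → Config M → Fin n → Letter
  tileRow c d j = tile (contentAt c (toℕ j)) (contentAt d (toℕ j))

  tileRow-≡ : ∀ {n} c d ts → row c ≡ map proj₁ ts → row d ≡ map proj₂ ts → length (row c) ≡ n →
    tabulate {n = n} (tileRow c d) ≡ map tileOf ts
  tileRow-≡ c d ts p q eq rewrite p | q = tabulate-nth₂ tile (plain zero) (plain zero) ts (trans (sym (length-map proj₁ ts)) eq)

  -- Measures for how many steps the head is sure to keep a neighbour on both sides; a step uses up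
  -- at most one cell of the room on either side.
  Roomy : ℕ → Config M → Set
  Roomy k c = k ≤ length (Config.left c) × k ≤ length (Config.right c)

  Roomy-step : ∀ k c → Roomy (suc k) c → Roomy k (step M c)
  Roomy-step k (cfg q (y ∷ l) a (z ∷ r)) (s≤s p , s≤s p′) with δ q a
  ... | nothing          = ≤-trans p (n≤1+n _) , ≤-trans p′ (n≤1+n _)
  ... | just (_ , x , L) = p , ≤-trans p′ (≤-trans (n≤1+n _) (n≤1+n _))
  ... | just (_ , x , R) = ≤-trans p (≤-trans (n≤1+n _) (n≤1+n _)) , p′

  Roomy-row : ∀ k c → Roomy (suc k) c → ∃ λ l → ∃ λ q → ∃ λ a → ∃ λ b → ∃ λ r → row c ≡ map proj₁ (line l (active q a b) r)
  Roomy-row k (cfg q (y ∷ l) a (z ∷ r)) _ with stepped-row q y l a z r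
  ... | l′ , b , r′ , eq = l′ , q , a , b , r′ , eq

  Halted-row : ∀ c → Halted M c → ∃ λ l → ∃ λ q → ∃ λ a → ∃ λ r →
    row c ≡ map proj₁ (line l [ final q a ] r) × row c ≡ map proj₂ (line l [ final q a ] r)
  Halted-row (cfg q l a r) h = reverse l , q , a , r , along proj₁ above-line refl , along proj₂ below-line refl
    where
    along : (p : Content × Content → Content) → (∀ l ts r → map p (line l ts r) ≡ map plain l ++ map p ts ++ map plain r) →
      p (headed q a , headed q a) ≡ headed q a → row (cfg q l a r) ≡ map p (line (reverse l) [ final q a ] r)
    along p p-line pe = trans
      (cong (λ x → map plain (reverse l) ++ x ∷ map plain r) (sym (trans (cong (λ m → p (finalWith q a m)) h) pe)))
      (sym (p-line (reverse l) [ final q a ] r))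

  module _ (w : Word) where

    rows-shape : ∀ {n} t c → Roomy (suc t) c → Halted M (run M t c) → length (row c) ≡ n → ∀ (i : Fin (suc t)) →
      Shape w (mark-at t (toℕ i) ∷ wall ∷ tabulate {n = n} (tileRow (run M (toℕ i) c) (run M (suc (toℕ i)) c)))
    rows-shape zero c rm h len zero with Halted-row c h
    ... | l , q , a , r , eq , eq′ = subst (λ ts → Shape w (stopMark ∷ wall ∷ ts))
      (sym (tileRow-≡ c (step M c) (line l [ final q a ] r) eq (trans (cong row (halted-step M c h)) eq′) len)) (last l q a r)
    rows-shape (suc t) c rm h len i with Roomy-row (suc t) c rm
    rows-shape (suc t) c rm h len zero | l , q , a , b , r , eq = subst (λ ts → Shape w (stepMark ∷ wall ∷ ts))
      (sym (tileRow-≡ c (step M c) (line l (active q a b) r) eq (step-row c l q a b r eq) len)) (across l q a b r)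
    rows-shape (suc t) c rm h len (suc i) | l , q , a , b , r , eq =
      rows-shape t (step M c) (Roomy-step (suc t) c rm) h
        (trans (cong length (step-row c l q a b r eq)) (trans (length-map proj₂ (line l (active q a b) r))
          (trans (sym (length-map proj₁ (line l (active q a b) r))) (trans (cong length (sym eq)) len)))) i

    columns-shape : ∀ t (f : ℕ → Content) → Column (f 0) (tabulate {n = suc t} (λ i → tile (f (toℕ i)) (f (suc (toℕ i)))))
    columns-shape zero    f = end
    columns-shape (suc t) f = more (columns-shape t (f ∘ suc))

    halts-crossword : HaltsOn M w → CrosswordExists (crosswordR w) (crosswordR w)
    -- Sizes are stored as predecessors: there are row 0, one row for each of the `t` steps and a
    -- last row, and the marks and the wall precede `W` columns of contents.
    halts-crossword (t , h) = suc t , suc W , (λ i j → ⌜ B i j ⌝) ,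
      (λ i → matches (B i) (rowShape i)) , (λ j → matches (λ i → B i j) (colShape j))
      where
      I : List ⊤
      -- One blank per step and one more on either side leave the head a neighbour in every row that
      -- shows a step.
      I = replicate (suc t) tt
      c₀ : Config M
      c₀ = padded I w I
      W : ℕ
      W = length (row c₀)
      B : Fin (suc (suc t)) → Fin (suc (suc W)) → Letter
      B zero    zero          = corner
      B zero    (suc zero)    = wallTop
      B zero    (suc (suc j)) = first (contentAt c₀ (toℕ j))
      B (suc i) zero          = mark-at t (toℕ i)
      B (suc i) (suc zero)    = wall
      B (suc i) (suc (suc j)) = tileRow (run M (toℕ i) c₀) (run M (suc (toℕ i)) c₀) j
      lengths : ∀ n → length (replicate n tt) ≡ n
      lengths zero    = refl
      lengths (suc n) = cong suc (lengths n)
      pads : length (padding I) ≡ suc t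
      pads = trans (length-map _ I) (lengths (suc t))
      roomy : Roomy (suc t) c₀
      roomy = subst (suc t ≤_) (sym (trans (length-reverse (padding I)) pads)) ≤-refl ,
        subst (suc t ≤_) (sym (trans (length-++ (tailSyms w)) (trans (cong (length (tailSyms w) +_) pads) (+-comm _ (suc t))))) (m≤m+n (suc t) _)
      rowShape : ∀ i → Shape w (tabulate (B i))
      rowShape zero    = subst (λ xs → Shape w (corner ∷ wallTop ∷ xs)) (sym (tabulate-nth first (plain zero) (row c₀))) (top I I)
      rowShape (suc i) = rows-shape t c₀ roomy (halted-≈ (≈-sym (run-≈ t (padded-≈ I w I))) h) refl i
      colShape : ∀ j → Shape w (tabulate (λ i → B i j))
      colShape zero          = subst (λ xs → Shape w (corner ∷ xs)) (sym (marks-≡ t)) (side (replicate t tt))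
      colShape (suc zero)    = subst (λ xs → Shape w (wallTop ∷ wall ∷ xs)) (sym (walls-≡ t)) (border (replicate t tt))
      colShape (suc (suc j)) = column (columns-shape t (λ i → contentAt (run M i c₀) (toℕ j)))
      matches : ∀ {n} (f : Fin n → Letter) → Shape w (tabulate f) → tabulate (λ i → ⌜ f i ⌝) ∈L crosswordR w
      matches f s = subst (_∈L crosswordR w) (map-tabulate f ⌜_⌝) (crosswordR-complete w s)

-- A library of programs

appendₜ : ∀ {Γ τ} → Tm Γ (list τ) → Tm Γ (list τ) → Tm Γ (list τ)
appendₜ t u = foldrₜ t u (consₜ v₀ v₁)

eval-append : ∀ {Γ τ} (t u : Tm Γ (list τ)) γ → eval (appendₜ t u) γ ≡ eval t γ ++ eval u γ
eval-append t u γ = sym (++-is-foldr (eval t γ) (eval u γ))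

mapₜ : ∀ {Γ σ τ} → Tm Γ (list σ) → Tm (σ ∷ list τ ∷ Γ) τ → Tm Γ (list τ)
mapₜ t f = foldrₜ t nilₜ (consₜ f v₁)

eval-map : ∀ {Γ σ τ} (t : Tm Γ (list σ)) (f : Tm (σ ∷ list τ ∷ Γ) τ) (g : Val σ → Val τ) γ →
  (∀ x a → eval f (x ∷ a ∷ γ) ≡ g x) → eval (mapₜ t f) γ ≡ map g (eval t γ)
eval-map t f g γ eq = along (eval t γ)
  where
  along : ∀ l → foldr (λ x a → eval f (x ∷ a ∷ γ) ∷ a) [] l ≡ map g l
  along []      = refl
  along (x ∷ l) = cong₂ _∷_ (eq x _) (along l)

concatMapₜ : ∀ {Γ σ τ} → Tm Γ (list σ) → Tm (σ ∷ list τ ∷ Γ) (list τ) → Tm Γ (list τ)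
concatMapₜ t f = foldrₜ t nilₜ (appendₜ f v₁)

eval-concatMap : ∀ {Γ σ τ} (t : Tm Γ (list σ)) (f : Tm (σ ∷ list τ ∷ Γ) (list τ)) (g : Val σ → List (Val τ)) γ →
  (∀ x a → eval f (x ∷ a ∷ γ) ≡ g x) → eval (concatMapₜ t f) γ ≡ concatMap g (eval t γ)
eval-concatMap t f g γ eq = along (eval t γ)
  where
  along : ∀ l → foldr (λ x a → foldr _∷_ a (eval f (x ∷ a ∷ γ))) [] l ≡ concatMap g l
  along []      = refl
  along (x ∷ l) = trans (sym (++-is-foldr (eval f (x ∷ _ ∷ γ)) _)) (cong₂ _++_ (eq x _) (along l))

andₜ : ∀ {Γ} → Tm Γ bool → Tm Γ bool → Tm Γ bool
andₜ a b = ifₜ a b (lit false)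

lengthₜ : ∀ {Γ τ} → Tm Γ (list τ) → Tm Γ nat
lengthₜ t = foldrₜ t (lit 0) (sucₜ v₁)

natBitsₜ : ∀ {Γ} → Tm Γ nat → Tm Γ (list bool)
natBitsₜ n = iterₜ n (lit (false ∷ [])) (consₜ (lit true) v₀)

eval-natBits : ∀ {Γ} (n : Tm Γ nat) γ → eval (natBitsₜ n) γ ≡ natBits (eval n γ)
eval-natBits n γ = along (eval n γ)
  where
  along : ∀ n → iter (true ∷_) (false ∷ []) n ≡ natBits n
  along zero    = refl
  along (suc n) = trans (iter-suc (true ∷_) (false ∷ []) n) (cong (true ∷_) (along n))

subₜ : ∀ {Γ} → Tm Γ nat → Tm Γ nat → Tm Γ nat
subₜ a b = iterₜ b a (caseNₜ v₀ (lit 0) v₀)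

eval-sub : ∀ {Γ} (a b : Tm Γ nat) γ → eval (subₜ a b) γ ≡ eval a γ ∸ eval b γ
eval-sub a b γ = along (eval b γ) (eval a γ)
  where
  along : ∀ n m → iter (λ k → caseN k 0 (λ k → k)) m n ≡ m ∸ n
  along zero    m       = refl
  along (suc n) zero    = trans (along n 0) (0∸n≡0 n)
  along (suc n) (suc m) = along n m

isZeroₜ : ∀ {Γ} → Tm Γ nat → Tm Γ bool
isZeroₜ n = caseNₜ n (lit true) (lit false)

upToₜ : ∀ {Γ} → Tm Γ nat → Tm Γ (list nat)
upToₜ n = iterₜ n nilₜ (consₜ (lit 0) (mapₜ v₀ (sucₜ v₀)))

eval-upTo : ∀ {Γ} (n : Tm Γ nat) γ → eval (upToₜ n) γ ≡ upTo (eval n γ)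
eval-upTo n γ = along (eval n γ)
  where
  sucs : ∀ l → foldr (λ k → suc k ∷_) [] l ≡ map suc l
  sucs []      = refl
  sucs (k ∷ l) = cong (suc k ∷_) (sucs l)
  along : ∀ n → iter (λ l → 0 ∷ foldr (λ k → suc k ∷_) [] l) [] n ≡ upTo n
  along zero    = refl
  along (suc n) = trans (iter-suc _ [] n) (cong (0 ∷_) (trans (sucs (iter _ [] n)) (trans (cong (map suc) (along n)) (map-upTo suc n))))

nthₜ : ∀ {Γ τ} → Tm Γ τ → Tm Γ (list τ) → Tm Γ nat → Tm Γ τ
nthₜ d l i = caseLₜ (iterₜ i l (caseLₜ v₀ nilₜ v₁)) d v₀

eval-nth : ∀ {Γ τ} (d : Tm Γ τ) l i γ → eval (nthₜ d l i) γ ≡ nth (eval d γ) (eval l γ) (eval i γ)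
eval-nth d l i γ = along (eval l γ) (eval i γ)
  where
  along : ∀ l i → caseL (iter (λ l → caseL l [] (λ _ l → l)) l i) (eval d γ) (λ x _ → x) ≡ nth (eval d γ) l i
  along []      zero    = refl
  along (x ∷ l) zero    = refl
  along []      (suc i) = along [] i
  along (x ∷ l) (suc i) = along l i

encNatsₜ : Tm (list nat ∷ []) (list bool)
encNatsₜ = concatMapₜ v₀ (natBitsₜ v₀)

eval-encNats : ∀ l → eval encNatsₜ (l ∷ []) ≡ encNats l
eval-encNats l = eval-concatMap v₀ (natBitsₜ v₀) natBits (l ∷ []) (λ x a → eval-natBits v₀ (x ∷ a ∷ l ∷ []))

eqBoolₜ : Tm (bool ∷ bool ∷ []) bool
eqBoolₜ = ifₜ v₀ v₁ (ifₜ v₁ (lit false) (lit true))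

-- Terms recurse on one list at a time, so the second word is carried in the state of a fold over
-- the first, with a flag for agreement so far. The final case on the remainder rejects a second
-- word that is too long.
eqWordₜ : Tm (list bool ∷ list bool ∷ []) bool
eqWordₜ = call result (foldlₜ v₀ (pairₜ (lit true) v₁)
    (caseLₜ (sndₜ v₁) (pairₜ (lit false) nilₜ) (pairₜ (ifₜ (fstₜ v₃) (call eqBoolₜ (v₂ ∷ v₀ ∷ [])) (lit false)) v₁)) ∷ [])
  where
  result : Tm (bool ⊗ list bool ∷ []) bool
  result = caseLₜ (sndₜ v₀) (fstₜ v₀) (lit false)

eqBool-refl : ∀ b → eval eqBoolₜ (b ∷ b ∷ []) ≡ true
eqBool-refl true  = refl
eqBool-refl false = refl

eqBool-sound : ∀ b c → eval eqBoolₜ (b ∷ c ∷ []) ≡ true → b ≡ c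
eqBool-sound true  true  eq = refl
eqBool-sound false false eq = refl

private
  compare : Bool × Word → Bool → Bool × Word
  compare s b = caseL (proj₂ s) (false , []) (λ c v → (if proj₁ s then eval eqBoolₜ (b ∷ c ∷ []) else false) , v)

  outcome : Bool × Word → Bool
  outcome s = caseL (proj₂ s) (proj₁ s) (λ _ _ → false)

  compare-refl : ∀ u → outcome (foldl compare (true , u) u) ≡ true
  compare-refl []      = refl
  compare-refl (b ∷ u) rewrite eqBool-refl b = compare-refl u

  compare-false : ∀ u v → outcome (foldl compare (false , v) u) ≡ false
  compare-false []      []      = refl
  compare-false []      (_ ∷ _) = refl
  compare-false (b ∷ u) []      = compare-false u []
  compare-false (b ∷ u) (_ ∷ v) = compare-false u v

  compare-sound : ∀ u v → outcome (foldl compare (true , v) u) ≡ true → u ≡ v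
  compare-sound []      []      eq = refl
  compare-sound (b ∷ u) []      eq with () ← trans (sym eq) (compare-false u [])
  compare-sound (b ∷ u) (c ∷ v) eq with eval eqBoolₜ (b ∷ c ∷ []) in e
  ... | true  = cong₂ _∷_ (eqBool-sound b c e) (compare-sound u v eq)
  ... | false with () ← trans (sym eq) (compare-false u v)

eqWord-refl : ∀ u → eval eqWordₜ (u ∷ u ∷ []) ≡ true
eqWord-refl = compare-refl

eqWord-sound : ∀ u v → eval eqWordₜ (u ∷ v ∷ []) ≡ true → u ≡ v
eqWord-sound = compare-sound

and-true : ∀ {a b} → (if a then b else false) ≡ true → a ≡ true × b ≡ true
and-true {true} eq = refl , eq

and-intro : ∀ {a b} → a ≡ true → b ≡ true → (if a then b else false) ≡ true
and-intro refl eq = eq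

-- Simulation of Turing machines by programs

-- Transitions as numbers (tag, state, symbol, move), where tag 0 means halting. A machine is given by a table of
-- transitions together with nQ and extra; missing entries halt and oversized entries are truncated, so that
-- every such triple describes a Turing machine.
Transition Machineᵗ Configᵗ : Ty
Transition = nat ⊗ nat ⊗ nat ⊗ nat
Machineᵗ   = list (list Transition) ⊗ nat ⊗ nat
Configᵗ    = nat ⊗ list nat ⊗ nat ⊗ list nat

clampFin : ∀ n → ℕ → Fin (suc n)
clampFin zero    m       = zero
clampFin (suc n) zero    = zero
clampFin (suc n) (suc m) = suc (clampFin n m)

-- `n ∸ (n ∸ m)` is the minimum of `n` and `m`, expressed by the one arithmetic operation that the
-- programs have at hand.
toℕ-clampFin : ∀ n m → n ∸ (n ∸ m) ≡ toℕ (clampFin n m)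
toℕ-clampFin zero    zero    = refl
toℕ-clampFin zero    (suc m) = refl
toℕ-clampFin (suc n) zero    = n∸n≡0 n
toℕ-clampFin (suc n) (suc m) = trans (+-∸-assoc 1 (m∸n≤m n m)) (cong suc (toℕ-clampFin n m))

clampFin-toℕ : ∀ n (i : Fin (suc n)) → clampFin n (toℕ i) ≡ i
clampFin-toℕ zero    zero    = refl
clampFin-toℕ (suc n) zero    = refl
clampFin-toℕ (suc n) (suc i) = cong suc (clampFin-toℕ n i)

clamp : Val Transition → ℕ → ℕ → Val Transition
clamp (f , q , x , m) nQ e =
  caseN f (0 , 0 , 0 , 0) (λ _ → 1 , nQ ∸ (nQ ∸ q) , 2 + e ∸ (2 + e ∸ x) , caseN m 0 (λ _ → 1))

transition : Val Machineᵗ → ℕ → ℕ → Val Transition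
transition (T , nQ , e) q x = clamp (nth (0 , 0 , 0 , 0) (nth [] T q) x) nQ e

numbers : ∀ {q s} → Maybe (Fin q × Fin s × Move) → Val Transition
numbers nothing            = 0 , 0 , 0 , 0
numbers (just (q , x , m)) = 1 , toℕ q , toℕ x , codeMove m

fromNumbers : ∀ nQ e → Val Transition → Maybe (Fin (suc nQ) × Fin (3 + e) × Move)
fromNumbers nQ e (f , q , x , m) = caseN f nothing (λ _ → just (clampFin nQ q , clampFin (2 + e) x , caseN m L (λ _ → R)))

-- A pointwise relation rather than an equation between machines: transition functions with the same
-- values need not be equal, but one table describes them both, and all that follows depends on the
-- table only.
Describes : List (List (Val Transition)) → TM → Set
Describes T M = ∀ q x → transition (T , nQ , extra) (toℕ q) (toℕ x) ≡ numbers (δ q x)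
  where open TM M

described : Val Machineᵗ → TM
described (T , nQ , e) = record { nQ = nQ ; extra = e
  ; δ = λ q x → fromNumbers nQ e (nth (0 , 0 , 0 , 0) (nth [] T (toℕ q)) (toℕ x)) }

described-Describes : ∀ T nQ e → Describes T (described (T , nQ , e))
described-Describes T nQ e q x = clamp-≡ (nth (0 , 0 , 0 , 0) (nth [] T (toℕ q)) (toℕ x))
  where
  clamp-≡ : ∀ t → clamp t nQ e ≡ numbers (fromNumbers nQ e t)
  clamp-≡ (zero  , q , x , m)     = refl
  clamp-≡ (suc f , q , x , zero)  = cong₂ (λ a b → 1 , a , b , 0) (toℕ-clampFin nQ q) (toℕ-clampFin (2 + e) x)
  clamp-≡ (suc f , q , x , suc m) = cong₂ (λ a b → 1 , a , b , 1) (toℕ-clampFin nQ q) (toℕ-clampFin (2 + e) x)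

nth-tabulate : {A : Set} (d : A) {n : ℕ} (f : Fin n → A) (i : Fin n) → nth d (tabulate f) (toℕ i) ≡ f i
nth-tabulate d f zero    = refl
nth-tabulate d f (suc i) = nth-tabulate d (f ∘ suc) i

tableOf : TM → List (List (Val Transition))
tableOf M = tabulate (λ q → tabulate (λ x → numbers (δ q x)))
  where open TM M

tableOf-Describes : ∀ M → Describes (tableOf M) M
tableOf-Describes M q x = trans (cong (λ t → clamp t nQ extra) entry≡) (valid (δ q x))
  where
  open TM M
  entry≡ : nth (0 , 0 , 0 , 0) (nth [] (tableOf M) (toℕ q)) (toℕ x) ≡ numbers (δ q x)
  entry≡ = trans (cong (λ r → nth _ r (toℕ x)) (nth-tabulate [] (λ q → tabulate (λ x → numbers (δ q x))) q))
                 (nth-tabulate _ (λ x → numbers (δ q x)) x)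
  fits : ∀ n (i : Fin (suc n)) → n ∸ (n ∸ toℕ i) ≡ toℕ i
  fits n i = trans (toℕ-clampFin n (toℕ i)) (cong toℕ (clampFin-toℕ n i))
  valid : ∀ (t : Maybe (Fin (suc nQ) × Sym M × Move)) → clamp (numbers t) nQ extra ≡ numbers t
  valid nothing             = refl
  valid (just (q , x , L)) = cong₂ (λ a b → 1 , a , b , 0) (fits nQ q) (fits (2 + extra) x)
  valid (just (q , x , R)) = cong₂ (λ a b → 1 , a , b , 1) (fits nQ q) (fits (2 + extra) x)

#1 : ∀ {Γ ρ σ τ υ} → Tm Γ (ρ ⊗ σ ⊗ τ ⊗ υ) → Tm Γ ρ
#1 t = fstₜ t

#2 : ∀ {Γ ρ σ τ υ} → Tm Γ (ρ ⊗ σ ⊗ τ ⊗ υ) → Tm Γ σ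
#2 t = fstₜ (sndₜ t)

#3 : ∀ {Γ ρ σ τ υ} → Tm Γ (ρ ⊗ σ ⊗ τ ⊗ υ) → Tm Γ τ
#3 t = fstₜ (sndₜ (sndₜ t))

#4 : ∀ {Γ ρ σ τ υ} → Tm Γ (ρ ⊗ σ ⊗ τ ⊗ υ) → Tm Γ υ
#4 t = sndₜ (sndₜ (sndₜ t))

quad : ∀ {Γ ρ σ τ υ} → Tm Γ ρ → Tm Γ σ → Tm Γ τ → Tm Γ υ → Tm Γ (ρ ⊗ σ ⊗ τ ⊗ υ)
quad a b c d = pairₜ a (pairₜ b (pairₜ c d))

clampₜ : Tm (Transition ∷ Machineᵗ ∷ []) Transition
clampₜ = caseNₜ (#1 v₀) (lit (0 , 0 , 0 , 0))
  (quad (lit 1) (subₜ nQ (subₜ nQ (#2 v₁))) (subₜ S (subₜ S (#3 v₁))) (caseNₜ (#4 v₁) (lit 0) (lit 1)))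
  where
  nQ S : Tm (nat ∷ Transition ∷ Machineᵗ ∷ []) nat
  nQ = fstₜ (sndₜ v₂)
  S  = sucₜ (sucₜ (sndₜ (sndₜ v₂)))

eval-clamp : ∀ t T nQ e → eval clampₜ (t ∷ (T , nQ , e) ∷ []) ≡ clamp t nQ e
eval-clamp (zero  , q , x , m) T nQ e = refl
eval-clamp (suc f , q , x , m) T nQ e = cong₂ (λ a b → 1 , a , b , caseN m 0 (λ _ → 1)) (minimum nQ q) (minimum (2 + e) x)
  where
  minimum : ∀ n m → eval (subₜ v₀ (subₜ v₀ v₁)) (n ∷ m ∷ []) ≡ n ∸ (n ∸ m)
  minimum n m = trans (eval-sub v₀ (subₜ v₀ v₁) (n ∷ m ∷ [])) (cong (n ∸_) (eval-sub v₀ v₁ (n ∷ m ∷ [])))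

transitionₜ : Tm (nat ∷ nat ∷ Machineᵗ ∷ []) Transition
transitionₜ = call clampₜ (nthₜ (lit (0 , 0 , 0 , 0)) (nthₜ nilₜ (fstₜ v₂) v₀) v₁ ∷ v₂ ∷ [])

eval-transition : ∀ q x D → eval transitionₜ (q ∷ x ∷ D ∷ []) ≡ transition D q x
eval-transition q x D@(T , nQ , e) = trans
  (eval-clamp (eval (nthₜ (lit (0 , 0 , 0 , 0)) (nthₜ nilₜ (fstₜ v₂) v₀) v₁) (q ∷ x ∷ D ∷ [])) T nQ e)
  (cong (λ t → clamp t nQ e)
    (trans (eval-nth (lit (0 , 0 , 0 , 0)) (nthₜ nilₜ (fstₜ v₂) v₀) v₁ (q ∷ x ∷ D ∷ []))
      (cong (λ r → nth (0 , 0 , 0 , 0) r x) (eval-nth nilₜ (fstₜ v₂) v₀ (q ∷ x ∷ D ∷ [])))))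

moveₜ : Tm (Transition ∷ Configᵗ ∷ []) Configᵗ
moveₜ = caseNₜ (#1 v₀) v₁ (caseNₜ (#4 v₁)
  (caseLₜ (#2 v₂) (quad (#2 v₁) nilₜ (lit 0) (consₜ (#3 v₁) (#4 v₂))) (quad (#2 v₃) v₁ v₀ (consₜ (#3 v₃) (#4 v₄))))
  (caseLₜ (#4 v₃) (quad (#2 v₂) (consₜ (#3 v₂) (#2 v₃)) (lit 0) nilₜ) (quad (#2 v₄) (consₜ (#3 v₄) (#2 v₅)) v₀ v₁)))

stepₜ : Tm (Configᵗ ∷ Machineᵗ ∷ []) Configᵗ
stepₜ = call moveₜ (call transitionₜ (#1 v₀ ∷ #3 v₀ ∷ v₁ ∷ []) ∷ v₀ ∷ [])

initialₜ : Tm (list bool ∷ []) Configᵗ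
initialₜ = caseLₜ v₀ (lit (0 , [] , 0 , []))
  (quad (lit 0) nilₜ (ifₜ v₀ (lit 2) (lit 1)) (mapₜ v₁ (ifₜ v₀ (lit 2) (lit 1))))

runₜ : Tm (nat ∷ list bool ∷ Machineᵗ ∷ []) Configᵗ
runₜ = iterₜ v₀ (call initialₜ (v₁ ∷ [])) (call stepₜ (v₀ ∷ v₃ ∷ []))

haltedₜ : Tm (Configᵗ ∷ Machineᵗ ∷ []) bool
haltedₜ = isZeroₜ (#1 (call transitionₜ (#1 v₀ ∷ #3 v₀ ∷ v₁ ∷ [])))

transitionCodeₜ : Tm (Transition ∷ []) (list nat)
transitionCodeₜ = caseNₜ (#1 v₀) (lit (0 ∷ []))
  (consₜ (lit 1) (consₜ (#2 v₁) (consₜ (#3 v₁) (consₜ (#4 v₁) nilₜ))))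

rowCodeₜ : Tm (nat ∷ Machineᵗ ∷ []) (list nat)
rowCodeₜ = concatMapₜ (upToₜ (sucₜ (sucₜ (sucₜ (sndₜ (sndₜ v₁))))))
  (call transitionCodeₜ (call transitionₜ (v₂ ∷ v₀ ∷ v₃ ∷ []) ∷ []))

machineCodeₜ : Tm (Machineᵗ ∷ []) (list nat)
machineCodeₜ = consₜ (fstₜ (sndₜ v₀)) (consₜ (sndₜ (sndₜ v₀))
  (concatMapₜ (upToₜ (sucₜ (fstₜ (sndₜ v₀)))) (call rowCodeₜ (v₀ ∷ v₂ ∷ []))))

inputCodeₜ : Tm (list bool ∷ []) (list nat)
inputCodeₜ = consₜ (lengthₜ v₀) (mapₜ v₀ (ifₜ v₀ (lit 1) (lit 0)))

inputCode : Word → List ℕ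
inputCode w = length w ∷ map codeBit w

eval-inputCode : ∀ w → eval inputCodeₜ (w ∷ []) ≡ inputCode w
eval-inputCode w = cong₂ _∷_ (len w) (eval-map v₀ (ifₜ v₀ (lit 1) (lit 0)) codeBit (w ∷ []) (λ { true a → refl ; false a → refl }))
  where
  len : ∀ (w : Word) → foldr (λ _ n → suc n) 0 w ≡ length w
  len []      = refl
  len (_ ∷ w) = cong suc (len w)

concatMap-allFin : ∀ {B : Set} n (f : Fin n → List B) (g : ℕ → List B) → (∀ i → f i ≡ g (toℕ i)) →
  concatMap g (upTo n) ≡ concatMap f (allFin n)
concatMap-allFin {B} n f g eq = along n id id (λ i → sym (eq i))
  where
  along : ∀ k (h : Fin k → Fin n) (j : ℕ → ℕ) → (∀ i → g (j (toℕ i)) ≡ f (h i)) →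
    concatMap g (applyUpTo j k) ≡ concatMap f (tabulate h)
  along zero    h j p = refl
  along (suc k) h j p = cong₂ _++_ (p zero) (along k (h ∘ suc) (j ∘ suc) (p ∘ suc))

module Simulation (M : TM) (T : List (List (Val Transition))) (describes : Describes T M) where
  open TM M

  D : Val Machineᵗ
  D = T , nQ , extra

  eval-δ : ∀ q x → eval transitionₜ (toℕ q ∷ toℕ x ∷ D ∷ []) ≡ numbers (δ q x)
  eval-δ q x = trans (eval-transition (toℕ q) (toℕ x) D) (describes q x)

  raw : Config M → Val Configᵗ
  raw (cfg q l a r) = toℕ q , map toℕ l , toℕ a , map toℕ r

  eval-step : ∀ c → eval stepₜ (raw c ∷ D ∷ []) ≡ raw (step M c)
  eval-step c@(cfg q l a r) = trans (cong (λ t → eval moveₜ (t ∷ raw c ∷ [])) (eval-δ q a)) (moved (δ q a) l r)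
    where
    moved : ∀ t l r → eval moveₜ (numbers t ∷ raw (cfg q l a r) ∷ []) ≡ raw (stepWith M (cfg q l a r) t)
    moved nothing             l       r       = refl
    moved (just (q′ , x , L)) []      r       = refl
    moved (just (q′ , x , L)) (_ ∷ l) r       = refl
    moved (just (q′ , x , R)) l       []      = refl
    moved (just (q′ , x , R)) l       (_ ∷ r) = refl

  eval-initial : ∀ w → eval initialₜ (w ∷ []) ≡ raw (initial M w)
  eval-initial []      = refl
  eval-initial (b ∷ w) = cong₂ (λ x r → 0 , [] , x , r) (bit b)
    (trans (eval-map v₁ (ifₜ v₀ (lit 2) (lit 1)) (toℕ ∘ bitSym M) (b ∷ w ∷ (b ∷ w) ∷ []) (λ b _ → bit b)) (maps w))
    where
    bit : ∀ b → (if b then 2 else 1) ≡ toℕ (bitSym M b)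
    bit true  = refl
    bit false = refl
    maps : ∀ w → map (toℕ ∘ bitSym M) w ≡ map toℕ (map (bitSym M) w)
    maps []      = refl
    maps (b ∷ w) = cong (_ ∷_) (maps w)

  eval-run : ∀ n w → eval runₜ (n ∷ w ∷ D ∷ []) ≡ raw (run M n (initial M w))
  eval-run n w = runs n _ (initial M w) (eval-initial w)
    where
    runs : ∀ k v c → v ≡ raw c → iter (λ v → eval stepₜ (v ∷ D ∷ [])) v k ≡ raw (run M k c)
    runs zero    v c eq = eq
    runs (suc k) v c eq = runs k _ (step M c) (trans (cong (λ v → eval stepₜ (v ∷ D ∷ [])) eq) (eval-step c))

  halted-true : ∀ c → Halted M c → eval haltedₜ (raw c ∷ D ∷ []) ≡ true
  halted-true (cfg q l a r) h = cong (λ t → caseN (proj₁ t) true (λ _ → false)) (trans (eval-δ q a) (cong numbers h))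

  true-halted : ∀ c → eval haltedₜ (raw c ∷ D ∷ []) ≡ true → Halted M c
  true-halted (cfg q l a r) eq with δ q a | trans (sym (cong (λ t → caseN (proj₁ t) true (λ _ → false)) (eval-δ q a))) eq
  ... | nothing | _ = refl

  eval-machineCode : eval machineCodeₜ (D ∷ []) ≡ codeTM M
  eval-machineCode = cong (λ l → nQ ∷ extra ∷ l) (trans
    (eval-concatMap (upToₜ (sucₜ (fstₜ (sndₜ v₀)))) (call rowCodeₜ (v₀ ∷ v₂ ∷ [])) rows (D ∷ []) (λ q a → refl))
    (trans (cong (concatMap rows) (eval-upTo (sucₜ (fstₜ (sndₜ v₀))) (D ∷ [])))
      (concatMap-allFin (suc nQ) (λ q → concatMap (λ x → codeEntry (δ q x)) (allFin (3 + extra))) rows (λ q → sym (row-≡ q)))))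
    where
    rows : ℕ → List ℕ
    rows q = eval rowCodeₜ (q ∷ D ∷ [])
    entries : ℕ → ℕ → List ℕ
    entries q x = eval transitionCodeₜ (eval transitionₜ (q ∷ x ∷ D ∷ []) ∷ [])
    entry-≡ : ∀ t → eval transitionCodeₜ (numbers t ∷ []) ≡ codeEntry t
    entry-≡ nothing  = refl
    entry-≡ (just _) = refl
    row-≡ : ∀ q → rows (toℕ q) ≡ concatMap (λ x → codeEntry (δ q x)) (allFin (3 + extra))
    row-≡ q = trans
      (eval-concatMap (upToₜ (sucₜ (sucₜ (sucₜ (sndₜ (sndₜ v₁)))))) (call transitionCodeₜ (call transitionₜ (v₂ ∷ v₀ ∷ v₃ ∷ []) ∷ []))
        (entries (toℕ q)) (toℕ q ∷ D ∷ []) (λ x a → refl))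
      (trans (cong (concatMap (entries (toℕ q))) (eval-upTo (sucₜ (sucₜ (sucₜ (sndₜ (sndₜ v₁))))) (toℕ q ∷ D ∷ [])))
        (concatMap-allFin (3 + extra) (λ x → codeEntry (δ q x)) (entries (toℕ q))
          (λ x → sym (trans (cong (λ t → eval transitionCodeₜ (t ∷ [])) (eval-δ q x)) (entry-≡ (δ q x))))))

pairCodeₜ : Tm (Machineᵗ ∷ list bool ∷ []) (list bool)
pairCodeₜ = call encNatsₜ (appendₜ (call machineCodeₜ (v₀ ∷ [])) (call inputCodeₜ (v₁ ∷ [])) ∷ [])

eval-pairCode : ∀ M T → Describes T M → ∀ w → eval pairCodeₜ ((T , TM.nQ M , TM.extra M) ∷ w ∷ []) ≡ encPair M w
eval-pairCode M T d w = trans (eval-encNats (eval codeₜ (D ∷ w ∷ []))) (cong encNats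
  (trans (eval-append (call machineCodeₜ (v₀ ∷ [])) (call inputCodeₜ (v₁ ∷ [])) (D ∷ w ∷ []))
    (cong₂ _++_ eval-machineCode (eval-inputCode w))))
  where
  open Simulation M T d
  codeₜ : Tm (Machineᵗ ∷ list bool ∷ []) (list nat)
  codeₜ = appendₜ (call machineCodeₜ (v₀ ∷ [])) (call inputCodeₜ (v₁ ∷ []))

-- A certificate is a number of steps, an input and a machine. The instance is recognised by
-- encoding the last two and comparing, so no decoding of words is involved.
haltingCheckₜ : Tm ((nat ⊗ list bool ⊗ Machineᵗ) ∷ list bool ∷ []) bool
haltingCheckₜ = andₜ (call eqWordₜ (v₁ ∷ call pairCodeₜ (sndₜ (sndₜ v₀) ∷ fstₜ (sndₜ v₀) ∷ []) ∷ []))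
  (call haltedₜ (call runₜ (fstₜ v₀ ∷ fstₜ (sndₜ v₀) ∷ sndₜ (sndₜ v₀) ∷ []) ∷ sndₜ (sndₜ v₀) ∷ []))

module HaltingCheck (M : TM) (T : List (List (Val Transition))) (describes : Describes T M) where
  open Simulation M T describes

  eval-check : ∀ n w x → eval haltingCheckₜ ((n , w , D) ∷ x ∷ []) ≡
    (if eval eqWordₜ (x ∷ encPair M w ∷ []) then eval haltedₜ (raw (run M n (initial M w)) ∷ D ∷ []) else false)
  eval-check n w x = cong₂ (λ v c → if eval eqWordₜ (x ∷ v ∷ []) then eval haltedₜ (c ∷ D ∷ []) else false)
    (eval-pairCode M T describes w) (eval-run n w)

  accepts : ∀ n w x → x ≡ encPair M w → Halted M (run M n (initial M w)) → eval haltingCheckₜ ((n , w , D) ∷ x ∷ []) ≡ true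
  accepts n w x eq h = trans (eval-check n w x) (and-intro
    (trans (cong (λ v → eval eqWordₜ (x ∷ v ∷ [])) (sym eq)) (eqWord-refl x)) (halted-true (run M n (initial M w)) h))

  accepted : ∀ n w x → eval haltingCheckₜ ((n , w , D) ∷ x ∷ []) ≡ true → x ≡ encPair M w × Halted M (run M n (initial M w))
  accepted n w x ok = verified (and-true (trans (sym (eval-check n w x)) ok))
    where
    verified : eval eqWordₜ (x ∷ encPair M w ∷ []) ≡ true × eval haltedₜ (raw (run M n (initial M w)) ∷ D ∷ []) ≡ true →
      x ≡ encPair M w × Halted M (run M n (initial M w))
    verified (same , h) = eqWord-sound x (encPair M w) same , true-halted (run M n (initial M w)) h

halting-semidecidable : SemiDecidable HaltingProblem
halting-semidecidable = proj₁ semi , λ x → (λ p → proj₁ (proj₂ semi x) (certificate x p)) , λ h → certified x (proj₂ (proj₂ semi x) h)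
  where
  semi : SemiDecidable (λ x → ∃ λ v → eval haltingCheckₜ (v ∷ x ∷ []) ≡ true)
  semi = exists-semidecidable (nat ⊗ list bool ⊗ Machineᵗ) haltingCheckₜ
  certificate : ∀ x → HaltingProblem x → ∃ λ v → eval haltingCheckₜ (v ∷ x ∷ []) ≡ true
  certificate x (M , w , eq , n , h) = (n , w , tableOf M , TM.nQ M , TM.extra M) ,
    HaltingCheck.accepts M (tableOf M) (tableOf-Describes M) n w x eq h
  certified : ∀ x → (∃ λ v → eval haltingCheckₜ (v ∷ x ∷ []) ≡ true) → HaltingProblem x
  certified x ((n , w , T , nQ , e) , ok) = decode (HaltingCheck.accepted (described (T , nQ , e)) T (described-Describes T nQ e) n w x ok)
    where
    decode : x ≡ encPair (described (T , nQ , e)) w × Halted (described (T , nQ , e)) (run (described (T , nQ , e)) n (initial _ w)) →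
      HaltingProblem x
    decode (eq , h) = described (T , nQ , e) , w , eq , n , h

-- Derivatives of regular expressions

-- Letters are bare numbers because the types of program values cannot depend on the size of an
-- alphabet, and `emp` is added because a derivative may denote the empty language.
data Raw : Set where
  chr     : ℕ → Raw
  eps emp : Raw
  _∪_ _·_ : Raw → Raw → Raw
  _*      : Raw → Raw

data _∈R_ : List ℕ → Raw → Set where
  chr      : ∀ {a} → [ a ] ∈R chr a
  eps      : [] ∈R eps
  unionˡ   : ∀ {u E F} → u ∈R E → u ∈R (E ∪ F)
  unionʳ   : ∀ {u E F} → u ∈R F → u ∈R (E ∪ F)
  cat      : ∀ {u v E F} → u ∈R E → v ∈R F → (u ++ v) ∈R (E · F)
  star-nil : ∀ {E} → [] ∈R (E *)
  star-cons : ∀ {u v E} → u ∈R E → v ∈R (E *) → (u ++ v) ∈R (E *)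

toRaw : ∀ {k} → Regex k → Raw
toRaw (chr a) = chr (toℕ a)
toRaw eps     = eps
toRaw (E ∪ F) = toRaw E ∪ toRaw F
toRaw (E · F) = toRaw E · toRaw F
toRaw (E *)   = toRaw E *

∈L-∈R : ∀ {k} {w : List (Fin k)} {E} → w ∈L E → map toℕ w ∈R toRaw E
∈L-∈R chr        = chr
∈L-∈R eps        = eps
∈L-∈R (unionˡ d) = unionˡ (∈L-∈R d)
∈L-∈R (unionʳ d) = unionʳ (∈L-∈R d)
∈L-∈R (cat {u} {v} d e) = subst (_∈R _) (sym (map-++ toℕ u v)) (cat (∈L-∈R d) (∈L-∈R e))
∈L-∈R star-nil   = star-nil
∈L-∈R (star-cons {u} {v} d e) = subst (_∈R _) (sym (map-++ toℕ u v)) (star-cons (∈L-∈R d) (∈L-∈R e))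

∈R-∈L : ∀ {k} (E : Regex k) {v} → v ∈R toRaw E → ∃ λ w → v ≡ map toℕ w × w ∈L E
∈R-∈L (chr a) chr = _ , refl , chr
∈R-∈L eps     eps = _ , refl , eps
∈R-∈L (E ∪ F) (unionˡ d) with ∈R-∈L E d
... | w , refl , c = w , refl , unionˡ c
∈R-∈L (E ∪ F) (unionʳ d) with ∈R-∈L F d
... | w , refl , c = w , refl , unionʳ c
∈R-∈L (E · F) (cat d e) with ∈R-∈L E d | ∈R-∈L F e
... | u , refl , c | v , refl , c′ = u ++ v , sym (map-++ toℕ u v) , cat c c′
∈R-∈L (E *) star-nil = [] , refl , star-nil
∈R-∈L (E *) (star-cons d e) with ∈R-∈L E d | ∈R-∈L (E *) e
... | u , refl , c | v , refl , c′ = u ++ v , sym (map-++ toℕ u v) , star-cons c c′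

nullable : Raw → Bool
nullable (chr a) = false
nullable eps     = true
nullable emp     = false
nullable (E ∪ F) = if nullable E then true else nullable F
nullable (E · F) = if nullable E then nullable F else false
nullable (E *)   = true

sameₜ : Tm (nat ∷ nat ∷ []) bool
sameₜ = andₜ (isZeroₜ (subₜ v₀ v₁)) (isZeroₜ (subₜ v₁ v₀))

same : ℕ → ℕ → Bool
same a b = eval sameₜ (a ∷ b ∷ [])

isZero-true : ∀ {n} → caseN n true (λ _ → false) ≡ true → n ≡ 0
isZero-true {zero} eq = refl

same-sound : ∀ a b → same a b ≡ true → a ≡ b
same-sound a b eq with and-true {caseN (eval (subₜ v₀ v₁) (a ∷ b ∷ [])) true (λ _ → false)} eq
... | p , q = ≤-antisym
  (m∸n≡0⇒m≤n (trans (sym (eval-sub v₀ v₁ (a ∷ b ∷ []))) (isZero-true p)))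
  (m∸n≡0⇒m≤n (trans (sym (eval-sub v₁ v₀ (a ∷ b ∷ []))) (isZero-true q)))

same-refl : ∀ a → same a a ≡ true
same-refl a = and-intro (zero-true (eval-sub v₀ v₁ (a ∷ a ∷ []))) (zero-true (eval-sub v₁ v₀ (a ∷ a ∷ [])))
  where
  zero-true : ∀ {n} → n ≡ a ∸ a → caseN n true (λ _ → false) ≡ true
  zero-true refl = cong (λ n → caseN n true (λ _ → false)) (m≤n⇒m∸n≡0 (≤-refl {a}))

der : ℕ → Raw → Raw
der a (chr b) = if same b a then eps else emp
der a eps     = emp
der a emp     = emp
der a (E ∪ F) = der a E ∪ der a F
der a (E · F) = (der a E · F) ∪ (if nullable E then der a F else emp)
der a (E *)   = der a E · (E *)

nullable-sound : ∀ E → nullable E ≡ true → [] ∈R E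
nullable-sound eps     eq = eps
nullable-sound (E ∪ F) eq with nullable E in e
... | true  = unionˡ (nullable-sound E e)
... | false = unionʳ (nullable-sound F eq)
nullable-sound (E · F) eq with nullable E in e
... | true  = cat (nullable-sound E e) (nullable-sound F eq)
nullable-sound (E *)   eq = star-nil

nullable-complete : ∀ {w E} → w ∈R E → w ≡ [] → nullable E ≡ true
nullable-complete eps        refl = refl
nullable-complete {E = E ∪ F} (unionˡ d) refl rewrite nullable-complete d refl = refl
nullable-complete {E = E ∪ F} (unionʳ d) refl with nullable E
... | true  = refl
... | false = nullable-complete d refl
nullable-complete (cat {[]} d e) eq rewrite nullable-complete d refl = nullable-complete e eq
nullable-complete star-nil   refl = refl
nullable-complete (star-cons d e) eq = refl

der-sound : ∀ a E {w} → w ∈R der a E → (a ∷ w) ∈R E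
der-sound a (chr b) d with same b a in eq
der-sound a (chr b) eps | true rewrite same-sound b a eq = chr
der-sound a (E ∪ F) (unionˡ d) = unionˡ (der-sound a E d)
der-sound a (E ∪ F) (unionʳ d) = unionʳ (der-sound a F d)
der-sound a (E · F) (unionˡ (cat d e)) = cat (der-sound a E d) e
der-sound a (E · F) (unionʳ d) with nullable E in eq
... | true = cat (nullable-sound E eq) (der-sound a F d)
der-sound a (E *) (cat d e) = star-cons (der-sound a E d) e

-- The word is tied to `a ∷ w` by an equation so that the derivation can be analysed. The induction
-- is on the derivation, not on the expression, because an empty first iteration of a star leads
-- back to the same star.
der-complete : ∀ {a v w E} → v ∈R E → v ≡ a ∷ w → w ∈R der a E
der-complete {a} chr refl rewrite same-refl a = eps
der-complete (unionˡ d) eq = unionˡ (der-complete d eq)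
der-complete (unionʳ d) eq = unionʳ (der-complete d eq)
der-complete (cat {_ ∷ _} d e) refl = unionˡ (cat (der-complete d refl) e)
der-complete {a} {E = E · F} (cat {[]} d e) eq = unionʳ (subst (λ b → _ ∈R (if b then der a F else emp))
  (sym (nullable-complete d refl)) (der-complete e eq))
der-complete (star-cons {[]}    d e) eq   = der-complete e eq
der-complete (star-cons {_ ∷ _} d e) refl = cat (der-complete d refl) e

matches : Raw → List ℕ → Bool
matches E w = nullable (foldl (λ E a → der a E) E w)

matches-sound : ∀ E w → matches E w ≡ true → w ∈R E
matches-sound E []      eq = nullable-sound E eq
matches-sound E (a ∷ w) eq = der-sound a E (matches-sound (der a E) w eq)

matches-complete : ∀ {E} w → w ∈R E → matches E w ≡ true
matches-complete []      d = nullable-complete d refl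
matches-complete (a ∷ w) d = matches-complete w (der-complete d refl)

-- Regular expressions enter the programs in reverse Polish notation: (tag, letter) items evaluated on a stack.
Items : Ty
Items = list (nat ⊗ nat)

-- All recursive functions that programs compute on expressions are folds, so one stack interpreter,
-- verified once, runs them all.
record Algebra (A : Set) : Set where
  field
    chrᵃ         : ℕ → A
    epsᵃ empᵃ    : A
    _∪ᵃ_ _·ᵃ_    : A → A → A
    _*ᵃ          : A → A
open Algebra

foldRaw : {A : Set} → Algebra A → Raw → A
foldRaw 𝒜 (chr a) = chrᵃ 𝒜 a
foldRaw 𝒜 eps     = epsᵃ 𝒜
foldRaw 𝒜 emp     = empᵃ 𝒜
foldRaw 𝒜 (E ∪ F) = _∪ᵃ_ 𝒜 (foldRaw 𝒜 E) (foldRaw 𝒜 F)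
foldRaw 𝒜 (E · F) = _·ᵃ_ 𝒜 (foldRaw 𝒜 E) (foldRaw 𝒜 F)
foldRaw 𝒜 (E *)   = _*ᵃ 𝒜 (foldRaw 𝒜 E)

-- On a stack that is too short the missing operand is taken to be `z`, which will be the value of
-- `eps` in every algebra. So every list of items denotes an expression, and a certificate need not
-- be checked for being well formed.
unary : {A : Set} → A → (A → A) → List A → List A
unary z f st = caseL st (f z ∷ []) (λ x xs → f x ∷ xs)

binary : {A : Set} → A → (A → A → A) → List A → List A
-- In reverse Polish notation the right operand `x` is on top.
binary z f st = caseL st (f z z ∷ []) (λ x xs → caseL xs (f z x ∷ []) (λ y ys → f y x ∷ ys))

pushItem : {A : Set} → Algebra A → List A → ℕ × ℕ → List A
pushItem 𝒜 st (tag , a) =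
  caseN tag (chrᵃ 𝒜 a ∷ st) λ tag →
  caseN tag (epsᵃ 𝒜 ∷ st) λ tag →
  caseN tag (binary (epsᵃ 𝒜) (_∪ᵃ_ 𝒜) st) λ tag →
  caseN tag (binary (epsᵃ 𝒜) (_·ᵃ_ 𝒜) st) λ tag →
  caseN tag (unary (epsᵃ 𝒜) (_*ᵃ 𝒜) st) λ _ → empᵃ 𝒜 ∷ st

interpret : {A : Set} → Algebra A → List (ℕ × ℕ) → A
interpret 𝒜 is = caseL (foldl (pushItem 𝒜) [] is) (epsᵃ 𝒜) (λ x _ → x)

rawAlgebra : Algebra Raw
rawAlgebra = record { chrᵃ = chr ; epsᵃ = eps ; empᵃ = emp ; _∪ᵃ_ = _∪_ ; _·ᵃ_ = _·_ ; _*ᵃ = _* }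

parse : List (ℕ × ℕ) → Raw
parse = interpret rawAlgebra

toItems : Raw → List (ℕ × ℕ)
toItems (chr a) = (0 , a) ∷ []
toItems eps     = (1 , 0) ∷ []
toItems emp     = (5 , 0) ∷ []
toItems (E ∪ F) = toItems E ++ toItems F ++ (2 , 0) ∷ []
toItems (E · F) = toItems E ++ toItems F ++ (3 , 0) ∷ []
toItems (E *)   = toItems E ++ (4 , 0) ∷ []

parse-toItems : ∀ E → parse (toItems E) ≡ E
parse-toItems E = cong (λ st → caseL st eps (λ x _ → x))
  (trans (cong (foldl (pushItem rawAlgebra) []) (sym (++-identityʳ (toItems E)))) (pushed E [] []))
  where
  pushed : ∀ E st is → foldl (pushItem rawAlgebra) st (toItems E ++ is) ≡ foldl (pushItem rawAlgebra) (E ∷ st) is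
  pushed (chr a) st is = refl
  pushed eps     st is = refl
  pushed emp     st is = refl
  pushed (E ∪ F) st is rewrite ++-assoc (toItems E) (toItems F ++ (2 , 0) ∷ []) is | ++-assoc (toItems F) ((2 , 0) ∷ []) is
    | pushed E st (toItems F ++ (2 , 0) ∷ is) | pushed F (E ∷ st) ((2 , 0) ∷ is) = refl
  pushed (E · F) st is rewrite ++-assoc (toItems E) (toItems F ++ (3 , 0) ∷ []) is | ++-assoc (toItems F) ((3 , 0) ∷ []) is
    | pushed E st (toItems F ++ (3 , 0) ∷ is) | pushed F (E ∷ st) ((3 , 0) ∷ is) = refl
  pushed (E *)   st is rewrite ++-assoc (toItems E) ((4 , 0) ∷ []) is | pushed E st ((4 , 0) ∷ is) = refl

-- Folding commutes with each item, including the default operands of malformed lists: the stack of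
-- values is always the image of the stack of expressions.
interpret-parse : {A : Set} (𝒜 : Algebra A) (is : List (ℕ × ℕ)) → interpret 𝒜 is ≡ foldRaw 𝒜 (parse is)
interpret-parse 𝒜 is = trans (cong (λ st → caseL st (epsᵃ 𝒜) (λ x _ → x)) (along [] is)) (topmost (foldl (pushItem rawAlgebra) [] is))
  where
  topmost : ∀ st → caseL (map (foldRaw 𝒜) st) (epsᵃ 𝒜) (λ x _ → x) ≡ foldRaw 𝒜 (caseL st eps (λ x _ → x))
  topmost []      = refl
  topmost (_ ∷ _) = refl
  one : ∀ st i → pushItem 𝒜 (map (foldRaw 𝒜) st) i ≡ map (foldRaw 𝒜) (pushItem rawAlgebra st i)
  one st           (0 , a) = refl
  one st           (1 , a) = refl
  one []           (2 , a) = refl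
  one (_ ∷ [])     (2 , a) = refl
  one (_ ∷ _ ∷ _)  (2 , a) = refl
  one []           (3 , a) = refl
  one (_ ∷ [])     (3 , a) = refl
  one (_ ∷ _ ∷ _)  (3 , a) = refl
  one []           (4 , a) = refl
  one (_ ∷ _)      (4 , a) = refl
  one st           (suc (suc (suc (suc (suc _)))) , a) = refl
  along : ∀ st is → foldl (pushItem 𝒜) (map (foldRaw 𝒜) st) is ≡ map (foldRaw 𝒜) (foldl (pushItem rawAlgebra) st is)
  along st []       = refl
  along st (i ∷ is) = trans (cong (λ s → foldl (pushItem 𝒜) s is) (one st i)) (along (pushItem rawAlgebra st i) is)

-- The parameter p will be the letter of a derivative, or the size of the alphabet.
record Algebraₜ (τ : Ty) : Set where
  field
    chrₜ      : Tm (nat ∷ nat ∷ []) τ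
    epsₜ empₜ : Val τ
    unionₜ catₜ : Tm (τ ∷ τ ∷ []) τ
    starₜ     : Tm (τ ∷ []) τ

  algebra : ℕ → Algebra (Val τ)
  algebra p = record
    { chrᵃ = λ a → eval chrₜ (a ∷ p ∷ []) ; epsᵃ = epsₜ ; empᵃ = empₜ
    ; _∪ᵃ_ = λ u v → eval unionₜ (u ∷ v ∷ []) ; _·ᵃ_ = λ u v → eval catₜ (u ∷ v ∷ []) ; _*ᵃ = λ u → eval starₜ (u ∷ []) }

  unaryₜ : Tm (τ ∷ []) τ → Tm (list τ ∷ []) (list τ)
  unaryₜ f = caseLₜ v₀ (consₜ (call f (lit epsₜ ∷ [])) nilₜ) (consₜ (call f (v₀ ∷ [])) v₁)

  binaryₜ : Tm (τ ∷ τ ∷ []) τ → Tm (list τ ∷ []) (list τ)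
  binaryₜ f = caseLₜ v₀ (consₜ (call f (lit epsₜ ∷ lit epsₜ ∷ [])) nilₜ)
    (caseLₜ v₁ (consₜ (call f (lit epsₜ ∷ v₀ ∷ [])) nilₜ) (consₜ (call f (v₀ ∷ v₂ ∷ [])) v₁))

  pushItemₜ : Tm ((nat ⊗ nat) ∷ list τ ∷ nat ∷ []) (list τ)
  pushItemₜ = caseNₜ (fstₜ v₀) (consₜ (call chrₜ (sndₜ v₀ ∷ v₂ ∷ [])) v₁)
    (caseNₜ v₀ (consₜ (lit epsₜ) v₂)
    (caseNₜ v₀ (call (binaryₜ unionₜ) (v₃ ∷ []))
    (caseNₜ v₀ (call (binaryₜ catₜ) (v₄ ∷ []))
    (caseNₜ v₀ (call (unaryₜ starₜ) (v₅ ∷ [])) (consₜ (lit empₜ) v₆)))))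

  interpretₜ : Tm (Items ∷ nat ∷ []) τ
  interpretₜ = caseLₜ (foldlₜ v₀ nilₜ (call pushItemₜ (v₀ ∷ v₁ ∷ v₃ ∷ []))) (lit epsₜ) v₀

  eval-interpret : ∀ is p → eval interpretₜ (is ∷ p ∷ []) ≡ foldRaw (algebra p) (parse is)
  eval-interpret is p = trans (cong (λ st → caseL st epsₜ (λ x _ → x)) (along [] is)) (interpret-parse (algebra p) is)
    where
    one : ∀ st i → eval pushItemₜ (i ∷ st ∷ p ∷ []) ≡ pushItem (algebra p) st i
    one st           (0 , a) = refl
    one st           (1 , a) = refl
    one []           (2 , a) = refl
    one (_ ∷ [])     (2 , a) = refl
    one (_ ∷ _ ∷ _)  (2 , a) = refl
    one []           (3 , a) = refl
    one (_ ∷ [])     (3 , a) = refl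
    one (_ ∷ _ ∷ _)  (3 , a) = refl
    one []           (4 , a) = refl
    one (_ ∷ _)      (4 , a) = refl
    one st           (suc (suc (suc (suc (suc _)))) , a) = refl
    along : ∀ st js → foldl (λ st i → eval pushItemₜ (i ∷ st ∷ p ∷ [])) st js ≡ foldl (pushItem (algebra p)) st js
    along st []       = refl
    along st (i ∷ js) = trans (cong (λ s → foldl _ s js) (one st i)) (along (pushItem (algebra p) st i) js)

-- Crosswords are semidecidable

module Derivative where

  joinₜ : ℕ → Tm (Items ∷ Items ∷ []) Items
  joinₜ t = appendₜ v₀ (appendₜ v₁ (lit ((t , 0) ∷ [])))

  eval-join : ∀ t u v → eval (joinₜ t) (u ∷ v ∷ []) ≡ u ++ v ++ (t , 0) ∷ []
  eval-join t u v = trans (eval-append v₀ (appendₜ v₁ (lit ((t , 0) ∷ []))) (u ∷ v ∷ []))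
    (cong (u ++_) (eval-append v₁ (lit ((t , 0) ∷ [])) (u ∷ v ∷ [])))

  starItemsₜ : Tm (Items ∷ []) Items
  starItemsₜ = appendₜ v₀ (lit ((4 , 0) ∷ []))

  eval-starItems : ∀ u → eval starItemsₜ (u ∷ []) ≡ u ++ (4 , 0) ∷ []
  eval-starItems u = eval-append v₀ (lit ((4 , 0) ∷ [])) (u ∷ [])

  -- The derivative of a concatenation refers to its second factor itself and to the nullability of
  -- the first, so it is not a fold alone. The triple of the expression, its nullability and its
  -- derivative is one.
  Triple : Ty
  Triple = Items ⊗ bool ⊗ Items

  selfₜ dₜ : ∀ {Γ} → Tm Γ Triple → Tm Γ Items
  selfₜ t = fstₜ t
  dₜ t    = sndₜ (sndₜ t)

  nullₜ : ∀ {Γ} → Tm Γ Triple → Tm Γ bool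
  nullₜ t = fstₜ (sndₜ t)

  derivativeₜ : Algebraₜ Triple
  derivativeₜ = record
    { chrₜ   = pairₜ (consₜ (pairₜ (lit 0) v₀) nilₜ) (pairₜ (lit false)
                 (ifₜ (call sameₜ (v₀ ∷ v₁ ∷ [])) (lit ((1 , 0) ∷ [])) (lit ((5 , 0) ∷ []))))
    ; epsₜ   = (1 , 0) ∷ [] , true , (5 , 0) ∷ []
    ; empₜ   = (5 , 0) ∷ [] , false , (5 , 0) ∷ []
    ; unionₜ = pairₜ (call (joinₜ 2) (selfₜ v₀ ∷ selfₜ v₁ ∷ []))
                 (pairₜ (ifₜ (nullₜ v₀) (lit true) (nullₜ v₁)) (call (joinₜ 2) (dₜ v₀ ∷ dₜ v₁ ∷ [])))
    ; catₜ   = pairₜ (call (joinₜ 3) (selfₜ v₀ ∷ selfₜ v₁ ∷ []))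
                 (pairₜ (ifₜ (nullₜ v₀) (nullₜ v₁) (lit false))
                   (call (joinₜ 2) (call (joinₜ 3) (dₜ v₀ ∷ selfₜ v₁ ∷ []) ∷ ifₜ (nullₜ v₀) (dₜ v₁) (lit ((5 , 0) ∷ [])) ∷ [])))
    ; starₜ  = pairₜ (call starItemsₜ (selfₜ v₀ ∷ []))
                 (pairₜ (lit true) (call (joinₜ 3) (dₜ v₀ ∷ call starItemsₜ (selfₜ v₀ ∷ []) ∷ [])))
    }

  open Algebraₜ derivativeₜ

  triple : ℕ → Raw → Val Triple
  triple a E = toItems E , nullable E , toItems (der a E)

  foldRaw-derivative : ∀ a E → foldRaw (algebra a) E ≡ triple a E
  foldRaw-derivative a (chr b) with same b a
  ... | true  = refl
  ... | false = refl
  foldRaw-derivative a eps     = refl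
  foldRaw-derivative a emp     = refl
  foldRaw-derivative a (E ∪ F) = trans (cong₂ (λ u v → eval unionₜ (u ∷ v ∷ [])) (foldRaw-derivative a E) (foldRaw-derivative a F))
    (cong₂ (λ u v → u , nullable (E ∪ F) , v) (eval-join 2 (toItems E) (toItems F)) (eval-join 2 (toItems (der a E)) (toItems (der a F))))
  foldRaw-derivative a (E · F) = trans (cong₂ (λ u v → eval catₜ (u ∷ v ∷ [])) (foldRaw-derivative a E) (foldRaw-derivative a F))
    (cong₂ (λ u v → u , nullable (E · F) , v) (eval-join 3 (toItems E) (toItems F))
      (trans (eval-join 2 (eval (joinₜ 3) (toItems (der a E) ∷ toItems F ∷ [])) (if nullable E then toItems (der a F) else ((5 , 0) ∷ [])))
        (cong₂ (λ u v → u ++ v ++ (2 , 0) ∷ []) (eval-join 3 (toItems (der a E)) (toItems F)) (branch (nullable E)))))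
    where
    branch : ∀ b → (if b then toItems (der a F) else ((5 , 0) ∷ [])) ≡ toItems (if b then der a F else emp)
    branch true  = refl
    branch false = refl
  foldRaw-derivative a (E *)   = trans (cong (λ u → eval starₜ (u ∷ [])) (foldRaw-derivative a E))
    (cong₂ (λ u v → u , true , v) (eval-starItems (toItems E))
      (trans (eval-join 3 (toItems (der a E)) (eval starItemsₜ (toItems E ∷ [])))
        (cong (λ v → toItems (der a E) ++ v ++ (3 , 0) ∷ []) (eval-starItems (toItems E)))))

  nullableₜ : Tm (Items ∷ []) bool
  nullableₜ = nullₜ (call interpretₜ (v₀ ∷ lit 0 ∷ []))

  derₜ : Tm (Items ∷ nat ∷ []) Items
  derₜ = dₜ interpretₜ

  eval-nullable : ∀ is → eval nullableₜ (is ∷ []) ≡ nullable (parse is)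
  eval-nullable is = cong (λ t → proj₁ (proj₂ t)) (trans (eval-interpret is 0) (foldRaw-derivative 0 (parse is)))

  parse-der : ∀ is a → parse (eval derₜ (is ∷ a ∷ [])) ≡ der a (parse is)
  parse-der is a = trans (cong (λ t → parse (proj₂ (proj₂ t))) (trans (eval-interpret is a) (foldRaw-derivative a (parse is))))
    (parse-toItems (der a (parse is)))

  matchesₜ : Tm (list nat ∷ Items ∷ []) bool
  matchesₜ = call nullableₜ (foldlₜ v₀ v₁ (call derₜ (v₁ ∷ v₀ ∷ [])) ∷ [])

  eval-matches : ∀ w is → eval matchesₜ (w ∷ is ∷ []) ≡ matches (parse is) w
  eval-matches w is = trans (eval-nullable (foldl (λ js a → eval derₜ (js ∷ a ∷ [])) is w)) (cong nullable (along w is (parse is) refl))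
    where
    along : ∀ w js E → parse js ≡ E → parse (foldl (λ js a → eval derₜ (js ∷ a ∷ [])) js w) ≡ foldl (λ E a → der a E) E w
    along []      js E eq = eq
    along (a ∷ w) js E eq = along w (eval derₜ (js ∷ a ∷ [])) (der a E) (trans (parse-der js a) (cong (der a) eq))

open Derivative using (nullableₜ; eval-nullable; matchesₜ; eval-matches)

codeAlgebraₜ : Algebraₜ (list nat)
codeAlgebraₜ = record
  { chrₜ   = consₜ (lit 0) (consₜ v₀ nilₜ) ; epsₜ = 1 ∷ [] ; empₜ = []
  ; unionₜ = consₜ (lit 2) (appendₜ v₀ v₁) ; catₜ = consₜ (lit 3) (appendₜ v₀ v₁) ; starₜ = consₜ (lit 4) v₀ }

-- Recognises the expressions that come from a `Regex k`, with `k` as the parameter: letters have to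
-- be below `k`, and `emp` is rejected, which is why its value in the algebra of codes is
-- immaterial.
letterAlgebraₜ : Algebraₜ bool
letterAlgebraₜ = record
  { chrₜ   = isZeroₜ (subₜ (sucₜ v₀) v₁) ; epsₜ = true ; empₜ = false
  ; unionₜ = andₜ v₀ v₁ ; catₜ = andₜ v₀ v₁ ; starₜ = v₀ }

prefixCode : Raw → List ℕ
prefixCode = foldRaw (Algebraₜ.algebra codeAlgebraₜ 0)

lettersBelow : ℕ → Raw → Bool
lettersBelow k = foldRaw (Algebraₜ.algebra letterAlgebraₜ k)

code-append : ∀ (u v : List ℕ) {u′ v′ : List ℕ} → u ≡ u′ → v ≡ v′ → eval (appendₜ v₀ v₁) (u ∷ v ∷ []) ≡ u′ ++ v′
code-append u v refl refl = eval-append v₀ v₁ (u ∷ v ∷ [])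

code-toRaw : ∀ {k} (E : Regex k) → prefixCode (toRaw E) ≡ codeRegex E
code-toRaw (chr a) = refl
code-toRaw eps     = refl
code-toRaw (E ∪ F) = cong (2 ∷_) (code-append (prefixCode (toRaw E)) (prefixCode (toRaw F))
  (code-toRaw E) (code-toRaw F))
code-toRaw (E · F) = cong (3 ∷_) (code-append (prefixCode (toRaw E)) (prefixCode (toRaw F))
  (code-toRaw E) (code-toRaw F))
code-toRaw (E *)   = cong (4 ∷_) (code-toRaw E)

letter< : ∀ a k → eval (isZeroₜ (subₜ (sucₜ v₀) v₁)) (a ∷ k ∷ []) ≡ caseN (suc a ∸ k) true (λ _ → false)
letter< a k = cong (λ n → caseN n true (λ _ → false)) (eval-sub (sucₜ v₀) v₁ (a ∷ k ∷ []))

letters-toRaw : ∀ {k} (E : Regex k) → lettersBelow k (toRaw E) ≡ true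
letters-toRaw {k} (chr a) = trans (letter< (toℕ a) k) (cong (λ n → caseN n true (λ _ → false)) (m≤n⇒m∸n≡0 (toℕ<n a)))
letters-toRaw eps     = refl
letters-toRaw (E ∪ F) = and-intro (letters-toRaw E) (letters-toRaw F)
letters-toRaw (E · F) = and-intro (letters-toRaw E) (letters-toRaw F)
letters-toRaw (E *)   = letters-toRaw E

fromRaw : ∀ {k} (E : Raw) → lettersBelow k E ≡ true → ∃ λ (E′ : Regex k) → toRaw E′ ≡ E
fromRaw {k} (chr a) ok = chr (fromℕ< lt) , cong chr (toℕ-fromℕ< lt)
  where
  lt : a < k
  lt = m∸n≡0⇒m≤n (isZero-true (trans (sym (letter< a k)) ok))
fromRaw eps ok = eps , refl
fromRaw {k} (E ∪ F) ok with and-true {lettersBelow k E} ok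
... | p , q with fromRaw E p | fromRaw F q
... | E′ , eq | F′ , eq′ = (E′ ∪ F′) , cong₂ (λ (A B : Raw) → A ∪ B) eq eq′
fromRaw {k} (E · F) ok with and-true {lettersBelow k E} ok
... | p , q with fromRaw E p | fromRaw F q
... | E′ , eq | F′ , eq′ = (E′ · F′) , cong₂ (λ (A B : Raw) → A · B) eq eq′
fromRaw (E *) ok with fromRaw E ok
... | E′ , eq = (E′ *) , cong (λ (A : Raw) → A *) eq

cellAt : List (List ℕ) → ℕ → ℕ → ℕ
cellAt rows i j = nth 0 (nth [] rows i) j

cellₜ : Tm (nat ∷ nat ∷ list (list nat) ∷ []) nat
cellₜ = nthₜ (lit 0) (nthₜ nilₜ v₂ v₀) v₁

eval-cell : ∀ i j rows → eval cellₜ (i ∷ j ∷ rows ∷ []) ≡ cellAt rows i j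
eval-cell i j rows = trans (eval-nth (lit 0) (nthₜ nilₜ v₂ v₀) v₁ (i ∷ j ∷ rows ∷ []))
  (cong (λ r → nth 0 r j) (eval-nth nilₜ v₂ v₀ (i ∷ j ∷ rows ∷ [])))

rowₜ columnₜ : Tm (nat ∷ nat ∷ list (list nat) ∷ []) (list nat)
rowₜ    = mapₜ (upToₜ (sucₜ v₁)) (call cellₜ (v₂ ∷ v₀ ∷ v₄ ∷ []))
columnₜ = mapₜ (upToₜ (sucₜ v₁)) (call cellₜ (v₀ ∷ v₂ ∷ v₄ ∷ []))

map-upTo-tabulate : {A : Set} (g : ℕ → A) (n : ℕ) → map g (upTo n) ≡ tabulate {n = n} (g ∘ toℕ)
map-upTo-tabulate g n = along n id
  where
  along : ∀ k (h : ℕ → ℕ) → map g (applyUpTo h k) ≡ tabulate {n = k} (g ∘ h ∘ toℕ)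
  along zero    h = refl
  along (suc k) h = cong (g (h 0) ∷_) (along k (h ∘ suc))

eval-row : ∀ i n rows → eval rowₜ (i ∷ n ∷ rows ∷ []) ≡ tabulate {n = suc n} (λ j → cellAt rows i (toℕ j))
eval-row i n rows = trans
  (eval-map (upToₜ (sucₜ v₁)) (call cellₜ (v₂ ∷ v₀ ∷ v₄ ∷ [])) (cellAt rows i) (i ∷ n ∷ rows ∷ []) (λ j _ → eval-cell i j rows))
  (trans (cong (map (cellAt rows i)) (eval-upTo (sucₜ v₁) (i ∷ n ∷ rows ∷ []))) (map-upTo-tabulate (cellAt rows i) (suc n)))

eval-column : ∀ j m rows → eval columnₜ (j ∷ m ∷ rows ∷ []) ≡ tabulate {n = suc m} (λ i → cellAt rows (toℕ i) j)
eval-column j m rows = trans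
  (eval-map (upToₜ (sucₜ v₁)) (call cellₜ (v₀ ∷ v₂ ∷ v₄ ∷ [])) (λ i → cellAt rows i j) (j ∷ m ∷ rows ∷ []) (λ i _ → eval-cell i j rows))
  (trans (cong (map (λ i → cellAt rows i j)) (eval-upTo (sucₜ v₁) (j ∷ m ∷ rows ∷ []))) (map-upTo-tabulate (λ i → cellAt rows i j) (suc m)))

allₜ : ∀ {Γ} → Tm Γ nat → Tm (nat ∷ bool ∷ Γ) bool → Tm Γ bool
allₜ n f = foldrₜ (upToₜ n) (lit true) (andₜ f v₁)

allBelow : (ℕ → Bool) → ℕ → Bool
allBelow g n = foldr (λ i b → if g i then b else false) true (upTo n)

eval-all : ∀ {Γ} (n : Tm Γ nat) (f : Tm (nat ∷ bool ∷ Γ) bool) (g : ℕ → Bool) γ →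
  (∀ i b → eval f (i ∷ b ∷ γ) ≡ g i) → eval (allₜ n f) γ ≡ allBelow g (eval n γ)
eval-all n f g γ eq = trans (cong (foldr (λ i b → if eval f (i ∷ b ∷ γ) then b else false) true) (eval-upTo n γ)) (along (upTo (eval n γ)))
  where
  along : ∀ l → foldr (λ i b → if eval f (i ∷ b ∷ γ) then b else false) true l ≡ foldr (λ i b → if g i then b else false) true l
  along []      = refl
  along (i ∷ l) = cong₂ (λ a b → if a then b else false) (eq i _) (along l)

allBelow-sound : ∀ g n → allBelow g n ≡ true → ∀ (i : Fin n) → g (toℕ i) ≡ true
allBelow-sound g n = along n id
  where
  along : ∀ k (h : ℕ → ℕ) → foldr (λ i b → if g i then b else false) true (applyUpTo h k) ≡ true → ∀ (i : Fin k) → g (h (toℕ i)) ≡ true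
  along (suc k) h eq zero    = proj₁ (and-true eq)
  along (suc k) h eq (suc i) = along k (h ∘ suc) (proj₂ (and-true {g (h 0)} eq)) i

allBelow-complete : ∀ g n → (∀ (i : Fin n) → g (toℕ i) ≡ true) → allBelow g n ≡ true
allBelow-complete g n = along n id
  where
  along : ∀ k (h : ℕ → ℕ) → (∀ (i : Fin k) → g (h (toℕ i)) ≡ true) → foldr (λ i b → if g i then b else false) true (applyUpTo h k) ≡ true
  along zero    h eq = refl
  along (suc k) h eq = and-intro (eq zero) (along k (h ∘ suc) (eq ∘ suc))

gridₜ : Tm (nat ∷ nat ∷ list (list nat) ∷ Items ∷ []) bool
gridₜ = andₜ (allₜ (sucₜ v₀) (call matchesₜ (call rowₜ (v₀ ∷ v₃ ∷ v₄ ∷ []) ∷ v₅ ∷ [])))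
             (allₜ (sucₜ v₁) (call matchesₜ (call columnₜ (v₀ ∷ v₂ ∷ v₄ ∷ []) ∷ v₅ ∷ [])))

rowOf columnOf : ℕ → List (List ℕ) → ℕ → List ℕ
rowOf n rows i    = tabulate {n = suc n} (λ j → cellAt rows i (toℕ j))
columnOf m rows j = tabulate {n = suc m} (λ i → cellAt rows (toℕ i) j)

grid : ℕ → ℕ → List (List ℕ) → Raw → Bool
grid m n rows E = if allBelow (λ i → matches E (rowOf n rows i)) (suc m)
  then allBelow (λ j → matches E (columnOf m rows j)) (suc n) else false

eval-grid : ∀ m n rows is → eval gridₜ (m ∷ n ∷ rows ∷ is ∷ []) ≡ grid m n rows (parse is)
eval-grid m n rows is = cong₂ (λ a b → if a then b else false)
  (eval-all (sucₜ v₀) (call matchesₜ (call rowₜ (v₀ ∷ v₃ ∷ v₄ ∷ []) ∷ v₅ ∷ [])) (λ i → matches (parse is) (rowOf n rows i)) (m ∷ n ∷ rows ∷ is ∷ [])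
    (λ i b → trans (eval-matches (eval rowₜ (i ∷ n ∷ rows ∷ [])) is) (cong (matches (parse is)) (eval-row i n rows))))
  (eval-all (sucₜ v₁) (call matchesₜ (call columnₜ (v₀ ∷ v₂ ∷ v₄ ∷ []) ∷ v₅ ∷ [])) (λ j → matches (parse is) (columnOf m rows j)) (m ∷ n ∷ rows ∷ is ∷ [])
    (λ j b → trans (eval-matches (eval columnₜ (j ∷ m ∷ rows ∷ [])) is) (cong (matches (parse is)) (eval-column j m rows))))

map-toℕ-tabulate : ∀ {k n} (f : Fin n → Fin k) (g : ℕ → ℕ) → (∀ i → toℕ (f i) ≡ g (toℕ i)) → map toℕ (tabulate f) ≡ tabulate {n = n} (g ∘ toℕ)
map-toℕ-tabulate f g eq = trans (map-tabulate f toℕ) (tabulate-cong eq)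

grid-complete : ∀ {k} (E : Regex k) m n (A : Fin (suc m) → Fin (suc n) → Fin k) → IsCrossword E E m n A →
  grid m n (tabulate (λ i → tabulate (λ j → toℕ (A i j)))) (toRaw E) ≡ true
grid-complete {k} E m n A (rs , cs) = and-intro
  (allBelow-complete (λ i → matches (toRaw E) (rowOf n rows i)) (suc m) λ i → matches-complete (rowOf n rows (toℕ i)) (subst (_∈R toRaw E)
    (map-toℕ-tabulate (A i) (cellAt rows (toℕ i)) (λ j → sym (cell-≡ i j))) (∈L-∈R (rs i))))
  (allBelow-complete (λ j → matches (toRaw E) (columnOf m rows j)) (suc n) λ j → matches-complete (columnOf m rows (toℕ j)) (subst (_∈R toRaw E)
    (map-toℕ-tabulate (λ i → A i j) (λ i → cellAt rows i (toℕ j)) (λ i → sym (cell-≡ i j))) (∈L-∈R (cs j))))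
  where
  rows : List (List ℕ)
  rows = tabulate (λ i → tabulate (λ j → toℕ (A i j)))
  cell-≡ : ∀ i j → cellAt rows (toℕ i) (toℕ j) ≡ toℕ (A i j)
  cell-≡ i j = trans (cong (λ r → nth 0 r (toℕ j)) (nth-tabulate [] (λ i → tabulate (λ j → toℕ (A i j))) i))
    (nth-tabulate 0 (λ j → toℕ (A i j)) j)

-- The entries are bare numbers; that they are letters below `k` follows from the rows, which match
-- an expression over that alphabet. The columns then match over the same letters because `toℕ` is
-- injective.
grid-sound : ∀ {k} (E : Regex k) m n rows → grid m n rows (toRaw E) ≡ true → CrosswordExists E E
grid-sound {k} E m n rows ok = m , n , A , (λ i → matched (λ j → cellAt rows (toℕ i) (toℕ j)) (rowWord i) (A i) (λ j → proj₂ (letter i j))) ,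
  (λ j → matched (λ i → cellAt rows (toℕ i) (toℕ j)) (columnWord j) (λ i → A i j) (λ i → proj₂ (letter i j)))
  where
  Matched : List ℕ → Set
  Matched v = ∃ λ (w : List (Fin k)) → v ≡ map toℕ w × w ∈L E
  both : allBelow (λ i → matches (toRaw E) (rowOf n rows i)) (suc m) ≡ true ×
         allBelow (λ j → matches (toRaw E) (columnOf m rows j)) (suc n) ≡ true
  both = and-true ok
  rowWord : ∀ (i : Fin (suc m)) → Matched (rowOf n rows (toℕ i))
  rowWord i = ∈R-∈L E (matches-sound (toRaw E) (rowOf n rows (toℕ i))
    (allBelow-sound (λ i → matches (toRaw E) (rowOf n rows i)) (suc m) (proj₁ both) i))
  columnWord : ∀ (j : Fin (suc n)) → Matched (columnOf m rows (toℕ j))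
  columnWord j = ∈R-∈L E (matches-sound (toRaw E) (columnOf m rows (toℕ j))
    (allBelow-sound (λ j → matches (toRaw E) (columnOf m rows j)) (suc n) (proj₂ both) j))
  nth-letter : ∀ {n} (g : Fin n → ℕ) (w : List (Fin k)) → tabulate g ≡ map toℕ w → ∀ j → ∃ λ (a : Fin k) → toℕ a ≡ g j
  nth-letter {suc n} g (a ∷ w) eq zero    = a , sym (∷-injectiveˡ eq)
  nth-letter {suc n} g (a ∷ w) eq (suc j) = nth-letter (g ∘ suc) w (∷-injectiveʳ eq) j
  letter : ∀ i j → ∃ λ (a : Fin k) → toℕ a ≡ cellAt rows (toℕ i) (toℕ j)
  letter i = nth-letter (λ j → cellAt rows (toℕ i) (toℕ j)) (proj₁ (rowWord i)) (proj₁ (proj₂ (rowWord i)))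
  A : Fin (suc m) → Fin (suc n) → Fin k
  A i j = proj₁ (letter i j)
  matched : ∀ {n} (g : Fin n → ℕ) → Matched (tabulate g) → (f : Fin n → Fin k) → (∀ i → toℕ (f i) ≡ g i) → tabulate f ∈L E
  matched g (w , eq , d) f p = subst (_∈L E)
    (map-injective toℕ-injective (trans (sym eq) (trans (tabulate-cong (λ i → sym (p i))) (sym (map-tabulate f toℕ))))) d

Certificate : Ty
Certificate = nat ⊗ Items ⊗ nat ⊗ nat ⊗ list (list nat)

regexCodeₜ : Tm (nat ∷ Items ∷ []) (list bool)
regexCodeₜ = call encNatsₜ (consₜ v₀ (call (Algebraₜ.interpretₜ codeAlgebraₜ) (v₁ ∷ lit 0 ∷ [])) ∷ [])

regexCode : ℕ → Raw → Word
regexCode k E = encNats (k ∷ prefixCode E)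

eval-regexCode : ∀ k is → eval regexCodeₜ (k ∷ is ∷ []) ≡ regexCode k (parse is)
eval-regexCode k is = trans (eval-encNats (k ∷ eval (Algebraₜ.interpretₜ codeAlgebraₜ) (is ∷ 0 ∷ [])))
  (cong (λ l → encNats (k ∷ l)) (Algebraₜ.eval-interpret codeAlgebraₜ is 0))

properₜ : Tm (nat ∷ Items ∷ []) bool
properₜ = andₜ (call (Algebraₜ.interpretₜ letterAlgebraₜ) (v₁ ∷ v₀ ∷ [])) (ifₜ (call nullableₜ (v₁ ∷ [])) (lit false) (lit true))

proper : ℕ → Raw → Bool
proper k E = if lettersBelow k E then (if nullable E then false else true) else false

eval-proper : ∀ k is → eval properₜ (k ∷ is ∷ []) ≡ proper k (parse is)
eval-proper k is = cong₂ (λ a b → if a then (if b then false else true) else false)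
  (Algebraₜ.eval-interpret letterAlgebraₜ is k) (eval-nullable is)

-- Besides the grid the certificate contains the alphabet size and the expression, to be encoded and
-- compared with the instance. Positivity requires no evidence of its own, since nullability is
-- computed.
crosswordCheckₜ : Tm (Certificate ∷ list bool ∷ []) bool
crosswordCheckₜ = andₜ (call eqWordₜ (v₁ ∷ call regexCodeₜ (fstₜ v₀ ∷ fstₜ (sndₜ v₀) ∷ []) ∷ []))
  (andₜ (call properₜ (fstₜ v₀ ∷ fstₜ (sndₜ v₀) ∷ []))
    (call gridₜ (fstₜ (sndₜ (sndₜ v₀)) ∷ fstₜ (sndₜ (sndₜ (sndₜ v₀))) ∷ sndₜ (sndₜ (sndₜ (sndₜ v₀))) ∷ fstₜ (sndₜ v₀) ∷ [])))

eval-crosswordCheck : ∀ k is m n rows x → eval crosswordCheckₜ ((k , is , m , n , rows) ∷ x ∷ []) ≡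
  (if eval eqWordₜ (x ∷ regexCode k (parse is) ∷ []) then (if proper k (parse is) then grid m n rows (parse is) else false) else false)
eval-crosswordCheck k is m n rows x = cong₂ (λ a b → if a then b else false)
  (cong (λ v → eval eqWordₜ (x ∷ v ∷ [])) (eval-regexCode k is))
  (cong₂ (λ a b → if a then b else false) (eval-proper k is) (eval-grid m n rows is))

crossword-semidecidable : SemiDecidable CrosswordProblem
crossword-semidecidable = proj₁ semi , λ x → (λ p → proj₁ (proj₂ semi x) (certificate x p)) , λ h → certified x (proj₂ (proj₂ semi x) h)
  where
  Certified : Word → Set
  Certified x = ∃ λ (v : Val Certificate) → eval crosswordCheckₜ (v ∷ x ∷ []) ≡ true
  semi : SemiDecidable Certified
  semi = exists-semidecidable Certificate crosswordCheckₜ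
  certificate : ∀ x → CrosswordProblem x → Certified x
  certificate x (k , E , eq , pos , m , n , A , ok) = (k , toItems (toRaw E) , m , n , rows) ,
    trans (eval-crosswordCheck k (toItems (toRaw E)) m n rows x) (trans (cong verdict (parse-toItems (toRaw E)))
      (and-intro (trans (cong (λ v → eval eqWordₜ (x ∷ v ∷ [])) (trans (cong (λ l → encNats (k ∷ l)) (code-toRaw E)) (sym eq))) (eqWord-refl x))
        (and-intro (and-intro (letters-toRaw E) (not-nullable (toRaw E) refl)) (grid-complete E m n A ok))))
    where
    rows : List (List ℕ)
    rows = tabulate (λ i → tabulate (λ j → toℕ (A i j)))
    verdict : Raw → Bool
    verdict E = if eval eqWordₜ (x ∷ regexCode k E ∷ []) then (if proper k E then grid m n rows E else false) else false
    not-nullable : ∀ E′ → E′ ≡ toRaw E → (if nullable E′ then false else true) ≡ true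
    not-nullable E′ refl with nullable (toRaw E) in e
    ... | false = refl
    ... | true with ∈R-∈L E (nullable-sound (toRaw E) e)
    ...   | [] , _ , d = ⊥-elim (pos d)
  certified : ∀ x → Certified x → CrosswordProblem x
  certified x ((k , is , m , n , rows) , ok) with and-true {eval eqWordₜ (x ∷ regexCode k (parse is) ∷ [])} (trans (sym (eval-crosswordCheck k is m n rows x)) ok)
  ... | same , ok₁ with and-true {proper k (parse is)} ok₁
  ... | pr , gr with and-true {lettersBelow k (parse is)} pr
  ... | ls , nn with fromRaw {k} (parse is) ls
  ... | E , eq = k , E ,
    trans (eqWord-sound x (regexCode k (parse is)) same) (trans (cong (regexCode k) (sym eq)) (cong (λ l → encNats (k ∷ l)) (code-toRaw E))) ,
    (λ d → positive (trans (cong nullable (sym eq)) (nullable-complete (∈L-∈R d) refl)) nn) ,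
    grid-sound E m n rows (trans (cong (grid m n rows) eq) gr)
    where
    positive : ∀ {b} → b ≡ true → (if b then false else true) ≢ true
    positive refl ()

-- Reductions

natBits-injective : ∀ m n {u v} → natBits m ++ u ≡ natBits n ++ v → m ≡ n × u ≡ v
natBits-injective zero    zero    eq = refl , ∷-injectiveʳ eq
natBits-injective zero    (suc n) eq with () ← ∷-injectiveˡ eq
natBits-injective (suc m) zero    eq with () ← ∷-injectiveˡ eq
natBits-injective (suc m) (suc n) eq with natBits-injective m n (∷-injectiveʳ eq)
... | refl , p = refl , p

encNats-injective : ∀ xs ys → encNats xs ≡ encNats ys → xs ≡ ys
encNats-injective []       []       eq = refl
encNats-injective []       (zero ∷ ys)  ()
encNats-injective []       (suc _ ∷ ys) ()
encNats-injective (zero ∷ xs)  []   ()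
encNats-injective (suc _ ∷ xs) []   ()
encNats-injective (x ∷ xs) (y ∷ ys) eq with natBits-injective x y eq
... | refl , p = cong (x ∷_) (encNats-injective xs ys p)

-- The tails `u` and `v` carry the induction: prefix codes are self-delimiting, so after the code of
-- the left operand the code of the right one is still aligned.
codeRegex-injective : ∀ {k} (E F : Regex k) {u v} → codeRegex E ++ u ≡ codeRegex F ++ v → E ≡ F × u ≡ v
codeRegex-injective (chr a) (chr b) eq with toℕ-injective (∷-injectiveˡ (∷-injectiveʳ eq))
... | refl = refl , ∷-injectiveʳ (∷-injectiveʳ eq)
codeRegex-injective eps eps eq = refl , ∷-injectiveʳ eq
codeRegex-injective (E ∪ F) (E′ ∪ F′) {u} {v} eq
  with codeRegex-injective E E′ (trans (sym (++-assoc (codeRegex E) (codeRegex F) u))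
    (trans (∷-injectiveʳ eq) (++-assoc (codeRegex E′) (codeRegex F′) v)))
... | refl , eq′ with codeRegex-injective F F′ eq′
...   | refl , p = refl , p
codeRegex-injective (E · F) (E′ · F′) {u} {v} eq
  with codeRegex-injective E E′ (trans (sym (++-assoc (codeRegex E) (codeRegex F) u))
    (trans (∷-injectiveʳ eq) (++-assoc (codeRegex E′) (codeRegex F′) v)))
... | refl , eq′ with codeRegex-injective F F′ eq′
...   | refl , p = refl , p
codeRegex-injective (E *) (F *) eq with codeRegex-injective E F (∷-injectiveʳ eq)
... | refl , p = refl , p

encRegex-injective : ∀ k (E : Regex k) k′ (E′ : Regex k′) → encRegex k E ≡ encRegex k′ E′ → (k , E) ≡ (k′ , E′)
encRegex-injective k E k′ E′ eq with encNats-injective (k ∷ codeRegex E) (k′ ∷ codeRegex E′) eq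
... | eq′ with ∷-injectiveˡ eq′
... | refl with codeRegex-injective E E′ (trans (++-identityʳ (codeRegex E)) (trans (∷-injectiveʳ eq′) (sym (++-identityʳ (codeRegex E′)))))
... | refl , _ = refl

codeMove-injective : ∀ m n → codeMove m ≡ codeMove n → m ≡ n
codeMove-injective L L eq = refl
codeMove-injective R R eq = refl

codeEntry-injective : ∀ {q s} (x y : Maybe (Fin q × Fin s × Move)) {u v} → codeEntry x ++ u ≡ codeEntry y ++ v → x ≡ y × u ≡ v
codeEntry-injective nothing nothing eq = refl , ∷-injectiveʳ eq
codeEntry-injective nothing (just _) eq with () ← ∷-injectiveˡ eq
codeEntry-injective (just _) nothing eq with () ← ∷-injectiveˡ eq
codeEntry-injective (just (q , a , m)) (just (q′ , a′ , m′)) eq with ∷-injectiveʳ eq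
... | eq₁ with toℕ-injective (∷-injectiveˡ eq₁) | ∷-injectiveʳ eq₁
... | refl | eq₂ with toℕ-injective (∷-injectiveˡ eq₂) | ∷-injectiveʳ eq₂
... | refl | eq₃ with codeMove-injective m m′ (∷-injectiveˡ eq₃)
... | refl = refl , ∷-injectiveʳ eq₃

-- The predicate `P` stands for what the codes of one block reveal. For transition tables the lemma
-- is nested: for the outer blocks `P q` is agreement of the whole row of `q`, itself obtained from
-- the lemma.
concatMap-injective : ∀ {X : Set} {P : X → Set} (f g : X → List ℕ) →
  (∀ x {u v} → f x ++ u ≡ g x ++ v → P x × u ≡ v) →
  ∀ {n} (h : Fin n → X) {u v} → concatMap f (tabulate h) ++ u ≡ concatMap g (tabulate h) ++ v → (∀ i → P (h i)) × u ≡ v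
concatMap-injective f g inj {zero}  h eq = (λ ()) , eq
concatMap-injective {P = P} f g inj {suc n} h {u} {v} eq
  with inj (h zero) (trans (sym (++-assoc (f (h zero)) (concatMap f (tabulate (h ∘ suc))) u))
    (trans eq (++-assoc (g (h zero)) (concatMap g (tabulate (h ∘ suc))) v)))
... | p , eq′ with concatMap-injective {P = P} f g inj (h ∘ suc) eq′
... | ps , q = (λ { zero → p ; (suc i) → ps i }) , q

codeBit-injective : ∀ {b c} → codeBit b ≡ codeBit c → b ≡ c
codeBit-injective {false} {false} eq = refl
codeBit-injective {true}  {true}  eq = refl

tables-injective : ∀ nQ e (δ δ′ : Fin (suc nQ) → Fin (3 + e) → Maybe (Fin (suc nQ) × Fin (3 + e) × Move)) {u v} →
  concatMap (λ q → concatMap (λ x → codeEntry (δ q x)) (allFin (3 + e))) (allFin (suc nQ)) ++ u ≡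
  concatMap (λ q → concatMap (λ x → codeEntry (δ′ q x)) (allFin (3 + e))) (allFin (suc nQ)) ++ v →
  (∀ q x → δ q x ≡ δ′ q x) × u ≡ v
tables-injective nQ e δ δ′ = concatMap-injective {P = λ q → ∀ x → δ q x ≡ δ′ q x} _ _
  (λ q → concatMap-injective {P = λ x → δ q x ≡ δ′ q x} _ _ (λ x → codeEntry-injective (δ q x) (δ′ q x)) id) id

-- Machines with the same code agree pointwise, hence are described by the same table.
encPair-halts : ∀ M w M′ w′ → encPair M w ≡ encPair M′ w′ → HaltsOn M′ w′ → HaltsOn M w
encPair-halts M w M′ w′ eq = sameCode M M′ (encNats-injective (codeTM M ++ inputCode w) (codeTM M′ ++ inputCode w′) eq)
  where
  sameδ : ∀ nQ e (δ δ′ : Fin (suc nQ) → Fin (3 + e) → Maybe (Fin (suc nQ) × Fin (3 + e) × Move)) → (∀ q x → δ q x ≡ δ′ q x) → ∀ w →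
    HaltsOn (record { nQ = nQ ; extra = e ; δ = δ′ }) w → HaltsOn (record { nQ = nQ ; extra = e ; δ = δ }) w
  sameδ nQ e δ δ′ same w (n , h) = n , S.true-halted (run M₁ n (initial M₁ w))
    (trans (cong (λ c → eval haltedₜ (c ∷ S.D ∷ [])) (trans (sym (S.eval-run n w)) (S′.eval-run n w)))
      (S′.halted-true (run M₂ n (initial M₂ w)) h))
    where
    M₁ M₂ : TM
    M₁ = record { nQ = nQ ; extra = e ; δ = δ }
    M₂ = record { nQ = nQ ; extra = e ; δ = δ′ }
    module S  = Simulation M₁ (tableOf M₁) (tableOf-Describes M₁)
    module S′ = Simulation M₂ (tableOf M₁) (λ q x → trans (tableOf-Describes M₁ q x) (cong numbers (same q x)))
  sameCode : ∀ M M′ → codeTM M ++ inputCode w ≡ codeTM M′ ++ inputCode w′ → HaltsOn M′ w′ → HaltsOn M w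
  sameCode record { nQ = nQ ; extra = e ; δ = δ } record { nQ = nQ′ ; extra = e′ ; δ = δ′ } eq
    with ∷-injectiveˡ eq | ∷-injectiveˡ (∷-injectiveʳ eq)
  ... | refl | refl with tables-injective nQ e δ δ′ (∷-injectiveʳ (∷-injectiveʳ eq))
  ... | same , ws with map-injective codeBit-injective {w} {w′} (∷-injectiveʳ ws)
  ... | refl = sameδ nQ e δ δ′ same w

halting-encPair : ∀ M w → HaltingProblem (encPair M w) → HaltsOn M w
halting-encPair M w (M′ , w′ , eq , h) = encPair-halts M w M′ w′ eq h

crossword-encRegex : ∀ k (E : Regex k) → CrosswordProblem (encRegex k E) → CrosswordExists E E
crossword-encRegex k E (k′ , E′ , eq , _ , c) with encRegex-injective k E k′ E′ eq
... | refl = c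

computable-≗ : ∀ {f g : Word → Word} → (∀ w → f w ≡ g w) → Computable f → Computable g
computable-≗ eq (M , c) = M , λ w → proj₁ (c w) , proj₁ (proj₂ (c w)) , trans (proj₂ (proj₂ (c w))) (eq w)

-- The machine is fixed, so its table is a literal in the program and only the input varies.
-- Injectivity of the encoding prevents another pair with the same code from making an instance
-- positive by accident.
semidecidable-≤-halting : ∀ {A : Problem} → SemiDecidable A → A ≤m HaltingProblem
semidecidable-≤-halting (M , spec) = encPair M ,
  computable-≗ (eval-pairCode M (tableOf M) (tableOf-Describes M))
    (Tm-computable (call pairCodeₜ (lit (tableOf M , TM.nQ M , TM.extra M) ∷ v₀ ∷ []))) ,
  λ w → (λ a → M , w , refl , proj₁ (spec w) a) , λ h → proj₂ (spec w) (halting-encPair M w h)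

module CrosswordReduction (M : TM) where
  open CrosswordOf M
  open Rows M
  open Correctness M

  firstIndex : Content → ℕ
  firstIndex c = toℕ ⌜ first c ⌝

  blanksCode : List ℕ
  blanksCode = codeRegex (blankR *)

  symsCodeₜ : Tm (list bool ∷ []) (list nat)
  symsCodeₜ = foldrₜ v₀ (lit blanksCode) (consₜ (lit 3) (consₜ (lit 0) (consₜ
    (ifₜ v₀ (lit (firstIndex (plain (bitSym M true)))) (lit (firstIndex (plain (bitSym M false))))) v₁)))

  eval-symsCode : ∀ w → eval symsCodeₜ (w ∷ []) ≡ codeRegex (symsR w)
  eval-symsCode []          = refl
  eval-symsCode (false ∷ w) = cong (λ l → 3 ∷ 0 ∷ firstIndex (plain (bitSym M false)) ∷ l) (eval-symsCode w)
  eval-symsCode (true ∷ w)  = cong (λ l → 3 ∷ 0 ∷ firstIndex (plain (bitSym M true)) ∷ l) (eval-symsCode w)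

  headedCodeₜ : Tm (list bool ∷ []) (list nat)
  headedCodeₜ = consₜ (lit 3) (consₜ (lit 0) (caseLₜ v₀
    (lit (firstIndex (headed zero zero) ∷ blanksCode))
    (consₜ (ifₜ v₀ (lit (firstIndex (headed zero (bitSym M true)))) (lit (firstIndex (headed zero (bitSym M false)))))
      (call symsCodeₜ (v₁ ∷ [])))))

  eval-headedCode : ∀ w → eval headedCodeₜ (w ∷ []) ≡ codeRegex (chr ⌜ first (headed zero (headSym w)) ⌝ · tailR w)
  eval-headedCode []          = refl
  eval-headedCode (false ∷ w) = cong (λ l → 3 ∷ 0 ∷ firstIndex (headed zero (bitSym M false)) ∷ l) (eval-symsCode w)
  eval-headedCode (true ∷ w)  = cong (λ l → 3 ∷ 0 ∷ firstIndex (headed zero (bitSym M true)) ∷ l) (eval-symsCode w)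

  -- The tags 3 and 0 stand for concatenation and letter. As `topR w` is nested to the right, its
  -- prefix code begins with this constant part, and everything that depends on `w` follows it.
  topPrefix : List ℕ
  topPrefix = 3 ∷ 0 ∷ toℕ ⌜ corner ⌝ ∷ 3 ∷ 0 ∷ toℕ ⌜ wallTop ⌝ ∷ 3 ∷ blanksCode

  reductionₜ : Tm (list bool ∷ []) (list bool)
  reductionₜ = call encNatsₜ (consₜ (lit letters) (consₜ (lit 2)
    (appendₜ (appendₜ (lit topPrefix) (call headedCodeₜ (v₀ ∷ []))) (lit (codeRegex fixedR)))) ∷ [])

  eval-reduction : ∀ w → eval reductionₜ (w ∷ []) ≡ encRegex letters (crosswordR w)
  eval-reduction w = trans (eval-encNats (letters ∷ 2 ∷ eval wholeₜ (w ∷ [])))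
    (cong (λ l → encNats (letters ∷ 2 ∷ l)) (trans (eval-append topₜ (lit (codeRegex fixedR)) (w ∷ []))
      (cong (_++ codeRegex fixedR) (trans (eval-append (lit topPrefix) (call headedCodeₜ (v₀ ∷ [])) (w ∷ []))
        (cong (topPrefix ++_) (eval-headedCode w))))))
    where
    topₜ wholeₜ : Tm (list bool ∷ []) (list nat)
    topₜ   = appendₜ (lit topPrefix) (call headedCodeₜ (v₀ ∷ []))
    wholeₜ = appendₜ topₜ (lit (codeRegex fixedR))

  reduces : ∀ w → (HaltsOn M w → CrosswordProblem (encRegex letters (crosswordR w))) ×
                  (CrosswordProblem (encRegex letters (crosswordR w)) → HaltsOn M w)
  reduces w = (λ h → letters , crosswordR w , refl , crosswordR-positive w , halts-crossword w h) ,
    λ c → crossword-halts w (crossword-encRegex letters (crosswordR w) c)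

semidecidable-≤-crossword : ∀ {A : Problem} → SemiDecidable A → A ≤m CrosswordProblem
semidecidable-≤-crossword (M , spec) = (λ w → encRegex letters (crosswordR w)) ,
  computable-≗ eval-reduction (Tm-computable reductionₜ) ,
  λ w → (λ a → proj₁ (reduces w) (proj₁ (spec w) a)) , λ c → proj₂ (spec w) (proj₂ (reduces w) c)
  where
  open CrosswordOf M using (letters; crosswordR)
  open CrosswordReduction M

-- Undecidability of the crossword problem

halted-unique : ∀ M m n c → Halted M (run M m c) → Halted M (run M n c) → run M m c ≡ run M n c
halted-unique M m n c h h′ = trans (sym (halted-run M n (run M m c) h))
  (trans (sym (run-+ M m n c)) (trans (cong (λ k → run M k c) (+-comm m n)) (trans (run-+ M n m c) (halted-run M m (run M n c) h′))))

-- The diagonal argument: machine P halts on x iff the alleged decider answers false to "x, as a code, halts on x".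
crossword-undecidable : ¬ Decidable CrosswordProblem
crossword-undecidable (d , (D , computes) , decides) = diverges (halts-if-not diverges)
  where
  U : TM
  U = proj₁ halting-semidecidable
  open CrosswordReduction U

  g : Word → Word
  g y = eval reductionₜ (y ∷ [])

  g-spec : ∀ y → (HaltingProblem y → CrosswordProblem (g y)) × (CrosswordProblem (g y) → HaltingProblem y)
  g-spec y = (λ h → subst CrosswordProblem (sym (eval-reduction y)) (proj₁ (reduces y) (proj₁ (proj₂ halting-semidecidable y) h))) ,
    λ c → proj₂ (proj₂ halting-semidecidable y) (proj₂ (reduces y) (subst CrosswordProblem (eval-reduction y) c))

  module S = Simulation D (tableOf D) (tableOf-Describes D)

  -- `encNats` turns concatenation into concatenation. So if `x` is the code of a machine, the code
  -- of this machine on input `x` is `x` followed by the code of `x` as an input, which is computed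
  -- without decoding `x`.
  selfₜ : Tm (list bool ∷ []) (list bool)
  selfₜ = appendₜ v₀ (call encNatsₜ (call inputCodeₜ (v₀ ∷ []) ∷ []))

  -- Symbol 1 is the bit false, so looking at the cell under the head of the halted decider tells
  -- the answers `[ true ]` and `[ false ]` apart.
  answerₜ : Tm (Configᵗ ∷ []) bool
  answerₜ = andₜ (call haltedₜ (v₀ ∷ lit S.D ∷ [])) (call sameₜ (#3 v₀ ∷ lit 1 ∷ []))

  rejectsₜ : Tm (nat ∷ list bool ∷ []) bool
  rejectsₜ = call answerₜ (call runₜ (v₀ ∷ call reductionₜ (call selfₜ (v₁ ∷ []) ∷ []) ∷ lit S.D ∷ []) ∷ [])

  P-semidecidable : SemiDecidable (λ x → ∃ λ n → eval rejectsₜ (n ∷ x ∷ []) ≡ true)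
  P-semidecidable = exists-semidecidable nat rejectsₜ

  P : TM
  P = proj₁ P-semidecidable

  x₀ y₀ : Word
  x₀ = encNats (codeTM P)
  y₀ = encPair P x₀

  self-≡ : eval selfₜ (x₀ ∷ []) ≡ y₀
  self-≡ = trans (eval-append v₀ (call encNatsₜ (call inputCodeₜ (v₀ ∷ []) ∷ [])) (x₀ ∷ []))
    (trans (cong (x₀ ++_) (trans (eval-encNats (eval inputCodeₜ (x₀ ∷ []))) (cong encNats (eval-inputCode x₀))))
      (sym (concatMap-++ natBits (codeTM P) (inputCode x₀))))

  result : ℕ → Config D
  result n = run D n (initial D (g y₀))

  rejects-≡ : ∀ n → eval rejectsₜ (n ∷ x₀ ∷ []) ≡ eval answerₜ (S.raw (result n) ∷ [])
  rejects-≡ n = trans (cong (λ y → eval answerₜ (eval runₜ (n ∷ g y ∷ S.D ∷ []) ∷ [])) self-≡)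
    (cong (λ c → eval answerₜ (c ∷ [])) (S.eval-run n (g y₀)))

  false-output : ∀ c → toℕ (Config.head c) ≡ 1 → output D c ≢ [ true ]
  false-output (cfg q l (suc zero) r) eq ()

  output-false : ∀ c → output D c ≡ [ false ] → toℕ (Config.head c) ≡ 1
  output-false (cfg q l (suc zero) r) eq = refl
  output-false (cfg q l (suc (suc zero)) r) ()
  output-false (cfg q l (suc (suc (suc _))) r) ()

  final : ∃ λ N → Halted D (result N) × output D (result N) ≡ d (g y₀)
  final = computes (g y₀)

  -- The search may have caught the decider at a later time than the one for which its output is
  -- known; by `halted-unique` the two halted configurations coincide.
  rejected : ∀ n → eval answerₜ (S.raw (result n) ∷ []) ≡ true → d (g y₀) ≢ [ true ]
  rejected n ok accept = false-output (result n) head≡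
    (trans (cong (output D) (halted-unique D n (proj₁ final) (initial D (g y₀)) halted (proj₁ (proj₂ final))))
      (trans (proj₂ (proj₂ final)) accept))
    where
    both : eval haltedₜ (S.raw (result n) ∷ S.D ∷ []) ≡ true × eval sameₜ (toℕ (Config.head (result n)) ∷ 1 ∷ []) ≡ true
    both = and-true ok
    halted : Halted D (result n)
    halted = S.true-halted (result n) (proj₁ both)
    head≡ : toℕ (Config.head (result n)) ≡ 1
    head≡ = same-sound (toℕ (Config.head (result n))) 1 (proj₂ both)

  diverges : ¬ HaltsOn P x₀
  diverges h = refuted (proj₂ (proj₂ P-semidecidable x₀) h)
    where
    refuted : ¬ (∃ λ n → eval rejectsₜ (n ∷ x₀ ∷ []) ≡ true)
    refuted (n , ok) = rejected n (trans (sym (rejects-≡ n)) ok)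
      (proj₁ (decides (g y₀)) (proj₁ (g-spec y₀) (P , x₀ , refl , h)))

  -- The decider is specified only where membership or its negation is known. Since `diverges` is
  -- proved outright, the negation is available here, and no excluded middle is required.
  halts-if-not : ¬ HaltsOn P x₀ → HaltsOn P x₀
  halts-if-not no-halt = proj₁ (proj₂ P-semidecidable x₀) (N , trans (rejects-≡ N) (and-intro
      (S.halted-true (result N) (proj₁ (proj₂ final)))
      (trans (cong (λ a → eval sameₜ (a ∷ 1 ∷ [])) (output-false (result N) (trans (proj₂ (proj₂ final)) answer))) (same-refl 1))))
    where
    N : ℕ
    N = proj₁ final
    answer : d (g y₀) ≡ [ false ]
    answer = proj₂ (decides (g y₀)) (λ c → no-halt (halting-encPair P x₀ (proj₂ (g-spec y₀) c)))

theorem3p5 : (¬ Decidable CrosswordProblem) × (CrosswordProblem ≡m HaltingProblem)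
theorem3p5 = crossword-undecidable ,
  (semidecidable-≤-halting crossword-semidecidable , semidecidable-≤-crossword halting-semidecidable)
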